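{- There exists a constant $c$ such that the following holds for every natural number $d$ and every real number $\alpha \le \frac{1}{2}$ (with $\alpha>0$). For every natural number $n \ge \alpha^{ -cd^2}$, if $G$ is a graph with at least $\alpha^{ -cd} n$ vertices and density at least $\alpha$, then $G$ is universal for the family of $d$-degenerate bipartite graphs on $n$ vertices.
   Context: The density of a graph is the fraction of pairs of distinct vertices that form an edge. A graph is $d$-degenerate if every subgraph of it has a vertex of degree at most $d$. A graph $G$ is universal for a family $\mathcal{F}$ of graphs if it contains every $F\in\mathcal{F}$ as a (not necessarily induced) subgraph.
   Formalization: The density parameter α ranges over rational numbers with 0 < α ≤ 1/2 instead of real numbers; the real version follows with the constant c doubled, by choosing a rational between α² and α. -}

module Defs where

open import Data.Nat using (ℕ; zero; suc; _+_; _*_; _∸_; _≤_)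
open import Data.Fin using (Fin; zero; suc)
open import Data.Bool using (Bool; true; false; _∧_; if_then_else_)
open import Data.Integer using (+_)
open import Data.Rational using (ℚ; _/_) renaming (_*_ to _*ℚ_)
open import Data.Product using (Σ; ∃; _×_; _,_)
open import Relation.Binary.PropositionalEquality using (_≡_; _≢_)
open import Function.Definitions using (Injective)

record Graph (N : ℕ) : Set where
  field
    adj    : Fin N → Fin N → Bool
    adj-sym : ∀ i j → adj i j ≡ adj j i
    loopless : ∀ i → adj i i ≡ false
open Graph public

count : ∀ {n} → (Fin n → Bool) → ℕ
count {zero} p = 0
count {suc n} p = (if p zero then 1 else 0) + count (λ i → p (suc i))

orderedEdgeCount : ∀ {N} → Graph N → ℕ
orderedEdgeCount {zero} G = 0
orderedEdgeCount {suc N} G = go (λ i → count (adj G i))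
  where
  go : ∀ {m} → (Fin m → ℕ) → ℕ
  go {zero} f = 0
  go {suc m} f = f zero + go (λ i → f (suc i))

ℕ→ℚ : ℕ → ℚ
ℕ→ℚ n = (+ n) / 1

pow : ℚ → ℕ → ℚ
pow q zero = (+ 1) / 1
pow q (suc k) = q *ℚ pow q k

-- density of G is at least α :  |E(G)| ≥ α * (N choose 2),
-- written with ordered pairs:  2|E(G)| ≥ α * N * (N - 1)
DensityAtLeast : ∀ {N} → ℚ → Graph N → Set
DensityAtLeast {N} α G =
  Data.Rational._≤_ (α *ℚ ℕ→ℚ (N * (N ∸ 1))) (ℕ→ℚ (orderedEdgeCount G))

NonEmpty : ∀ {n} → (Fin n → Bool) → Set
NonEmpty S = ∃ λ v → S v ≡ true

degIn : ∀ {n} → Graph n → (Fin n → Bool) → Fin n → ℕ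
degIn H S v = count (λ u → S u ∧ adj H v u)

Degenerate : ℕ → ∀ {n} → Graph n → Set
Degenerate d {n} H =
  (S : Fin n → Bool) → NonEmpty S →
  ∃ λ v → (S v ≡ true) × (degIn H S v ≤ d)

Bipartite : ∀ {n} → Graph n → Set
Bipartite {n} H = Σ (Fin n → Bool) λ col →
  ∀ u v → adj H u v ≡ true → col u ≢ col v

SubgraphOf : ∀ {n N} → Graph n → Graph N → Set
SubgraphOf {n} {N} F G = Σ (Fin n → Fin N) λ f →
  Injective _≡_ _≡_ f × (∀ u v → adj F u v ≡ true → adj G (f u) (f v) ≡ true)

UniversalDegBip : ℕ → (n : ℕ) → ∀ {N} → Graph N → Set
UniversalDegBip d n G =
  (F : Graph n) → Degenerate d F → Bipartite F → SubgraphOf F G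

-- Let t = 4d and a = 2d. Fix two t-tuples T₀, T₁ of vertices of G that span a complete bipartite graph,
-- and embed the two colour classes of F into their common neighbourhoods along a degeneracy order,
-- sending each vertex v to a uniformly random candidate, that is, a common neighbour of T₀ (or T₁) and
-- of the images of the at most d earlier neighbours of v. Let X_v be N divided by the number of candidates.
--
-- Averaging over the at least α^(O(d²)) N^(2t) choices of (T₀, T₁), some choice makes the t-th moment of X
-- over uniform tuples of at most d vertices on the other side at most K = α^(-O(d²)). The images of the
-- earlier neighbours u of v have density at most Y = ∏ X_u with respect to the uniform distribution, so
-- X_v^a ≤ λ X_v^(2a) / Y + Y / λ and Y ≤ 1 + ∑ X_u^a yield E[X_v^a] ≤ 4(d + 1)K by induction along the order.
-- Hence typically ∑ X_v is O(α^(-O(d)) n), and every vertex has at least N^(1/4) candidates.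
--
-- If ∑ X_v is at most a small multiple of N, an exponential moment bound and a union bound over the at most
-- N^d sets of candidates show that the images occupy at most half of each of these sets. So every vertex
-- can be sent to an unused candidate, at the cost of a factor 2 in the probabilities.

module Submission where

-- The obstacle is a circularity: the moments are known for uniform tuples, but the images follow
-- the process, and their density Y is a product of earlier X_u, the very quantities to be bounded.
-- With λ = 2(d + 1) the term Y / λ returns at most half of the bound, so the induction closes with
-- a constant that does not depend on the position in the order. Passing from X_v^a to X_v^(2a)
-- forces t = 2a. The exponent a is at least d, so that a product of at most d factors is at most
-- the a-th power of the largest, and at least 2, so that the bound on ∑ X_u^a, which is linear in
-- n, bounds each X_v by O(√n) up to powers of 1/α; together with n ≥ α^(-400d²) this leaves N^(1/4)
-- candidates. Since a is proportional to d, K = α^(-O(d²)) has the a-th root α^(-O(d)), which is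
-- the admissible ratio N / n. Each X_v is rounded to an integer because the sum of these numbers
-- serves as an exponent in the exponential moment bound.

open import Defs

-- Rational inequalities, powers and reciprocals.

module Rationals where

  open import Data.Nat as ℕ using (ℕ; zero; suc; z≤n; s≤s)
  import Data.Nat.Properties as ℕ
  import Data.Integer as ℤ
  import Data.Integer.Properties as ℤ
  open import Data.Nat.Coprimality using (1-coprimeTo) renaming (sym to coprime-sym)
  open import Data.Rational
  open import Data.Rational.Properties
  open import Data.Rational.Unnormalised as ℚᵘ using (mkℚᵘ; *≡*)
  import Data.Rational.Unnormalised.Properties as ℚᵘ
  open import Data.Rational.Solver using (module +-*-Solver)
  open import Relation.Binary.PropositionalEquality

  *-nonneg : ∀ {p q} → 0ℚ ≤ p → 0ℚ ≤ q → 0ℚ ≤ p * q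
  *-nonneg {p} {q} 0≤p 0≤q =
    subst (_≤ p * q) (*-zeroʳ p) (*-monoˡ-≤-nonNeg p {{nonNegative 0≤p}} 0≤q)

  *-mono-≤₀ : ∀ {p q r s} → 0ℚ ≤ p → 0ℚ ≤ r → p ≤ q → r ≤ s → p * r ≤ q * s
  *-mono-≤₀ {p} {q} {r} {s} 0≤p 0≤r p≤q r≤s = ≤-trans
    (*-monoʳ-≤-nonNeg r {{nonNegative 0≤r}} p≤q)
    (*-monoˡ-≤-nonNeg q {{nonNegative (≤-trans 0≤p p≤q)}} r≤s)

  *-monoˡ : ∀ {p q r} → 0ℚ ≤ r → p ≤ q → r * p ≤ r * q
  *-monoˡ {r = r} 0≤r = *-monoˡ-≤-nonNeg r {{nonNegative 0≤r}}

  *-monoʳ : ∀ {p q r} → 0ℚ ≤ r → p ≤ q → p * r ≤ q * r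
  *-monoʳ {r = r} 0≤r = *-monoʳ-≤-nonNeg r {{nonNegative 0≤r}}

  *-monoʳ-< : ∀ {p q r} → 0ℚ < r → p < q → p * r < q * r
  *-monoʳ-< {r = r} 0<r = *-monoˡ-<-pos r {{positive 0<r}}

  *-pos : ∀ {p q} → 0ℚ < p → 0ℚ < q → 0ℚ < p * q
  *-pos {p} {q} 0<p 0<q =
    positive⁻¹ (p * q) {{pos*pos⇒pos p {{positive 0<p}} q {{positive 0<q}}}}

  *-cancelˡ-≤₀ : ∀ {p q r} → 0ℚ < r → r * p ≤ r * q → p ≤ q
  *-cancelˡ-≤₀ {r = r} 0<r = *-cancelˡ-≤-pos r {{positive 0<r}}

  *-cancelˡ-<₀ : ∀ {p q r} → 0ℚ ≤ r → r * p < r * q → p < q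
  *-cancelˡ-<₀ {r = r} 0≤r = *-cancelˡ-<-nonNeg r {{nonNegative 0≤r}}

  +-nonneg : ∀ {p q} → 0ℚ ≤ p → 0ℚ ≤ q → 0ℚ ≤ p + q
  +-nonneg = +-mono-≤

  ≤-+ˡ : ∀ {p q} → 0ℚ ≤ q → p ≤ q + p
  ≤-+ˡ {p} {q} 0≤q = subst (_≤ q + p) (+-identityˡ p) (+-monoˡ-≤ p 0≤q)

  ≤-+ʳ : ∀ {p q} → 0ℚ ≤ q → p ≤ p + q
  ≤-+ʳ {p} {q} 0≤q = subst (_≤ p + q) (+-identityʳ p) (+-monoʳ-≤ p 0≤q)

  0≤1 : 0ℚ ≤ 1ℚ
  0≤1 = nonNegative⁻¹ 1ℚ

  0<1 : 0ℚ < 1ℚ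
  0<1 = positive⁻¹ 1ℚ

  pow-nonneg : ∀ {p} k → 0ℚ ≤ p → 0ℚ ≤ pow p k
  pow-nonneg zero 0≤p = 0≤1
  pow-nonneg (suc k) 0≤p = *-nonneg 0≤p (pow-nonneg k 0≤p)

  pow-pos : ∀ {p} k → 0ℚ < p → 0ℚ < pow p k
  pow-pos zero 0<p = 0<1
  pow-pos (suc k) 0<p = *-pos 0<p (pow-pos k 0<p)

  pow-mono : ∀ {p q} k → 0ℚ ≤ p → p ≤ q → pow p k ≤ pow q k
  pow-mono zero 0≤p p≤q = ≤-refl
  pow-mono (suc k) 0≤p p≤q = *-mono-≤₀ 0≤p (pow-nonneg k 0≤p) p≤q (pow-mono k 0≤p p≤q)

  pow-1 : ∀ k → pow 1ℚ k ≡ 1ℚ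
  pow-1 zero = refl
  pow-1 (suc k) = trans (*-identityˡ _) (pow-1 k)

  1≤pow : ∀ {p} k → 1ℚ ≤ p → 1ℚ ≤ pow p k
  1≤pow {p} k 1≤p = subst (_≤ pow p k) (pow-1 k) (pow-mono k 0≤1 1≤p)

  pow-+ : ∀ p j k → pow p (j ℕ.+ k) ≡ pow p j * pow p k
  pow-+ p zero k = sym (*-identityˡ _)
  pow-+ p (suc j) k = trans (cong (p *_) (pow-+ p j k)) (sym (*-assoc p _ _))

  pow-distrib-* : ∀ p q k → pow (p * q) k ≡ pow p k * pow q k
  pow-distrib-* p q zero = refl
  pow-distrib-* p q (suc k) = trans (cong ((p * q) *_) (pow-distrib-* p q k))
    (solve 4 (λ p q a b → (p :* q) :* (a :* b) := (p :* a) :* (q :* b)) refl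
      p q (pow p k) (pow q k))
    where open +-*-Solver

  pow-* : ∀ p j k → pow p (j ℕ.* k) ≡ pow (pow p k) j
  pow-* p zero k = refl
  pow-* p (suc j) k = trans (pow-+ p k (j ℕ.* k)) (cong (pow p k *_) (pow-* p j k))

  pow-exp-mono : ∀ {p j k} → 1ℚ ≤ p → j ℕ.≤ k → pow p j ≤ pow p k
  pow-exp-mono {k = k} 1≤p z≤n = 1≤pow k 1≤p
  pow-exp-mono {p} 1≤p (s≤s j≤k) = *-monoˡ (≤-trans 0≤1 1≤p) (pow-exp-mono 1≤p j≤k)

  opaque
    -- Opaque, so that casts are handled through the laws below and never unfold to normalised
    -- fractions.
    ι : ℕ → ℚ
    ι = ℕ→ℚ

    ι≡ℕ→ℚ : ∀ n → ι n ≡ ℕ→ℚ n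
    ι≡ℕ→ℚ n = refl

    ι-0 : ι 0 ≡ 0ℚ
    ι-0 = refl

    ι-1 : ι 1 ≡ 1ℚ
    ι-1 = refl

    private
      toℚᵘ-ι : ∀ n → toℚᵘ (ι n) ℚᵘ.≃ mkℚᵘ (ℤ.+ n) 0
      toℚᵘ-ι n = toℚᵘ-fromℚᵘ (mkℚᵘ (ℤ.+ n) 0)

      ι≡mkℚ : ∀ n → ι n ≡ mkℚ (ℤ.+ n) 0 (coprime-sym (1-coprimeTo n))
      ι≡mkℚ n = normalize-coprime (coprime-sym (1-coprimeTo n))

    ι-+ : ∀ m n → ι (m ℕ.+ n) ≡ ι m + ι n
    ι-+ m n = toℚᵘ-injective (ℚᵘ.≃-trans (toℚᵘ-ι (m ℕ.+ n)) (ℚᵘ.≃-sym (ℚᵘ.≃-trans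
      (toℚᵘ-homo-+ (ι m) (ι n))
      (ℚᵘ.≃-trans (ℚᵘ.+-cong (toℚᵘ-ι m) (toℚᵘ-ι n))
        (*≡* (cong (ℤ._* ℤ.+ 1) (cong₂ ℤ._+_ (ℤ.*-identityʳ (ℤ.+ m)) (ℤ.*-identityʳ (ℤ.+ n)))))))))

    ι-* : ∀ m n → ι (m ℕ.* n) ≡ ι m * ι n
    ι-* m n = toℚᵘ-injective (ℚᵘ.≃-trans (toℚᵘ-ι (m ℕ.* n)) (ℚᵘ.≃-sym (ℚᵘ.≃-trans
      (toℚᵘ-homo-* (ι m) (ι n))
      (ℚᵘ.≃-trans (ℚᵘ.*-cong (toℚᵘ-ι m) (toℚᵘ-ι n))
        (*≡* (cong (ℤ._* ℤ.+ 1) (sym (ℤ.pos-* m n))))))))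

    ι-mono : ∀ {m n} → m ℕ.≤ n → ι m ≤ ι n
    ι-mono {m} {n} m≤n rewrite ι≡mkℚ m | ι≡mkℚ n = *≤* (ℤ.*-monoʳ-≤-nonNeg (ℤ.+ 1) (ℤ.+≤+ m≤n))

    ι-mono-< : ∀ {m n} → m ℕ.< n → ι m < ι n
    ι-mono-< {m} {n} m<n rewrite ι≡mkℚ m | ι≡mkℚ n = *<* (ℤ.*-monoʳ-<-pos (ℤ.+ 1) (ℤ.+<+ m<n))

  ι-suc : ∀ n → ι (suc n) ≡ 1ℚ + ι n
  ι-suc n = trans (ι-+ 1 n) (cong (_+ ι n) ι-1)

  ι-2 : ι 2 ≡ 1ℚ + 1ℚ
  ι-2 = trans (ι-suc 1) (cong (1ℚ +_) ι-1)

  ι-^ : ∀ m k → ι (m ℕ.^ k) ≡ pow (ι m) k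
  ι-^ m zero = ι-1
  ι-^ m (suc k) = trans (ι-* m (m ℕ.^ k)) (cong (ι m *_) (ι-^ m k))

  ι-cancel-≤ : ∀ {m n} → ι m ≤ ι n → m ℕ.≤ n
  ι-cancel-≤ {m} {n} ιm≤ιn = ℕ.≮⇒≥ λ n<m → <-irrefl refl (<-≤-trans (ι-mono-< n<m) ιm≤ιn)

  ι-nonneg : ∀ n → 0ℚ ≤ ι n
  ι-nonneg n = subst (_≤ ι n) ι-0 (ι-mono z≤n)

  ι-pos : ∀ n → 0ℚ < ι (suc n)
  ι-pos n = subst (_< ι (suc n)) ι-0 (ι-mono-< (s≤s z≤n))

  1≤ι : ∀ {n} → 1 ℕ.≤ n → 1ℚ ≤ ι n
  1≤ι {n} 1≤n = subst (_≤ ι n) ι-1 (ι-mono 1≤n)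

  recip : ∀ p → 0ℚ < p → ℚ
  recip p 0<p = (1/ p) {{>-nonZero 0<p}}

  recip-inverse : ∀ p (0<p : 0ℚ < p) → recip p 0<p * p ≡ 1ℚ
  recip-inverse p 0<p = *-inverseˡ p {{>-nonZero 0<p}}

  recip-pos : ∀ p (0<p : 0ℚ < p) → 0ℚ < recip p 0<p
  recip-pos p 0<p = positive⁻¹ _ {{1/pos⇒pos p {{positive 0<p}}}}

  opaque
    -- The value 0 at 0 makes `inv*ι≤1` unconditional, so that upper bounds on means survive when
    -- the underlying set is empty.
    inv : ℕ → ℚ
    inv zero = 0ℚ
    inv (suc n) = recip (ι (suc n)) (ι-pos n)

    inv-zero : inv 0 ≡ 0ℚ
    inv-zero = refl

    inv-inverse : ∀ {n} → 1 ℕ.≤ n → inv n * ι n ≡ 1ℚ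
    inv-inverse {suc n} _ = recip-inverse (ι (suc n)) (ι-pos n)

    inv-nonneg : ∀ n → 0ℚ ≤ inv n
    inv-nonneg zero = ≤-refl
    inv-nonneg (suc n) = <⇒≤ (recip-pos (ι (suc n)) (ι-pos n))

    inv*ι≤1 : ∀ n → inv n * ι n ≤ 1ℚ
    inv*ι≤1 zero = ≤-trans (≤-reflexive (*-zeroˡ (ι 0))) 0≤1
    inv*ι≤1 (suc n) = ≤-reflexive (recip-inverse (ι (suc n)) (ι-pos n))

  -- A converse to Bernoulli's inequality that stands in for (1 + x)^m ≤ e^(mx): for mx ≤ 1/2 it
  -- gives (1 + x)^m ≤ 2. The induction step discards only a multiple of x².
  pow-upper : ∀ x m → 0ℚ ≤ x → pow (1ℚ + x) m * (1ℚ - ι m * x) ≤ 1ℚ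
  pow-upper x zero 0≤x = ≤-reflexive (trans (*-identityˡ _)
    (trans (cong (λ z → 1ℚ - z) (trans (cong (_* x) ι-0) (*-zeroˡ x))) refl))
  pow-upper x (suc m) 0≤x = begin
    ((1ℚ + x) * y) * (1ℚ - ι (suc m) * x)       ≡⟨ cong (λ z → ((1ℚ + x) * y) * (1ℚ - z * x)) (ι-suc m) ⟩
    ((1ℚ + x) * y) * (1ℚ - (1ℚ + ι m) * x)      ≤⟨ ≤-+ʳ (*-nonneg 0≤y (*-nonneg (ι-nonneg (suc m)) (*-nonneg 0≤x 0≤x))) ⟩
    ((1ℚ + x) * y) * (1ℚ - (1ℚ + ι m) * x) + y * (ι (suc m) * (x * x))
      ≡⟨ cong (λ z → ((1ℚ + x) * y) * (1ℚ - (1ℚ + ι m) * x) + y * (z * (x * x))) (ι-suc m) ⟩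
    ((1ℚ + x) * y) * (1ℚ - (1ℚ + ι m) * x) + y * ((1ℚ + ι m) * (x * x))
      ≡⟨ solve 3 (λ x y m → ((con 1ℚ :+ x) :* y) :* (con 1ℚ :- (con 1ℚ :+ m) :* x) :+ y :* ((con 1ℚ :+ m) :* (x :* x))
                   := y :* (con 1ℚ :- m :* x)) refl x y (ι m) ⟩
    y * (1ℚ - ι m * x)                          ≤⟨ pow-upper x m 0≤x ⟩
    1ℚ                                          ∎
    where
    open ≤-Reasoning
    open +-*-Solver
    y = pow (1ℚ + x) m
    0≤y : 0ℚ ≤ y
    0≤y = pow-nonneg m (≤-trans 0≤1 (≤-+ʳ 0≤x))

  bernoulli : ∀ x m → 0ℚ ≤ x → 1ℚ + ι m * x ≤ pow (1ℚ + x) m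
  bernoulli x zero 0≤x = ≤-reflexive (trans (cong (1ℚ +_) (trans (cong (_* x) ι-0) (*-zeroˡ x))) refl)
  bernoulli x (suc m) 0≤x = begin
    1ℚ + ι (suc m) * x                  ≡⟨ cong (λ z → 1ℚ + z * x) (ι-suc m) ⟩
    1ℚ + (1ℚ + ι m) * x                 ≤⟨ ≤-+ʳ (*-nonneg (ι-nonneg m) (*-nonneg 0≤x 0≤x)) ⟩
    1ℚ + (1ℚ + ι m) * x + ι m * (x * x) ≡⟨ solve 2 (λ x m → con 1ℚ :+ (con 1ℚ :+ m) :* x :+ m :* (x :* x)
                                             := (con 1ℚ :+ x) :* (con 1ℚ :+ m :* x)) refl x (ι m) ⟩
    (1ℚ + x) * (1ℚ + ι m * x)           ≤⟨ *-monoˡ (≤-trans 0≤1 (≤-+ʳ 0≤x)) (bernoulli x m 0≤x) ⟩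
    (1ℚ + x) * pow (1ℚ + x) m           ∎
    where
    open ≤-Reasoning
    open +-*-Solver

-- Sums over vertices and over tuples.

module FiniteSums where

  open import Algebra.Bundles using (CommutativeRing)
  open import Data.Bool using (Bool; true; false; _∧_; not; if_then_else_)
  open import Data.Bool.ListAction using (all)
  open import Data.Fin using (Fin; zero; suc)
  open import Data.List using (List; []; _∷_; length)
  open import Data.Nat as ℕ using (ℕ; zero; suc; z≤n; s≤s)
  import Data.Nat.Properties as ℕ
  open import Data.Product using (∃; _×_; _,_)
  open import Data.Rational
  open import Data.Rational.Properties
  open import Data.Rational.Solver using (module +-*-Solver)
  open import Function using (_∘_)
  open import Relation.Binary.PropositionalEquality
  open import Relation.Nullary using (yes; no)
  open Rationals

  open import Algebra.Properties.Semiring.Sum (CommutativeRing.semiring +-*-commutativeRing) public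
    using (sum; sum-cong-≗; ∑-distrib-+; ∑-comm; *-distribˡ-sum)

  𝟙[_] : Bool → ℚ
  𝟙[ b ] = if b then 1ℚ else 0ℚ

  𝟙-nonneg : ∀ b → 0ℚ ≤ 𝟙[ b ]
  𝟙-nonneg false = ≤-refl
  𝟙-nonneg true = 0≤1

  𝟙≤1 : ∀ b → 𝟙[ b ] ≤ 1ℚ
  𝟙≤1 false = 0≤1
  𝟙≤1 true = ≤-refl

  𝟙-∧ : ∀ b c → 𝟙[ b ∧ c ] ≡ 𝟙[ b ] * 𝟙[ c ]
  𝟙-∧ false c = sym (*-zeroˡ 𝟙[ c ])
  𝟙-∧ true c = sym (*-identityˡ 𝟙[ c ])

  sum-mono : ∀ {n} {f g : Fin n → ℚ} → (∀ i → f i ≤ g i) → sum f ≤ sum g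
  sum-mono {zero} f≤g = ≤-refl
  sum-mono {suc n} f≤g = +-mono-≤ (f≤g zero) (sum-mono (f≤g ∘ suc))

  sum-nonneg : ∀ {n} {f : Fin n → ℚ} → (∀ i → 0ℚ ≤ f i) → 0ℚ ≤ sum f
  sum-nonneg {zero} 0≤f = ≤-refl
  sum-nonneg {suc n} 0≤f = +-nonneg (0≤f zero) (sum-nonneg (0≤f ∘ suc))

  term≤sum : ∀ {n} {f : Fin n → ℚ} → (∀ i → 0ℚ ≤ f i) → ∀ i → f i ≤ sum f
  term≤sum 0≤f zero = ≤-+ʳ (sum-nonneg (0≤f ∘ suc))
  term≤sum 0≤f (suc i) = ≤-trans (term≤sum (0≤f ∘ suc) i) (≤-+ˡ (0≤f zero))

  sum-const : ∀ n c → sum {n} (λ _ → c) ≡ ι n * c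
  sum-const zero c = sym (trans (cong (_* c) ι-0) (*-zeroˡ c))
  sum-const (suc n) c = begin
    c + sum {n} (λ _ → c)  ≡⟨ cong (c +_) (sum-const n c) ⟩
    c + ι n * c            ≡⟨ solve 2 (λ c m → c :+ m :* c := (con 1ℚ :+ m) :* c) refl c (ι n) ⟩
    (1ℚ + ι n) * c         ≡⟨ cong (_* c) (sym (ι-suc n)) ⟩
    ι (suc n) * c          ∎
    where
    open ≡-Reasoning
    open +-*-Solver

  sum-<⇒∃ : ∀ {n} (f g : Fin n → ℚ) → sum f < sum g → ∃ λ i → f i < g i
  sum-<⇒∃ {zero} f g 0<0 with () ← <-irrefl refl 0<0
  sum-<⇒∃ {suc n} f g f<g with f zero <? g zero
  ... | yes f₀<g₀ = zero , f₀<g₀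
  ... | no f₀≮g₀ with sum (f ∘ suc) <? sum (g ∘ suc)
  ...   | yes f′<g′ = let i , fi<gi = sum-<⇒∃ (f ∘ suc) (g ∘ suc) f′<g′ in suc i , fi<gi
  ...   | no f′≮g′ with () ← <-irrefl refl (<-≤-trans f<g (+-mono-≤ (≮⇒≥ f₀≮g₀) (≮⇒≥ f′≮g′)))

  sum-indicator : ∀ {n} (p : Fin n → Bool) → sum (λ i → 𝟙[ p i ]) ≡ ι (count p)
  sum-indicator {zero} p = sym ι-0
  sum-indicator {suc n} p with p zero
  ... | true = trans (cong (1ℚ +_) (sum-indicator (p ∘ suc))) (sym (ι-suc (count (p ∘ suc))))
  ... | false = trans (+-identityˡ _) (sum-indicator (p ∘ suc))

  sum-indicator-* : ∀ {n} (p : Fin n → Bool) c → sum (λ i → 𝟙[ p i ] * c) ≡ ι (count p) * c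
  sum-indicator-* p c = begin
    sum (λ i → 𝟙[ p i ] * c)  ≡⟨ sum-cong-≗ (λ i → *-comm 𝟙[ p i ] c) ⟩
    sum (λ i → c * 𝟙[ p i ])  ≡⟨ *-distribˡ-sum c (λ i → 𝟙[ p i ]) ⟨
    c * sum (λ i → 𝟙[ p i ])  ≡⟨ cong (c *_) (sum-indicator p) ⟩
    c * ι (count p)          ≡⟨ *-comm c _ ⟩
    ι (count p) * c          ∎
    where open ≡-Reasoning

  count-cong : ∀ {n} {p q : Fin n → Bool} → (∀ i → p i ≡ q i) → count p ≡ count q
  count-cong {zero} p≗q = refl
  count-cong {suc n} p≗q =
    cong₂ (λ b m → (if b then 1 else 0) ℕ.+ m) (p≗q zero) (count-cong (p≗q ∘ suc))

  count-split : ∀ {n} (p q : Fin n → Bool) →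
    count p ≡ count (λ i → p i ∧ q i) ℕ.+ count (λ i → p i ∧ not (q i))
  count-split {zero} p q = refl
  count-split {suc n} p q with p zero | q zero
  ... | false | _ = count-split (p ∘ suc) (q ∘ suc)
  ... | true | true = cong suc (count-split (p ∘ suc) (q ∘ suc))
  ... | true | false = trans (cong suc (count-split (p ∘ suc) (q ∘ suc))) (sym (ℕ.+-suc _ _))

  count≤n : ∀ {n} (p : Fin n → Bool) → count p ℕ.≤ n
  count≤n {zero} p = z≤n
  count≤n {suc n} p with p zero
  ... | true = s≤s (count≤n (p ∘ suc))
  ... | false = ℕ.m≤n⇒m≤1+n (count≤n (p ∘ suc))

  count-all : ∀ n → count {n} (λ _ → true) ≡ n
  count-all zero = refl
  count-all (suc n) = cong suc (count-all n)

  count-pos : ∀ {n} (p : Fin n → Bool) i → p i ≡ true → 1 ℕ.≤ count p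
  count-pos p zero pi rewrite pi = s≤s z≤n
  count-pos p (suc i) pi = ℕ.≤-trans (count-pos (p ∘ suc) i pi) (ℕ.m≤n+m _ _)

  -- The head of the tuple is summed innermost. Histories of the process grow at the head in the
  -- same way, so both recursions can be run in parallel.
  sumIn : ∀ {N} → (Fin N → Bool) → ℕ → (List (Fin N) → ℚ) → ℚ
  sumIn Z zero g = g []
  sumIn Z (suc k) g = sumIn Z k (λ q → sum (λ w → 𝟙[ Z w ] * g (w ∷ q)))

  sumAll : ∀ {N} → ℕ → (List (Fin N) → ℚ) → ℚ
  sumAll = sumIn (λ _ → true)

  module _ {N : ℕ} (Z : Fin N → Bool) where

    sumIn-mono : ∀ k {f g : List (Fin N) → ℚ} → (∀ q → length q ≡ k → f q ≤ g q) → sumIn Z k f ≤ sumIn Z k g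
    sumIn-mono zero f≤g = f≤g [] refl
    sumIn-mono (suc k) f≤g = sumIn-mono k λ q ∣q∣≡k →
      sum-mono λ w → *-monoˡ (𝟙-nonneg (Z w)) (f≤g (w ∷ q) (cong suc ∣q∣≡k))

    sumIn-cong : ∀ k {f g : List (Fin N) → ℚ} → (∀ q → f q ≡ g q) → sumIn Z k f ≡ sumIn Z k g
    sumIn-cong zero f≗g = f≗g []
    sumIn-cong (suc k) f≗g = sumIn-cong k λ q → sum-cong-≗ λ w → cong (𝟙[ Z w ] *_) (f≗g (w ∷ q))

    sumIn-+ : ∀ k (f g : List (Fin N) → ℚ) → sumIn Z k (λ q → f q + g q) ≡ sumIn Z k f + sumIn Z k g
    sumIn-+ zero f g = refl
    sumIn-+ (suc k) f g = trans
      (sumIn-cong k λ q → trans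
        (sum-cong-≗ λ w → *-distribˡ-+ 𝟙[ Z w ] (f (w ∷ q)) (g (w ∷ q)))
        (∑-distrib-+ (λ w → 𝟙[ Z w ] * f (w ∷ q)) (λ w → 𝟙[ Z w ] * g (w ∷ q))))
      (sumIn-+ k _ _)

    sumIn-*ˡ : ∀ k c (g : List (Fin N) → ℚ) → sumIn Z k (λ q → c * g q) ≡ c * sumIn Z k g
    sumIn-*ˡ zero c g = refl
    sumIn-*ˡ (suc k) c g = trans
      (sumIn-cong k λ q → trans
        (sum-cong-≗ λ w → solve 3 (λ z c x → z :* (c :* x) := c :* (z :* x)) refl 𝟙[ Z w ] c (g (w ∷ q)))
        (sym (*-distribˡ-sum c (λ w → 𝟙[ Z w ] * g (w ∷ q)))))
      (sumIn-*ˡ k c _)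
      where open +-*-Solver

    sumIn-const : ∀ k c → sumIn Z k (λ _ → c) ≡ pow (ι (count Z)) k * c
    sumIn-const zero c = sym (*-identityˡ c)
    sumIn-const (suc k) c = trans
      (sumIn-cong k λ q → sum-indicator-* Z c)
      (trans (sumIn-const k (ι (count Z) * c))
        (solve 3 (λ p m c → p :* (m :* c) := (m :* p) :* c) refl (pow (ι (count Z)) k) (ι (count Z)) c))
      where open +-*-Solver

    sumIn-nonneg : ∀ k {g : List (Fin N) → ℚ} → (∀ q → 0ℚ ≤ g q) → 0ℚ ≤ sumIn Z k g
    sumIn-nonneg zero 0≤g = 0≤g []
    sumIn-nonneg (suc k) 0≤g = sumIn-nonneg k λ q →
      sum-nonneg λ w → *-nonneg (𝟙-nonneg (Z w)) (0≤g (w ∷ q))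

    -- Moves the restriction into an indicator, so that two sums can be exchanged although the range
    -- of one tuple depends on the other.
    sumIn≡sumAll : ∀ k (g : List (Fin N) → ℚ) → sumIn Z k g ≡ sumAll k (λ q → 𝟙[ all Z q ] * g q)
    sumIn≡sumAll zero g = sym (*-identityˡ (g []))
    sumIn≡sumAll (suc k) g = trans (sumIn≡sumAll k _) (sumIn-cong-all k λ q → trans
      (*-distribˡ-sum 𝟙[ all Z q ] (λ w → 𝟙[ Z w ] * g (w ∷ q)))
      (sum-cong-≗ λ w → trans
        (solve 3 (λ a z x → a :* (z :* x) := con 1ℚ :* ((z :* a) :* x)) refl 𝟙[ all Z q ] 𝟙[ Z w ] (g (w ∷ q)))
        (cong (λ x → 1ℚ * (x * g (w ∷ q))) (sym (𝟙-∧ (Z w) (all Z q))))))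
      where
      open +-*-Solver
      sumIn-cong-all : ∀ k {f g : List (Fin N) → ℚ} → (∀ q → f q ≡ g q) → sumAll k f ≡ sumAll k g
      sumIn-cong-all zero f≗g = f≗g []
      sumIn-cong-all (suc k) f≗g = sumIn-cong-all k λ q → sum-cong-≗ λ w → cong (1ℚ *_) (f≗g (w ∷ q))

  module _ {N : ℕ} where

    sumAll-const : ∀ k c → sumAll {N} k (λ _ → c) ≡ pow (ι N) k * c
    sumAll-const k c = trans (sumIn-const (λ _ → true) k c)
      (cong (λ m → pow (ι m) k * c) (count-all N))

    sumAll-indicator : ∀ (Z : Fin N → Bool) k c → sumAll k (λ q → 𝟙[ all Z q ] * c) ≡ pow (ι (count Z)) k * c
    sumAll-indicator Z k c = trans (sym (sumIn≡sumAll Z k (λ _ → c))) (sumIn-const Z k c)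

    sumAll-sum : ∀ {n} k (φ : List (Fin N) → Fin n → ℚ) →
      sumAll k (λ q → sum (φ q)) ≡ sum (λ i → sumAll k (λ q → φ q i))
    sumAll-sum zero φ = refl
    sumAll-sum (suc k) φ = trans
      (sumIn-cong (λ _ → true) k λ q → trans
        (sum-cong-≗ λ w → *-distribˡ-sum 1ℚ (φ (w ∷ q)))
        (∑-comm (λ w i → 1ℚ * φ (w ∷ q) i)))
      (sumAll-sum k (λ q i → sum (λ w → 1ℚ * φ (w ∷ q) i)))

    sumAll-comm : ∀ j k (φ : List (Fin N) → List (Fin N) → ℚ) →
      sumAll j (λ p → sumAll k (φ p)) ≡ sumAll k (λ q → sumAll j (λ p → φ p q))
    sumAll-comm j zero φ = refl
    sumAll-comm j (suc k) φ = trans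
      (sumAll-comm j k (λ p q → sum (λ w → 1ℚ * φ p (w ∷ q))))
      (sumIn-cong (λ _ → true) k λ q → trans
        (sumAll-sum j (λ p w → 1ℚ * φ p (w ∷ q)))
        (sum-cong-≗ λ w → sumIn-*ˡ (λ _ → true) j 1ℚ (λ p → φ p (w ∷ q))))

    term≤sumAll : ∀ {g : List (Fin N) → ℚ} → (∀ q → 0ℚ ≤ g q) → ∀ q → g q ≤ sumAll (length q) g
    term≤sumAll 0≤g [] = ≤-refl
    term≤sumAll {g} 0≤g (w ∷ q) = begin
      g (w ∷ q)                           ≡⟨ *-identityˡ _ ⟨
      1ℚ * g (w ∷ q)                      ≤⟨ term≤sum (λ v → 0≤1*g v q) w ⟩
      sum (λ v → 1ℚ * g (v ∷ q))          ≤⟨ term≤sumAll (λ p → sum-nonneg λ v → 0≤1*g v p) q ⟩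
      sumAll (suc (length q)) g           ∎
      where
      open ≤-Reasoning
      0≤1*g : ∀ v p → 0ℚ ≤ 1ℚ * g (v ∷ p)
      0≤1*g v p = *-nonneg 0≤1 (0≤g (v ∷ p))

    sumAll-<⇒∃ : ∀ k (f g : List (Fin N) → ℚ) → sumAll k f < sumAll k g → ∃ λ q → length q ≡ k × f q < g q
    sumAll-<⇒∃ zero f g f<g = [] , refl , f<g
    sumAll-<⇒∃ (suc k) f g f<g =
      let q , ∣q∣≡k , f<g′ = sumAll-<⇒∃ k _ _ f<g
          w , f<g″ = sum-<⇒∃ _ _ f<g′
      in w ∷ q , cong suc ∣q∣≡k , *-cancelˡ-<₀ 0≤1 f<g″

-- Complete pairs of tuples and dependent random choice.

module CommonNeighbourhoods where

  open import Data.Bool using (Bool; true; false; _∧_; not)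
  open import Data.Bool.ListAction using (all)
  import Data.Bool.Properties as Bool
  open import Data.Fin using (Fin; zero; suc; toℕ; fromℕ<)
  import Data.Fin.Properties as Fin
  open import Data.List using (List; []; _∷_; length)
  open import Data.Nat as ℕ using (ℕ; zero; suc; z≤n; s≤s)
  import Data.Nat.Properties as ℕ
  import Data.Nat.DivMod as ℕ
  open import Data.Product using (∃; _×_; _,_)
  open import Data.Rational
  open import Data.Rational.Properties
  open import Data.Rational.Solver using (module +-*-Solver)
  open import Data.Vec.Functional using (foldr)
  open import Function using (_∘_)
  open import Relation.Binary.PropositionalEquality
  open import Relation.Nullary using (contradiction)
  open import Data.Sum using (inj₁; inj₂)
  open Rationals
  open FiniteSums

  all-∧ : ∀ {A : Set} (p q : A → Bool) xs → all (λ x → p x ∧ q x) xs ≡ all p xs ∧ all q xs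
  all-∧ p q [] = refl
  all-∧ p q (x ∷ xs) with p x | q x
  ... | false | _ = refl
  ... | true | true = all-∧ p q xs
  ... | true | false = sym (Bool.∧-zeroʳ (all p xs))

  all-true : ∀ {A : Set} (xs : List A) → all (λ _ → true) xs ≡ true
  all-true [] = refl
  all-true (x ∷ xs) = all-true xs

  -- If x ≤ ν the second term suffices, otherwise the first. It replaces convexity in the power mean
  -- inequality, and later it trades a sum of spreads for a sum of their powers.
  tangent : ∀ {x ν} s → 0ℚ ≤ x → 0ℚ ≤ ν → pow ν s * x ≤ pow x (suc s) + pow ν (suc s)
  tangent {x} {ν} s 0≤x 0≤ν with ≤-total x ν
  ... | inj₁ x≤ν = ≤-trans (*-monoˡ (pow-nonneg s 0≤ν) x≤ν)
    (≤-trans (≤-reflexive (*-comm (pow ν s) ν)) (≤-+ˡ (pow-nonneg (suc s) 0≤x)))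
  ... | inj₂ ν≤x = ≤-trans (*-monoʳ 0≤x (pow-mono s 0≤ν ν≤x))
    (≤-trans (≤-reflexive (*-comm (pow x s) x)) (≤-+ʳ (pow-nonneg (suc s) 0≤ν)))

  -- The factor 2 below the mean makes convexity unnecessary.
  sumAll-pow : ∀ {N} k s ν (x : List (Fin N) → ℚ) → 0ℚ ≤ ν → (∀ q → 0ℚ ≤ x q) →
    pow (ι N) k * (ν + ν) ≤ sumAll k x →
    pow (ι N) k * pow ν (suc s) ≤ sumAll k (λ q → pow (x q) (suc s))
  sumAll-pow {N} k s ν x 0≤ν 0≤x mean = begin
    a                       ≡⟨ solve 1 (λ a → a := (a :+ a) :+ (:- a)) refl a ⟩
    (a + a) - a             ≤⟨ +-monoˡ-≤ (- a) step ⟩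
    (y + a) - a             ≡⟨ solve 2 (λ y a → (y :+ a) :+ (:- a) := y) refl y a ⟩
    y                       ∎
    where
    open ≤-Reasoning
    open +-*-Solver
    m = pow (ι N) k
    a = m * pow ν (suc s)
    y = sumAll k (λ q → pow (x q) (suc s))
    step : a + a ≤ y + a
    step = begin
      m * (ν * pow ν s) + m * (ν * pow ν s)
        ≡⟨ solve 3 (λ m v p → m :* (v :* p) :+ m :* (v :* p) := p :* (m :* (v :+ v))) refl m ν (pow ν s) ⟩
      pow ν s * (m * (ν + ν))                  ≤⟨ *-monoˡ (pow-nonneg s 0≤ν) mean ⟩
      pow ν s * sumAll k x                     ≡⟨ sumIn-*ˡ (λ _ → true) k (pow ν s) x ⟨
      sumAll k (λ q → pow ν s * x q)           ≤⟨ sumIn-mono (λ _ → true) k (λ q _ → tangent s (0≤x q) 0≤ν) ⟩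
      sumAll k (λ q → pow (x q) (suc s) + pow ν (suc s))
        ≡⟨ sumIn-+ (λ _ → true) k (λ q → pow (x q) (suc s)) (λ _ → pow ν (suc s)) ⟩
      y + sumAll k (λ _ → pow ν (suc s))       ≡⟨ cong (y +_) (sumAll-const k (pow ν (suc s))) ⟩
      y + a                                    ∎

  module _ {N : ℕ} (G : Graph N) where

    V = Fin N

    nbr : List V → V → Bool
    nbr q w = all (λ x → adj G x w) q

    codeg : List V → ℕ
    codeg q = count (nbr q)

    all-nbr-comm : ∀ p q → all (nbr p) q ≡ all (nbr q) p
    all-nbr-comm p [] = sym (all-true p)
    all-nbr-comm p (y ∷ q) = begin
      nbr p y ∧ all (nbr p) q                              ≡⟨ cong₂ _∧_ (flip p) (all-nbr-comm p q) ⟩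
      all (λ x → adj G y x) p ∧ all (nbr q) p              ≡⟨ all-∧ (λ x → adj G y x) (nbr q) p ⟨
      all (nbr (y ∷ q)) p                                  ∎
      where
      open ≡-Reasoning
      flip : ∀ p → nbr p y ≡ all (λ x → adj G y x) p
      flip [] = refl
      flip (x ∷ p) = cong₂ _∧_ (adj-sym G x y) (flip p)

    complete : List V → List V → Bool
    complete p q = all (nbr p) q

    jointCodeg : List V → List V → ℕ
    jointCodeg p q = count (λ w → nbr p w ∧ nbr q w)

    -- An integer between 2N/m and 3N/m, except that spread 0 is junk.
    opaque
      spread : ℕ → ℕ
      spread m = suc ((2 ℕ.* N) ℕ./ suc (ℕ.pred m))

      spread-pos : ∀ m → 1 ℕ.≤ spread m
      spread-pos m = s≤s z≤n

      spread-upper : ∀ m → m ℕ.≤ N → spread m ℕ.* m ℕ.≤ 3 ℕ.* N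
      spread-upper zero _ rewrite ℕ.*-zeroʳ (spread zero) = z≤n
      -- Rounding up costs one extra `suc m`, at most N; this is the step from 2N to 3N.
      spread-upper (suc m) m<N = begin
        suc m ℕ.+ (2 ℕ.* N) ℕ./ suc m ℕ.* suc m  ≤⟨ ℕ.+-mono-≤ m<N (ℕ.m/n*n≤m (2 ℕ.* N) (suc m)) ⟩
        N ℕ.+ 2 ℕ.* N                            ∎
        where open ℕ.≤-Reasoning

      spread-lower : ∀ m → 1 ℕ.≤ m → 2 ℕ.* N ℕ.≤ spread m ℕ.* m
      spread-lower (suc m) _ = begin
        2 ℕ.* N                                        ≡⟨ ℕ.m≡m%n+[m/n]*n (2 ℕ.* N) (suc m) ⟩
        (2 ℕ.* N) ℕ.% suc m ℕ.+ (2 ℕ.* N) ℕ./ suc m ℕ.* suc m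
          ≤⟨ ℕ.+-monoˡ-≤ _ (ℕ.<⇒≤ (ℕ.m%n<n (2 ℕ.* N) (suc m))) ⟩
        spread (suc m) ℕ.* suc m                       ∎
        where open ℕ.≤-Reasoning

    -- The tuple `q` stands for the images of the earlier neighbours of a vertex. They lie in the
    -- common neighbourhood of `p′`, the candidates of the vertex in that of `p`. The sum is not
    -- normalised: a bound KN^k means K per tuple of the whole vertex set.
    moment : List V → List V → ℕ → ℕ → ℚ
    moment p p′ t k = sumIn (nbr p′) k (λ q → pow (ι (spread (jointCodeg p q))) t)

    moment-nonneg : ∀ p p′ t k → 0ℚ ≤ moment p p′ t k
    moment-nonneg p p′ t k = sumIn-nonneg (nbr p′) k (λ q → pow-nonneg t (ι-nonneg (spread (jointCodeg p q))))

    -- Exchanging the sums, the number of admissible p′ is the t-th power of a common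
    -- neighbourhood size, which cancels the t-th power of its spread.
    moment-average : ∀ p t k →
      sumAll t (λ p′ → 𝟙[ complete p p′ ] * moment p p′ t k) ≤ pow (ι N) k * pow (ι (3 ℕ.* N)) t
    moment-average p t k = begin
      sumAll t (λ p′ → 𝟙[ complete p p′ ] * moment p p′ t k)
        ≡⟨ sumIn-cong (λ _ → true) t expand ⟩
      sumAll t (λ p′ → sumAll k (λ q → 𝟙[ all (S q) p′ ] * x q))
        ≡⟨ sumAll-comm t k (λ p′ q → 𝟙[ all (S q) p′ ] * x q) ⟩
      sumAll k (λ q → sumAll t (λ p′ → 𝟙[ all (S q) p′ ] * x q))
        ≡⟨ sumIn-cong (λ _ → true) k (λ q → sumAll-indicator (S q) t (x q)) ⟩
      sumAll k (λ q → pow (ι (jointCodeg p q)) t * x q)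
        ≤⟨ sumIn-mono (λ _ → true) k (λ q _ → cancel q) ⟩
      sumAll {N} k (λ q → pow (ι (3 ℕ.* N)) t)
        ≡⟨ sumAll-const k (pow (ι (3 ℕ.* N)) t) ⟩
      pow (ι N) k * pow (ι (3 ℕ.* N)) t
        ∎
      where
      open ≤-Reasoning
      open +-*-Solver
      S : List V → V → Bool
      S q w = nbr p w ∧ nbr q w
      x : List V → ℚ
      x q = pow (ι (spread (jointCodeg p q))) t
      expand : ∀ p′ → 𝟙[ complete p p′ ] * moment p p′ t k ≡ sumAll k (λ q → 𝟙[ all (S q) p′ ] * x q)
      expand p′ = trans (cong (𝟙[ complete p p′ ] *_) (sumIn≡sumAll (nbr p′) k x))
        (trans (sym (sumIn-*ˡ (λ _ → true) k 𝟙[ complete p p′ ] (λ q → 𝟙[ all (nbr p′) q ] * x q)))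
          (sumIn-cong (λ _ → true) k λ q → trans
            (sym (*-assoc 𝟙[ complete p p′ ] 𝟙[ all (nbr p′) q ] (x q)))
            (cong (_* x q) (trans (sym (𝟙-∧ (complete p p′) (all (nbr p′) q)))
              (cong 𝟙[_] (trans (cong (complete p p′ ∧_) (all-nbr-comm p′ q))
                (sym (all-∧ (nbr p) (nbr q) p′))))))))
      cancel : ∀ q → pow (ι (jointCodeg p q)) t * x q ≤ pow (ι (3 ℕ.* N)) t
      cancel q = begin
        pow (ι m) t * pow (ι (spread m)) t  ≡⟨ pow-distrib-* (ι m) (ι (spread m)) t ⟨
        pow (ι m * ι (spread m)) t          ≡⟨ cong (λ z → pow z t) (trans (*-comm (ι m) _) (sym (ι-* (spread m) m))) ⟩
        pow (ι (spread m ℕ.* m)) t          ≤⟨ pow-mono t (ι-nonneg (spread m ℕ.* m)) (ι-mono (spread-upper m (count≤n _))) ⟩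
        pow (ι (3 ℕ.* N)) t                 ∎
        where m = jointCodeg p q

    -- Homomorphic stars with t leaves, counted by their leaves and by their centre.
    codeg-sum : ∀ t → sumAll t (λ p → ι (codeg p)) ≡ sumAll 1 (λ q → pow (ι (codeg q)) t)
    codeg-sum t = begin
      sumAll t (λ p → ι (codeg p))                           ≡⟨ sumIn-cong (λ _ → true) t (λ p → sum-indicator (nbr p)) ⟨
      sumAll t (λ p → sum (λ w → 𝟙[ nbr p w ]))              ≡⟨ sumAll-sum t (λ p w → 𝟙[ nbr p w ]) ⟩
      sum (λ w → sumAll t (λ p → 𝟙[ nbr p w ]))              ≡⟨ sum-cong-≗ each ⟩
      sum (λ w → 1ℚ * pow (ι (codeg (w ∷ []))) t)            ∎
      where
      open ≡-Reasoning
      each : ∀ w → sumAll t (λ p → 𝟙[ nbr p w ]) ≡ 1ℚ * pow (ι (codeg (w ∷ []))) t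
      each w = begin
        sumAll t (λ p → 𝟙[ nbr p w ])
          ≡⟨ sumIn-cong (λ _ → true) t (λ p → trans (cong 𝟙[_] (trans (sym (Bool.∧-identityʳ (nbr p w))) (all-nbr-comm p (w ∷ [])))) (sym (*-identityʳ 𝟙[ complete (w ∷ []) p ]))) ⟩
        sumAll t (λ p → 𝟙[ all (nbr (w ∷ [])) p ] * 1ℚ)      ≡⟨ sumAll-indicator (nbr (w ∷ [])) t 1ℚ ⟩
        pow (ι (codeg (w ∷ []))) t * 1ℚ                      ≡⟨ *-comm (pow (ι (codeg (w ∷ []))) t) 1ℚ ⟩
        1ℚ * pow (ι (codeg (w ∷ []))) t                      ∎

    -- For fixed `p`, the admissible `p′` are the t-tuples inside the common neighbourhood of `p`.
    completePairs : ∀ t → sumAll t (λ p → sumAll t (λ p′ → 𝟙[ complete p p′ ])) ≡ sumAll t (λ p → pow (ι (codeg p)) t)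
    completePairs t = sumIn-cong (λ _ → true) t λ p → trans
      (sumIn-cong (λ _ → true) t λ p′ → sym (*-identityʳ 𝟙[ complete p p′ ]))
      (trans (sumAll-indicator (nbr p) t 1ℚ) (*-identityʳ _))

    -- Two applications of the power mean inequality, as in the Kővári-Sós-Turán count: an average
    -- degree 2βN gives stars and thus an average codegree β^t N ≥ 2γN of t-tuples, which in turn
    -- gives complete pairs.
    completePairs-lower : ∀ s β γ → 0ℚ ≤ β → 0ℚ ≤ γ →
      pow (ι N) 1 * (β * ι N + β * ι N) ≤ sumAll 1 (λ q → ι (codeg q)) →
      γ + γ ≤ pow β (suc s) →
      pow (ι N) (suc s) * pow (γ * ι N) (suc s) ≤ sumAll (suc s) (λ p → sumAll (suc s) (λ p′ → 𝟙[ complete p p′ ]))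
    completePairs-lower s β γ 0≤β 0≤γ degrees 2γ≤β^t = begin
      pow (ι N) t * pow (γ * ι N) t
        ≤⟨ sumAll-pow t s (γ * ι N) (ι ∘ codeg) (*-nonneg 0≤γ (ι-nonneg N)) (ι-nonneg ∘ codeg) mean ⟩
      sumAll t (λ p → pow (ι (codeg p)) t)
        ≡⟨ completePairs t ⟨
      sumAll t (λ p → sumAll t (λ p′ → 𝟙[ complete p p′ ]))
        ∎
      where
      open ≤-Reasoning
      open +-*-Solver
      t = suc s
      mean : pow (ι N) t * (γ * ι N + γ * ι N) ≤ sumAll t (ι ∘ codeg)
      mean = begin
        pow (ι N) t * (γ * ι N + γ * ι N)
          ≡⟨ solve 3 (λ m n g → m :* (g :* n :+ g :* n) := (g :+ g) :* (m :* (n :* con 1ℚ))) refl (pow (ι N) t) (ι N) γ ⟩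
        (γ + γ) * (pow (ι N) t * pow (ι N) 1)
          ≤⟨ *-monoʳ (*-nonneg (pow-nonneg t (ι-nonneg N)) (pow-nonneg 1 (ι-nonneg N))) 2γ≤β^t ⟩
        pow β t * (pow (ι N) t * pow (ι N) 1)
          ≡⟨ solve 3 (λ b m n → b :* (m :* n) := n :* (b :* m)) refl (pow β t) (pow (ι N) t) (pow (ι N) 1) ⟩
        pow (ι N) 1 * (pow β t * pow (ι N) t)
          ≡⟨ cong (pow (ι N) 1 *_) (pow-distrib-* β (ι N) t) ⟨
        pow (ι N) 1 * pow (β * ι N) t
          ≤⟨ sumAll-pow 1 s (β * ι N) (ι ∘ codeg) (*-nonneg 0≤β (ι-nonneg N)) (ι-nonneg ∘ codeg) degrees ⟩
        sumAll 1 (λ q → pow (ι (codeg q)) t)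
          ≡⟨ codeg-sum t ⟨
        sumAll t (ι ∘ codeg)
          ∎

    pair : List V → List V → Bool → List V
    pair p p′ false = p
    pair p p′ true = p′

    -- The moments of all orders up to d and for both orientations of the pair are divided by N^k
    -- and added up to one weight `W`, so that a single average over complete pairs controls all of
    -- them. The left side of the strict hypothesis bounds the total weight of all complete pairs.
    dependentChoice : ∀ t d K → 1 ℕ.≤ N → 0ℚ ≤ K →
      ι (suc d) * (ι 2 * (pow (ι N) t * pow (ι (3 ℕ.* N)) t))
        < K * sumAll t (λ p → sumAll t (λ p′ → 𝟙[ complete p p′ ])) →
      ∃ λ (T : Bool → List V) →
        (∀ c → length (T c) ≡ t) × (complete (T false) (T true) ≡ true) ×
        (∀ c k → k ℕ.≤ d → moment (T c) (T (not c)) t k ≤ K * pow (ι N) k)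
    dependentChoice t d K 1≤N 0≤K R<K = result
      where
      open ≤-Reasoning
      open +-*-Solver

      κ : List V → List V → ℚ
      κ p p′ = 𝟙[ complete p p′ ]

      W : List V → List V → Fin (suc d) → ℚ
      W p p′ i = pow (inv N) (toℕ i) * (moment p p′ t (toℕ i) + moment p′ p t (toℕ i))

      B = pow (ι N) t * pow (ι (3 ℕ.* N)) t

      half : ∀ k → sumAll t (λ p → sumAll t (λ p′ → κ p p′ * moment p p′ t k)) ≤ pow (ι N) k * B
      half k = begin
        sumAll t (λ p → sumAll t (λ p′ → κ p p′ * moment p p′ t k))
          ≤⟨ sumIn-mono (λ _ → true) t (λ p _ → moment-average p t k) ⟩
        sumAll {N} t (λ p → pow (ι N) k * pow (ι (3 ℕ.* N)) t)
          ≡⟨ sumAll-const t (pow (ι N) k * pow (ι (3 ℕ.* N)) t) ⟩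
        pow (ι N) t * (pow (ι N) k * pow (ι (3 ℕ.* N)) t)
          ≡⟨ solve 3 (λ a b c → a :* (b :* c) := b :* (a :* c)) refl (pow (ι N) t) (pow (ι N) k) (pow (ι (3 ℕ.* N)) t) ⟩
        pow (ι N) k * B
          ∎

      half′ : ∀ k → sumAll t (λ p → sumAll t (λ p′ → κ p p′ * moment p′ p t k)) ≤ pow (ι N) k * B
      half′ k = begin
        sumAll t (λ p → sumAll t (λ p′ → κ p p′ * moment p′ p t k))
          ≡⟨ sumAll-comm t t (λ p p′ → κ p p′ * moment p′ p t k) ⟩
        sumAll t (λ p′ → sumAll t (λ p → κ p p′ * moment p′ p t k))
          ≡⟨ sumIn-cong (λ _ → true) t (λ p′ → sumIn-cong (λ _ → true) t λ p →
               cong (λ b → 𝟙[ b ] * moment p′ p t k) (all-nbr-comm p p′)) ⟩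
        sumAll t (λ p′ → sumAll t (λ p → κ p′ p * moment p′ p t k))
          ≤⟨ half k ⟩
        pow (ι N) k * B
          ∎

      inv-pow : ∀ k → pow (inv N) k * pow (ι N) k ≤ 1ℚ
      inv-pow k = begin
        pow (inv N) k * pow (ι N) k  ≡⟨ pow-distrib-* (inv N) (ι N) k ⟨
        pow (inv N * ι N) k          ≤⟨ pow-mono k (*-nonneg (inv-nonneg N) (ι-nonneg N)) (inv*ι≤1 N) ⟩
        pow 1ℚ k                     ≡⟨ pow-1 k ⟩
        1ℚ                           ∎

      level : ∀ i → sumAll t (λ p → sumAll t (λ p′ → κ p p′ * W p p′ i)) ≤ ι 2 * B
      level i = begin
        sumAll t (λ p → sumAll t (λ p′ → κ p p′ * W p p′ i))
          ≡⟨ sumIn-cong (λ _ → true) t (λ p → trans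
               (sumIn-cong (λ _ → true) t λ p′ →
                 solve 4 (λ k z a b → k :* (z :* (a :+ b)) := z :* (k :* a :+ k :* b)) refl
                   (κ p p′) z (moment p p′ t k) (moment p′ p t k))
               (trans (sumIn-*ˡ (λ _ → true) t z (λ p′ → κ p p′ * moment p p′ t k + κ p p′ * moment p′ p t k))
                 (cong (z *_) (sumIn-+ (λ _ → true) t (λ p′ → κ p p′ * moment p p′ t k) (λ p′ → κ p p′ * moment p′ p t k))))) ⟩
        sumAll t (λ p → z * (sumAll t (λ p′ → κ p p′ * moment p p′ t k) + sumAll t (λ p′ → κ p p′ * moment p′ p t k)))
          ≡⟨ trans (sumIn-*ˡ (λ _ → true) t z (λ p → x p + x′ p)) (cong (z *_) (sumIn-+ (λ _ → true) t x x′)) ⟩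
        z * (sumAll t (λ p → sumAll t (λ p′ → κ p p′ * moment p p′ t k)) + sumAll t (λ p → sumAll t (λ p′ → κ p p′ * moment p′ p t k)))
          ≤⟨ *-monoˡ (pow-nonneg k (inv-nonneg N)) (+-mono-≤ (half k) (half′ k)) ⟩
        z * (pow (ι N) k * B + pow (ι N) k * B)
          ≡⟨ solve 3 (λ z n b → z :* (n :* b :+ n :* b) := (z :* n) :* (b :+ b)) refl z (pow (ι N) k) B ⟩
        z * pow (ι N) k * (B + B)
          ≤⟨ *-monoʳ (+-nonneg 0≤B 0≤B) (inv-pow k) ⟩
        1ℚ * (B + B)
          ≡⟨ solve 1 (λ b → con 1ℚ :* (b :+ b) := (con 1ℚ :+ con 1ℚ) :* b) refl B ⟩
        (1ℚ + 1ℚ) * B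
          ≡⟨ cong (_* B) ι-2 ⟨
        ι 2 * B
          ∎
        where
        k = toℕ i
        z = pow (inv N) k
        x x′ : List V → ℚ
        x p = sumAll t (λ p′ → κ p p′ * moment p p′ t k)
        x′ p = sumAll t (λ p′ → κ p p′ * moment p′ p t k)
        0≤B : 0ℚ ≤ B
        0≤B = *-nonneg (pow-nonneg t (ι-nonneg N)) (pow-nonneg t (ι-nonneg (3 ℕ.* N)))

      total : sumAll t (λ p → sumAll t (λ p′ → κ p p′ * sum (W p p′))) ≤ ι (suc d) * (ι 2 * B)
      total = begin
        sumAll t (λ p → sumAll t (λ p′ → κ p p′ * sum (W p p′)))
          ≡⟨ sumIn-cong (λ _ → true) t (λ p → trans
               (sumIn-cong (λ _ → true) t λ p′ → *-distribˡ-sum (κ p p′) (W p p′))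
               (sumAll-sum t (λ p′ i → κ p p′ * W p p′ i))) ⟩
        sumAll t (λ p → sum (λ i → sumAll t (λ p′ → κ p p′ * W p p′ i)))
          ≡⟨ sumAll-sum t (λ p i → sumAll t (λ p′ → κ p p′ * W p p′ i)) ⟩
        sum (λ i → sumAll t (λ p → sumAll t (λ p′ → κ p p′ * W p p′ i)))
          ≤⟨ sum-mono level ⟩
        sum {suc d} (λ _ → ι 2 * B)
          ≡⟨ sum-const (suc d) (ι 2 * B) ⟩
        ι (suc d) * (ι 2 * B)
          ∎

      compare : sumAll t (λ p → sumAll t (λ p′ → κ p p′ * sum (W p p′)))
              < sumAll t (λ p → sumAll t (λ p′ → K * κ p p′))
      compare = ≤-<-trans total (<-≤-trans R<K (≤-reflexive (sym
        (trans (sumIn-cong (λ _ → true) t λ p → sumIn-*ˡ (λ _ → true) t K (κ p))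
          (sumIn-*ˡ (λ _ → true) t K (λ p → sumAll t (κ p)))))))

      W-nonneg : ∀ p p′ i → 0ℚ ≤ W p p′ i
      W-nonneg p p′ i = *-nonneg (pow-nonneg (toℕ i) (inv-nonneg N))
        (+-nonneg (moment-nonneg p p′ t (toℕ i)) (moment-nonneg p′ p t (toℕ i)))

      clear : ∀ {x} k → pow (inv N) k * x ≤ K → x ≤ K * pow (ι N) k
      clear {x} k z*x≤K = begin
        x                                  ≡⟨ *-identityˡ x ⟨
        1ℚ * x                             ≡⟨ cong (_* x) (trans (sym (pow-1 k)) (trans
                                                (cong (λ y → pow y k) (sym (inv-inverse 1≤N)))
                                                (pow-distrib-* (inv N) (ι N) k))) ⟩
        pow (inv N) k * pow (ι N) k * x    ≡⟨ solve 3 (λ a b c → a :* b :* c := (a :* c) :* b) refl (pow (inv N) k) (pow (ι N) k) x ⟩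
        pow (inv N) k * x * pow (ι N) k    ≤⟨ *-monoʳ (pow-nonneg k (ι-nonneg N)) z*x≤K ⟩
        K * pow (ι N) k                    ∎
      Choice : Set
      Choice = ∃ λ (T : Bool → List V) →
        (∀ c → length (T c) ≡ t) × (complete (T false) (T true) ≡ true) ×
        (∀ c k → k ℕ.≤ d → moment (T c) (T (not c)) t k ≤ K * pow (ι N) k)

      choose : ∀ p p′ b → length p ≡ t → length p′ ≡ t → complete p p′ ≡ b →
        𝟙[ b ] * sum (W p p′) < K * 𝟙[ b ] → Choice
      -- For an incomplete pair the strict inequality would read 0 < 0, so the average selects a
      -- complete one.
      choose p p′ false _ _ _ lt =
        contradiction (subst₂ _<_ (*-zeroˡ (sum (W p p′))) (*-zeroʳ K) lt) (<-irrefl refl)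
      choose p p′ true ∣p∣≡t ∣p′∣≡t eq lt = pair p p′ , lengths , eq , bounds
        where
        lengths : ∀ c → length (pair p p′ c) ≡ t
        lengths false = ∣p∣≡t
        lengths true = ∣p′∣≡t
        W≤K : ∀ k → k ℕ.≤ d → pow (inv N) k * (moment p p′ t k + moment p′ p t k) ≤ K
        W≤K k k≤d = subst (λ j → pow (inv N) j * (moment p p′ t j + moment p′ p t j) ≤ K)
          (Fin.toℕ-fromℕ< (s≤s k≤d))
          (≤-trans (term≤sum (W-nonneg p p′) (fromℕ< (s≤s k≤d)))
            (<⇒≤ (subst₂ _<_ (*-identityˡ (sum (W p p′))) (*-identityʳ K) lt)))
        bounds : ∀ c k → k ℕ.≤ d → moment (pair p p′ c) (pair p p′ (not c)) t k ≤ K * pow (ι N) k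
        bounds false k k≤d = ≤-trans (≤-+ʳ (moment-nonneg p′ p t k)) (clear k (W≤K k k≤d))
        bounds true k k≤d = ≤-trans (≤-+ˡ (moment-nonneg p p′ t k)) (clear k (W≤K k k≤d))

      result : Choice
      result =
        let p , ∣p∣≡t , lt = sumAll-<⇒∃ t _ _ compare
            p′ , ∣p′∣≡t , lt′ = sumAll-<⇒∃ t _ _ lt
        in choose p p′ (complete p p′) ∣p∣≡t ∣p′∣≡t refl lt′

  -- The meta variable defining go is solved by the local function of orderedEdgeCount:
  -- the with-abstractions below make all its arguments distinct variables.
  mutual
    private
      go : ∀ {k} → Graph (suc k) → ∀ {m} → (Fin m → ℕ) → ℕ
      go = _

    private
      go≡foldr : ∀ {k} (G : Graph (suc k)) {m} (f : Fin m → ℕ) → go G f ≡ foldr ℕ._+_ 0 f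

    edgeCount≡foldr : ∀ {N} (G : Graph N) → orderedEdgeCount G ≡ foldr ℕ._+_ 0 (λ i → count (adj G i))
    edgeCount≡foldr {zero} G = refl
    edgeCount≡foldr {suc zero} G = refl
    edgeCount≡foldr {suc (suc k)} G
      with count (adj G zero) | count (adj G (suc zero)) | (λ i → count (adj G (suc (suc i))))
    ... | a | b | f with suc k
    ...   | l = cong (λ x → a ℕ.+ (b ℕ.+ x)) (go≡foldr G f)

    go≡foldr G {zero} f = refl
    go≡foldr G {suc m} f = cong (f zero ℕ.+_) (go≡foldr G (f ∘ suc))

  ι-foldr : ∀ {n} (f : Fin n → ℕ) → ι (foldr ℕ._+_ 0 f) ≡ sum (ι ∘ f)
  ι-foldr {zero} f = ι-0
  ι-foldr {suc n} f = trans (ι-+ (f zero) (foldr ℕ._+_ 0 (f ∘ suc))) (cong (ι (f zero) +_) (ι-foldr (f ∘ suc)))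

  codeg-total : ∀ {N} (G : Graph N) → sumAll 1 (λ q → ι (codeg G q)) ≡ ι (orderedEdgeCount G)
  codeg-total G = trans
    (sum-cong-≗ λ w → trans (*-identityˡ _) (cong ι (count-cong λ i → Bool.∧-identityʳ (adj G w i))))
    (trans (sym (ι-foldr (λ w → count (adj G w)))) (cong ι (sym (edgeCount≡foldr G))))

-- The random homomorphism and its comparison with uniform tuples.

module RandomHomomorphism where

  open import Data.Bool using (Bool; true; false; _∧_; not; if_then_else_)
  open import Data.Bool.ListAction using (any)
  import Data.Bool.Properties as Bool
  open import Data.Fin as Fin using (Fin; zero; suc)
  open import Data.List using (List; []; _∷_; map)
  open import Data.Nat as ℕ using (ℕ; zero; suc; z≤n; s≤s)
  import Data.Nat.Properties as ℕ
  open import Data.Product using (_×_; _,_; proj₁; proj₂)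
  open import Data.Rational
  open import Data.Rational.Properties
  open import Data.Rational.Solver using (module +-*-Solver)
  open import Data.Sum using (inj₁; inj₂)
  open import Function using (_∘_)
  open import Relation.Binary.PropositionalEquality
  open import Relation.Nullary using (does)
  open Rationals
  open FiniteSums
  open CommonNeighbourhoods

  -- 0 for empty A.
  mean : ∀ {N} → (Fin N → Bool) → (Fin N → ℚ) → ℚ
  mean A ψ = inv (count A) * sum (λ w → 𝟙[ A w ] * ψ w)

  module _ {N : ℕ} (A : Fin N → Bool) where

    mean-mono : ∀ {φ ψ} → (∀ w → φ w ≤ ψ w) → mean A φ ≤ mean A ψ
    mean-mono φ≤ψ = *-monoˡ (inv-nonneg (count A)) (sum-mono λ w → *-monoˡ (𝟙-nonneg (A w)) (φ≤ψ w))

    mean-cong : ∀ {φ ψ} → (∀ w → φ w ≡ ψ w) → mean A φ ≡ mean A ψ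
    mean-cong φ≗ψ = cong (inv (count A) *_) (sum-cong-≗ λ w → cong (𝟙[ A w ] *_) (φ≗ψ w))

    mean-+ : ∀ φ ψ → mean A (λ w → φ w + ψ w) ≡ mean A φ + mean A ψ
    mean-+ φ ψ = trans
      (cong (inv (count A) *_) (trans
        (sum-cong-≗ λ w → *-distribˡ-+ 𝟙[ A w ] (φ w) (ψ w))
        (∑-distrib-+ (λ w → 𝟙[ A w ] * φ w) (λ w → 𝟙[ A w ] * ψ w))))
      (*-distribˡ-+ (inv (count A)) _ _)

    mean-*ʳ : ∀ φ c → mean A (λ w → φ w * c) ≡ mean A φ * c
    mean-*ʳ φ c = begin
      inv (count A) * sum (λ w → 𝟙[ A w ] * (φ w * c))
        ≡⟨ cong (inv (count A) *_) (trans
             (sum-cong-≗ λ w → solve 3 (λ a x c → a :* (x :* c) := c :* (a :* x)) refl 𝟙[ A w ] (φ w) c)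
             (sym (*-distribˡ-sum c (λ w → 𝟙[ A w ] * φ w)))) ⟩
      inv (count A) * (c * sum (λ w → 𝟙[ A w ] * φ w))
        ≡⟨ solve 3 (λ i c s → i :* (c :* s) := (i :* s) :* c) refl (inv (count A)) c (sum (λ w → 𝟙[ A w ] * φ w)) ⟩
      mean A φ * c
        ∎
      where
      open ≡-Reasoning
      open +-*-Solver

    mean-const : ∀ c → 0ℚ ≤ c → mean A (λ _ → c) ≤ c
    mean-const c 0≤c = begin
      inv (count A) * sum (λ w → 𝟙[ A w ] * c)  ≡⟨ cong (inv (count A) *_) (sum-indicator-* A c) ⟩
      inv (count A) * (ι (count A) * c)         ≡⟨ *-assoc (inv (count A)) (ι (count A)) c ⟨
      inv (count A) * ι (count A) * c           ≤⟨ *-monoʳ 0≤c (inv*ι≤1 (count A)) ⟩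
      1ℚ * c                                    ≡⟨ *-identityˡ c ⟩
      c                                         ∎
      where open ≤-Reasoning

  count-mono : ∀ {n} {p q : Fin n → Bool} → (∀ i → p i ≡ true → q i ≡ true) → count p ℕ.≤ count q
  count-mono {zero} p⇒q = z≤n
  count-mono {suc n} {p} {q} p⇒q = ℕ.+-mono-≤ (at-zero (p zero) (q zero) (p⇒q zero)) (count-mono (p⇒q ∘ suc))
    where
    at-zero : ∀ b c → (b ≡ true → c ≡ true) → (if b then 1 else 0) ℕ.≤ (if c then 1 else 0)
    at-zero false c _ = z≤n
    at-zero true c b⇒c rewrite b⇒c refl = ℕ.≤-refl

  -- Weighted arithmetic-geometric mean without square roots: either term alone suffices.
  young : ∀ {x y y′ l l′} → 0ℚ ≤ x → 0ℚ ≤ y → 0ℚ ≤ y′ → 0ℚ ≤ l → 0ℚ ≤ l′ → y′ * y ≡ 1ℚ → l′ * l ≡ 1ℚ →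
    x ≤ l * (x * x * y′) + l′ * y
  young {x} {y} {y′} {l} {l′} 0≤x 0≤y 0≤y′ 0≤l 0≤l′ y′y≡1 l′l≡1 with ≤-total x (l′ * y)
  ... | inj₁ x≤l′y = ≤-trans x≤l′y (≤-+ˡ (*-nonneg 0≤l (*-nonneg (*-nonneg 0≤x 0≤x) 0≤y′)))
  ... | inj₂ l′y≤x = ≤-trans large (≤-+ʳ (*-nonneg 0≤l′ 0≤y))
    where
    open ≤-Reasoning
    open +-*-Solver
    large : x ≤ l * (x * x * y′)
    large = begin
      x                              ≡⟨ trans (*-identityˡ (x * 1ℚ)) (*-identityʳ x) ⟨
      1ℚ * (x * 1ℚ)                  ≡⟨ cong₂ (λ a b → a * (x * b)) (sym l′l≡1) (sym y′y≡1) ⟩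
      l′ * l * (x * (y′ * y))        ≡⟨ solve 5 (λ x y y′ l l′ → l′ :* l :* (x :* (y′ :* y)) := l :* (x :* (l′ :* y) :* y′)) refl x y y′ l l′ ⟩
      l * (x * (l′ * y) * y′)        ≤⟨ *-monoˡ 0≤l (*-monoʳ 0≤y′ (*-monoˡ 0≤x l′y≤x)) ⟩
      l * (x * x * y′)               ∎

  module Process {n N : ℕ} (F : Graph n) (col : Fin n → Bool) (G : Graph N) (T : Bool → List (Fin N)) where

    Hist : Set
    Hist = List (Fin n × Fin N)

    Z : Bool → Fin N → Bool
    Z c = nbr G (T c)

    images : (Fin n → Bool) → Hist → List (Fin N)
    images S [] = []
    images S ((u , w) ∷ h) = if S u then w ∷ images S h else images S h

    cand : Bool → List (Fin N) → Fin N → Bool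
    cand c q w = Z c w ∧ nbr G q w

    back : Fin n → Hist → List (Fin N)
    back v h = images (adj F v) h

    target : Fin n → Hist → Fin N → Bool
    target v h = cand (col v) (back v h)

    used : Hist → Fin N → Bool
    used h w = any (λ e → does (w Fin.≟ proj₂ e)) h

    free : Fin n → Hist → Fin N → Bool
    free v h w = target v h w ∧ not (used h w)

    -- Collisions are allowed if more than half of the candidates are used, so that the
    -- distribution of the next image is always nearly uniform on the candidates.
    avail : Fin n → Hist → Fin N → Bool
    avail v h = if count (target v h) ℕ.≤ᵇ 2 ℕ.* count (free v h) then free v h else target v h

    -- Taken from all candidates, used or not: it thus depends on the history only through the
    -- images of the earlier neighbours of `v`, and `density` applies to it.
    X : Fin n → Hist → ℕ
    X v h = spread G (count (target v h))

    -- Expectation for the order whose last vertex is the head. It is defined without reference to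
    -- nonemptiness, so it may have total mass below 1, and constants are only bounded, not
    -- preserved.
    E : List (Fin n) → (Hist → ℚ) → ℚ
    E [] φ = φ []
    E (v ∷ r) φ = E r (λ h → mean (avail v h) (λ w → φ ((v , w) ∷ h)))

    E-mono : ∀ r {φ ψ} → (∀ h → map proj₁ h ≡ r → φ h ≤ ψ h) → E r φ ≤ E r ψ
    E-mono [] φ≤ψ = φ≤ψ [] refl
    E-mono (v ∷ r) φ≤ψ = E-mono r λ h eq →
      mean-mono (avail v h) λ w → φ≤ψ ((v , w) ∷ h) (cong (v ∷_) eq)

    E-cong : ∀ r {φ ψ} → (∀ h → φ h ≡ ψ h) → E r φ ≡ E r ψ
    E-cong [] φ≗ψ = φ≗ψ []
    E-cong (v ∷ r) φ≗ψ = E-cong r λ h → mean-cong (avail v h) λ w → φ≗ψ ((v , w) ∷ h)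

    E-+ : ∀ r φ ψ → E r (λ h → φ h + ψ h) ≡ E r φ + E r ψ
    E-+ [] φ ψ = refl
    E-+ (v ∷ r) φ ψ = trans
      (E-cong r λ h → mean-+ (avail v h) (λ w → φ ((v , w) ∷ h)) (λ w → ψ ((v , w) ∷ h)))
      (E-+ r (λ h → mean (avail v h) (λ w → φ ((v , w) ∷ h))) (λ h → mean (avail v h) (λ w → ψ ((v , w) ∷ h))))

    E-*ʳ : ∀ r φ c → E r (λ h → φ h * c) ≡ E r φ * c
    E-*ʳ [] φ c = refl
    E-*ʳ (v ∷ r) φ c = trans
      (E-cong r λ h → mean-*ʳ (avail v h) (λ w → φ ((v , w) ∷ h)) c)
      (E-*ʳ r (λ h → mean (avail v h) (λ w → φ ((v , w) ∷ h))) c)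

    E-*ˡ : ∀ r φ c → E r (λ h → c * φ h) ≡ c * E r φ
    E-*ˡ r φ c = trans (E-cong r λ h → *-comm c (φ h)) (trans (E-*ʳ r φ c) (*-comm (E r φ) c))

    E-const : ∀ r c → 0ℚ ≤ c → E r (λ _ → c) ≤ c
    E-const [] c 0≤c = ≤-refl
    E-const (v ∷ r) c 0≤c = ≤-trans (E-mono r λ h _ → mean-const (avail v h) c 0≤c) (E-const r c 0≤c)

    E-drop : ∀ v r φ → (∀ h → 0ℚ ≤ φ h) → E r (λ h → mean (avail v h) (λ _ → φ h)) ≤ E r φ
    E-drop v r φ 0≤φ = E-mono r λ h _ → mean-const (avail v h) (φ h) (0≤φ h)

    E-sum : ∀ r {m} (φ : Fin m → Hist → ℚ) C → (∀ i → E r (φ i) ≤ C) → E r (λ h → sum (λ i → φ i h)) ≤ ι m * C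
    E-sum r {zero} φ C _ = ≤-trans (E-const r 0ℚ ≤-refl) (≤-reflexive (sym (trans (cong (_* C) ι-0) (*-zeroˡ C))))
    E-sum r {suc m} φ C φ≤C = begin
      E r (λ h → φ zero h + sum (λ i → φ (suc i) h))        ≡⟨ E-+ r (φ zero) (λ h → sum (λ i → φ (suc i) h)) ⟩
      E r (φ zero) + E r (λ h → sum (λ i → φ (suc i) h))    ≤⟨ +-mono-≤ (φ≤C zero) (E-sum r (φ ∘ suc) C (φ≤C ∘ suc)) ⟩
      C + ι m * C                                           ≡⟨ solve 2 (λ c m → c :+ m :* c := (con 1ℚ :+ m) :* c) refl C (ι m) ⟩
      (1ℚ + ι m) * C                                        ≡⟨ cong (_* C) (ι-suc m) ⟨
      ι (suc m) * C                                         ∎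
      where
      open ≤-Reasoning
      open +-*-Solver

    E-sumAll : ∀ r k (φ : List (Fin N) → Hist → ℚ) C → (∀ q → E r (φ q) ≤ C) →
      E r (λ h → sumAll k (λ q → φ q h)) ≤ pow (ι N) k * C
    E-sumAll r zero φ C φ≤C = ≤-trans (φ≤C []) (≤-reflexive (sym (*-identityˡ C)))
    E-sumAll r (suc k) φ C φ≤C = begin
      E r (λ h → sumAll k (λ q → sum (λ w → 1ℚ * φ (w ∷ q) h)))
        ≤⟨ E-sumAll r k (λ q h → sum (λ w → 1ℚ * φ (w ∷ q) h)) (ι N * C) (λ q →
             E-sum r (λ w h → 1ℚ * φ (w ∷ q) h) C (λ w →
               ≤-trans (≤-reflexive (E-cong r λ h → *-identityˡ (φ (w ∷ q) h))) (φ≤C (w ∷ q)))) ⟩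
      pow (ι N) k * (ι N * C)
        ≡⟨ solve 3 (λ p m c → p :* (m :* c) := (m :* p) :* c) refl (pow (ι N) k) (ι N) C ⟩
      pow (ι N) (suc k) * C
        ∎
      where
      open ≤-Reasoning
      open +-*-Solver

    avail⇒target : ∀ v h w → avail v h w ≡ true → target v h w ≡ true
    avail⇒target v h w with count (target v h) ℕ.≤ᵇ 2 ℕ.* count (free v h)
    ... | false = λ eq → eq
    ... | true = Bool.∧-conicalˡ (target v h w) (not (used h w))

    target⇒Z : ∀ v h w → target v h w ≡ true → Z (col v) w ≡ true
    target⇒Z v h w = Bool.∧-conicalˡ (Z (col v) w) (nbr G (back v h) w)

    target≤2avail : ∀ v h → count (target v h) ℕ.≤ 2 ℕ.* count (avail v h)
    target≤2avail v h with count (target v h) ℕ.≤ᵇ 2 ℕ.* count (free v h) in eq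
    ... | true = ℕ.≤ᵇ⇒≤ _ _ (subst Data.Bool.T (sym eq) _)
    ... | false = ℕ.m≤m+n _ _

    -- At least half of the candidates are available, and the spread is at least 2N divided by their
    -- number: its factor 2 pays for the halving.
    inv-avail : ∀ v h → inv (count (avail v h)) ≤ ι (X v h) * inv N
    inv-avail v h = bound {X v h} (count (avail v h)) N (count≤n (avail v h)) λ 1≤a → begin
      2 ℕ.* N                                  ≤⟨ spread-lower G (count (target v h))
                                                    (ℕ.≤-trans 1≤a (count-mono (avail⇒target v h))) ⟩
      X v h ℕ.* count (target v h)             ≤⟨ ℕ.*-monoʳ-≤ (X v h) (target≤2avail v h) ⟩
      X v h ℕ.* (2 ℕ.* count (avail v h))      ≡⟨ ℕ.*-assoc (X v h) 2 (count (avail v h)) ⟨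
      X v h ℕ.* 2 ℕ.* count (avail v h)        ≡⟨ cong (ℕ._* count (avail v h)) (ℕ.*-comm (X v h) 2) ⟩
      2 ℕ.* X v h ℕ.* count (avail v h)        ≡⟨ ℕ.*-assoc 2 (X v h) (count (avail v h)) ⟩
      2 ℕ.* (X v h ℕ.* count (avail v h))      ∎
      where
      open ℕ.≤-Reasoning
      bound : ∀ {x} m M → m ℕ.≤ M → (1 ℕ.≤ m → 2 ℕ.* M ℕ.≤ 2 ℕ.* (x ℕ.* m)) → inv m ≤ ι x * inv M
      bound {x} zero M _ _ = ≤-trans (≤-reflexive inv-zero) (*-nonneg (ι-nonneg x) (inv-nonneg M))
      bound {x} (suc m) (suc M) _ 2M≤2xm = R.begin
        inv (suc m)                                 R.≡⟨ trans (cong (inv (suc m) *_) (inv-inverse (s≤s z≤n))) (*-identityʳ _) ⟨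
        inv (suc m) * (inv (suc M) * ι (suc M))     R.≤⟨ *-monoˡ (inv-nonneg (suc m)) (*-monoˡ (inv-nonneg (suc M))
                                                          (ι-mono (ℕ.*-cancelˡ-≤ 2 (2M≤2xm (s≤s z≤n))))) ⟩
        inv (suc m) * (inv (suc M) * ι (x ℕ.* suc m))
          R.≡⟨ cong (λ z → inv (suc m) * (inv (suc M) * z)) (ι-* x (suc m)) ⟩
        inv (suc m) * (inv (suc M) * (ι x * ι (suc m)))
          R.≡⟨ solve 4 (λ a b x m → a :* (b :* (x :* m)) := a :* m :* (x :* b)) refl (inv (suc m)) (inv (suc M)) (ι x) (ι (suc m)) ⟩
        inv (suc m) * ι (suc m) * (ι x * inv (suc M))
          R.≡⟨ trans (cong (_* (ι x * inv (suc M))) (inv-inverse (s≤s z≤n))) (*-identityˡ _) ⟩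
        ι x * inv (suc M)                           R.∎
        where
        module R = ≤-Reasoning
        open +-*-Solver

    -- Candidacy is weakened to membership in `Z`, which does not depend on the history. Apart from
    -- the factor `X v h` the bounding measure is therefore fixed.
    mean-avail : ∀ v h ψ → (∀ w → 0ℚ ≤ ψ w) →
      mean (avail v h) ψ ≤ ι (X v h) * inv N * sum (λ w → 𝟙[ Z (col v) w ] * ψ w)
    mean-avail v h ψ 0≤ψ = *-mono-≤₀ (inv-nonneg (count (avail v h)))
      (sum-nonneg λ w → *-nonneg (𝟙-nonneg (avail v h w)) (0≤ψ w)) (inv-avail v h)
      (sum-mono λ w → *-monoʳ (0≤ψ w) (𝟙-mono (avail v h w) (target⇒Z v h w ∘ avail⇒target v h w)))
      where
      𝟙-mono : ∀ b {c} → (b ≡ true → c ≡ true) → 𝟙[ b ] ≤ 𝟙[ c ]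
      𝟙-mono false {c} _ = 𝟙-nonneg c
      𝟙-mono true b⇒c = ≤-reflexive (sym (cong 𝟙[_] (b⇒c refl)))

    hits : (Fin n → Bool) → List (Fin n) → ℕ
    hits S [] = 0
    hits S (u ∷ r) = (if S u then 1 else 0) ℕ.+ hits S r

    -- This is 1/Y when `S` is the neighbourhood of the vertex to be embedded.
    weight : (Fin n → Bool) → Hist → ℚ
    weight S [] = 1ℚ
    weight S ((u , w) ∷ h) = if S u then inv (X u h) * weight S h else weight S h

    weight-nonneg : ∀ S h → 0ℚ ≤ weight S h
    weight-nonneg S [] = 0≤1
    weight-nonneg S ((u , w) ∷ h) = step (S u)
      where
      step : ∀ b → 0ℚ ≤ (if b then inv (X u h) * weight S h else weight S h)
      step false = weight-nonneg S h
      step true = *-nonneg (inv-nonneg (X u h)) (weight-nonneg S h)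

    -- After division by the spreads, the images of S are dominated by the uniform distribution.
    density : ∀ S c r (g : List (Fin N) → ℚ) → (∀ q → 0ℚ ≤ g q) → (∀ u → S u ≡ true → col u ≡ c) →
      E r (λ h → g (images S h) * weight S h) ≤ pow (inv N) (hits S r) * sumIn (Z c) (hits S r) g
    density S c [] g 0≤g S⇒c = ≤-reflexive (*-comm (g []) 1ℚ)
    density S c (v ∷ r) g 0≤g S⇒c = step (S v) (S⇒c v)
      where
      open ≤-Reasoning
      open +-*-Solver
      step : ∀ b → (b ≡ true → col v ≡ c) →
        E r (λ h → mean (avail v h) (λ w → g (if b then w ∷ images S h else images S h)
                                           * (if b then inv (X v h) * weight S h else weight S h)))
          ≤ pow (inv N) ((if b then 1 else 0) ℕ.+ hits S r) * sumIn (Z c) ((if b then 1 else 0) ℕ.+ hits S r) g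
      step false _ = ≤-trans
        (E-drop v r (λ h → g (images S h) * weight S h) λ h → *-nonneg (0≤g (images S h)) (weight-nonneg S h))
        (density S c r g 0≤g S⇒c)
      step true v∈c = begin
        E r (λ h → mean (avail v h) (λ w → g (w ∷ images S h) * (inv (X v h) * weight S h)))
          ≤⟨ E-mono r (λ h _ → pointwise h) ⟩
        E r (λ h → g′ (images S h) * weight S h)
          ≤⟨ density S c r g′ 0≤g′ S⇒c ⟩
        pow (inv N) k * sumIn (Z c) k g′
          ≡⟨ cong (pow (inv N) k *_) (sumIn-*ˡ (Z c) k (inv N) (λ q → sum (λ w → 𝟙[ Z c w ] * g (w ∷ q)))) ⟩
        pow (inv N) k * (inv N * sumIn (Z c) (suc k) g)
          ≡⟨ solve 3 (λ p i s → p :* (i :* s) := i :* p :* s) refl (pow (inv N) k) (inv N) (sumIn (Z c) (suc k) g) ⟩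
        pow (inv N) (suc k) * sumIn (Z c) (suc k) g
          ∎
        where
        k = hits S r
        -- Integrating out the newest image leaves a function of one entry fewer; the factor X from
        -- `mean-avail` cancels against the newest factor of the weight.
        g′ : List (Fin N) → ℚ
        g′ q = inv N * sum (λ w → 𝟙[ Z c w ] * g (w ∷ q))
        0≤g′ : ∀ q → 0ℚ ≤ g′ q
        0≤g′ q = *-nonneg (inv-nonneg N) (sum-nonneg λ w → *-nonneg (𝟙-nonneg (Z c w)) (0≤g (w ∷ q)))
        pointwise : ∀ h → mean (avail v h) (λ w → g (w ∷ images S h) * (inv (X v h) * weight S h)) ≤ g′ (images S h) * weight S h
        pointwise h = begin
          mean (avail v h) (λ w → g (w ∷ q) * (inv x * weight S h))
            ≡⟨ mean-*ʳ (avail v h) (λ w → g (w ∷ q)) (inv x * weight S h) ⟩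
          mean (avail v h) (λ w → g (w ∷ q)) * (inv x * weight S h)
            ≤⟨ *-monoʳ (*-nonneg (inv-nonneg x) (weight-nonneg S h)) (mean-avail v h (λ w → g (w ∷ q)) (λ w → 0≤g (w ∷ q))) ⟩
          ι x * inv N * sum (λ w → 𝟙[ Z (col v) w ] * g (w ∷ q)) * (inv x * weight S h)
            ≡⟨ cong (λ c′ → ι x * inv N * sum (λ w → 𝟙[ Z c′ w ] * g (w ∷ q)) * (inv x * weight S h)) (v∈c refl) ⟩
          ι x * inv N * s * (inv x * weight S h)
            ≡⟨ solve 5 (λ x i s x′ y → x :* i :* s :* (x′ :* y) := x′ :* x :* (i :* s :* y)) refl (ι x) (inv N) s (inv x) (weight S h) ⟩
          inv x * ι x * (g′ q * weight S h)
            ≡⟨ trans (cong (_* (g′ q * weight S h)) (inv-inverse (spread-pos G (count (target v h))))) (*-identityˡ _) ⟩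
          g′ q * weight S h
            ∎
          where
          q = images S h
          x = X v h
          s = sum (λ w → 𝟙[ Z c w ] * g (w ∷ q))

-- Moments along the process, exponential tilting, existence of good runs.

module ProcessBounds where

  open import Data.Bool using (Bool; true; false; _∧_; not; if_then_else_)
  open import Data.Bool.ListAction using (all)
  import Data.Bool.Properties as Bool
  open import Data.Fin using (Fin)
  open import Data.List using (List; []; _∷_; length; map)
  open import Data.Nat as ℕ using (ℕ; suc; z≤n; s≤s)
  import Data.Nat.Properties as ℕ
  open import Data.Product using (∃; _×_; _,_; proj₁)
  open import Data.Rational
  open import Data.Rational.Properties
  open import Data.Rational.Solver using (module +-*-Solver)
  open import Data.Sum using (inj₁; inj₂)
  open import Data.Unit using (⊤)
  open import Relation.Binary.PropositionalEquality
  open import Relation.Nullary using (contradiction)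
  open Rationals
  open FiniteSums
  open CommonNeighbourhoods
  open RandomHomomorphism

  mean-<⇒∃ : ∀ {N} (A : Fin N → Bool) φ {c} → 1 ℕ.≤ count A → mean A φ < c → ∃ λ w → A w ≡ true × φ w < c
  mean-<⇒∃ A φ {c} 1≤A mean<c = let w , lt = sum-<⇒∃ _ _ sums in w , select (A w) lt
    where
    open ≤-Reasoning
    open +-*-Solver
    S = sum (λ w → 𝟙[ A w ] * φ w)
    sums : S < sum (λ w → 𝟙[ A w ] * c)
    sums = *-cancelˡ-<₀ (inv-nonneg (count A)) (begin-strict
      inv (count A) * S                         <⟨ mean<c ⟩
      c                                         ≡⟨ trans (cong (_* c) (inv-inverse 1≤A)) (*-identityˡ c) ⟨
      inv (count A) * ι (count A) * c           ≡⟨ *-assoc (inv (count A)) (ι (count A)) c ⟩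
      inv (count A) * (ι (count A) * c)         ≡⟨ cong (inv (count A) *_) (sum-indicator-* A c) ⟨
      inv (count A) * sum (λ w → 𝟙[ A w ] * c)  ∎)
    select : ∀ b {x} → 𝟙[ b ] * x < 𝟙[ b ] * c → b ≡ true × x < c
    select false {x} lt = contradiction (subst₂ _<_ (*-zeroˡ x) (*-zeroˡ c) lt) (<-irrefl refl)
    select true {x} lt = refl , subst₂ _<_ (*-identityˡ x) (*-identityˡ c) lt

  pow-⊔ : ∀ x y a → pow (ι (x ℕ.⊔ y)) a ≤ pow (ι x) a + pow (ι y) a
  pow-⊔ x y a with ℕ.⊔-sel x y
  ... | inj₁ eq = ≤-trans (≤-reflexive (cong (λ z → pow (ι z) a) eq)) (≤-+ʳ (pow-nonneg a (ι-nonneg y)))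
  ... | inj₂ eq = ≤-trans (≤-reflexive (cong (λ z → pow (ι z) a) eq)) (≤-+ˡ (pow-nonneg a (ι-nonneg x)))

  module _ {n N : ℕ} (F : Graph n) (col : Fin n → Bool) (G : Graph N) (T : Bool → List (Fin N)) where

    open Process F col G T

    Ordered : ℕ → List (Fin n) → Set
    Ordered d [] = ⊤
    Ordered d (v ∷ r) = hits (adj F v) r ℕ.≤ d × Ordered d r

    product : (Fin n → Bool) → Hist → ℚ
    product S [] = 1ℚ
    product S ((u , w) ∷ h) = if S u then ι (X u h) * product S h else product S h

    -- The start value 1 keeps the maximum at least 1, so that its exponent may be raised from the
    -- number of factors to `a`; it is the origin of the 1 in Y ≤ 1 + ∑ X_u^a.
    peak : (Fin n → Bool) → Hist → ℕ
    peak S [] = 1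
    peak S ((u , w) ∷ h) = if S u then X u h ℕ.⊔ peak S h else peak S h

    powerSum : ℕ → (Fin n → Bool) → Hist → ℚ
    powerSum a S [] = 0ℚ
    powerSum a S ((u , w) ∷ h) = (if S u then pow (ι (X u h)) a else 0ℚ) + powerSum a S h

    powerSum-nonneg : ∀ a S h → 0ℚ ≤ powerSum a S h
    powerSum-nonneg a S [] = ≤-refl
    powerSum-nonneg a S ((u , w) ∷ h) = +-nonneg (step (S u)) (powerSum-nonneg a S h)
      where
      step : ∀ b → 0ℚ ≤ (if b then pow (ι (X u h)) a else 0ℚ)
      step false = ≤-refl
      step true = pow-nonneg a (ι-nonneg (X u h))

    product-nonneg : ∀ S h → 0ℚ ≤ product S h
    product-nonneg S [] = 0≤1
    product-nonneg S ((u , w) ∷ h) = step (S u)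
      where
      step : ∀ b → 0ℚ ≤ (if b then ι (X u h) * product S h else product S h)
      step false = product-nonneg S h
      step true = *-nonneg (ι-nonneg (X u h)) (product-nonneg S h)

    weight*product : ∀ S h → weight S h * product S h ≡ 1ℚ
    weight*product S [] = refl
    weight*product S ((u , w) ∷ h) = step (S u)
      where
      open +-*-Solver
      x = X u h
      step : ∀ b → (if b then inv x * weight S h else weight S h) * (if b then ι x * product S h else product S h) ≡ 1ℚ
      step false = weight*product S h
      step true = trans
        (solve 4 (λ i y x p → i :* y :* (x :* p) := i :* x :* (y :* p)) refl (inv x) (weight S h) (ι x) (product S h))
        (cong₂ _*_ (inv-inverse (spread-pos G (count (target u h)))) (weight*product S h))

    1≤peak : ∀ S h → 1 ℕ.≤ peak S h
    1≤peak S [] = ℕ.≤-refl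
    1≤peak S ((u , w) ∷ h) = step (S u)
      where
      step : ∀ b → 1 ℕ.≤ (if b then X u h ℕ.⊔ peak S h else peak S h)
      step false = 1≤peak S h
      step true = ℕ.≤-trans (1≤peak S h) (ℕ.m≤n⊔m (X u h) (peak S h))

    product≤peak : ∀ S h → product S h ≤ pow (ι (peak S h)) (hits S (map proj₁ h))
    product≤peak S [] = ≤-refl
    product≤peak S ((u , w) ∷ h) = step (S u)
      where
      x = X u h
      m = peak S h
      k = hits S (map proj₁ h)
      step : ∀ b → (if b then ι x * product S h else product S h)
        ≤ pow (ι (if b then x ℕ.⊔ m else m)) ((if b then 1 else 0) ℕ.+ k)
      step false = product≤peak S h
      step true = *-mono-≤₀ (ι-nonneg x) (product-nonneg S h) (ι-mono (ℕ.m≤m⊔n x m))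
        (≤-trans (product≤peak S h) (pow-mono k (ι-nonneg m) (ι-mono (ℕ.m≤n⊔m x m))))

    peak≤powerSum : ∀ a S h → pow (ι (peak S h)) a ≤ 1ℚ + powerSum a S h
    peak≤powerSum a S [] = ≤-reflexive (trans (cong (λ x → pow x a) ι-1) (trans (pow-1 a) (sym (+-identityʳ 1ℚ))))
    peak≤powerSum a S ((u , w) ∷ h) = step (S u)
      where
      open ≤-Reasoning
      open +-*-Solver
      x = X u h
      m = peak S h
      s = powerSum a S h
      step : ∀ b → pow (ι (if b then x ℕ.⊔ m else m)) a ≤ 1ℚ + ((if b then pow (ι x) a else 0ℚ) + s)
      step false = ≤-trans (peak≤powerSum a S h) (≤-reflexive (cong (1ℚ +_) (sym (+-identityˡ s))))
      step true = begin
        pow (ι (x ℕ.⊔ m)) a          ≤⟨ pow-⊔ x m a ⟩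
        pow (ι x) a + pow (ι m) a    ≤⟨ +-monoʳ-≤ (pow (ι x) a) (peak≤powerSum a S h) ⟩
        pow (ι x) a + (1ℚ + s)       ≡⟨ solve 2 (λ p s → p :+ (con 1ℚ :+ s) := con 1ℚ :+ (p :+ s)) refl (pow (ι x) a) s ⟩
        1ℚ + (pow (ι x) a + s)       ∎

    product≤powerSum : ∀ a S h → hits S (map proj₁ h) ℕ.≤ a → product S h ≤ 1ℚ + powerSum a S h
    product≤powerSum a S h k≤a = ≤-trans (product≤peak S h)
      (≤-trans (pow-exp-mono (1≤ι (1≤peak S h)) k≤a) (peak≤powerSum a S h))

    -- Here `l` and `l′` are λ and 1/λ. The hypothesis `recursion` is exactly the induction step:
    -- the first summand bounds the part of X^(2a) / Y, and (d + 1)L bounds the expectation of Y.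
    module MomentBound
      (proper : ∀ u v → adj F u v ≡ true → col u ≢ col v)
      (a d : ℕ) (d≤a : d ℕ.≤ a) (K L l l′ : ℚ)
      (0≤K : 0ℚ ≤ K) (1≤L : 1ℚ ≤ L) (0≤l : 0ℚ ≤ l) (0≤l′ : 0ℚ ≤ l′) (l′l≡1 : l′ * l ≡ 1ℚ)
      (recursion : l * K + l′ * (ι (suc d) * L) ≤ L)
      (moments : ∀ c k → k ℕ.≤ d → moment G (T c) (T (not c)) (a ℕ.+ a) k ≤ K * pow (ι N) k)
      where

      open ≤-Reasoning
      open +-*-Solver

      0≤L : 0ℚ ≤ L
      0≤L = ≤-trans 0≤1 1≤L

      -- Earlier neighbours have the other colour, so their images lie in the range over which
      -- `moment` sums. The weight compensates for the bias of the process, and `density` reduces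
      -- the claim to uniform tuples.
      neighbourMoment : ∀ v r → hits (adj F v) r ℕ.≤ d →
        E r (λ h → pow (ι (X v h)) (a ℕ.+ a) * weight (adj F v) h) ≤ K
      neighbourMoment v r k≤d = begin
        E r (λ h → pow (ι (X v h)) (a ℕ.+ a) * weight (adj F v) h)
          ≤⟨ density (adj F v) (not (col v)) r
               (λ q → pow (ι (spread G (count (cand (col v) q)))) (a ℕ.+ a))
               (λ q → pow-nonneg (a ℕ.+ a) (ι-nonneg (spread G (count (cand (col v) q)))))
               (λ u vu → Bool.¬-not (≢-sym (proper v u vu))) ⟩
        pow (inv N) k * moment G (T (col v)) (T (not (col v))) (a ℕ.+ a) k
          ≤⟨ *-monoˡ (pow-nonneg k (inv-nonneg N)) (moments (col v) k k≤d) ⟩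
        pow (inv N) k * (K * pow (ι N) k)
          ≡⟨ solve 3 (λ i k n → i :* (k :* n) := i :* n :* k) refl (pow (inv N) k) K (pow (ι N) k) ⟩
        pow (inv N) k * pow (ι N) k * K
          ≡⟨ cong (_* K) (pow-distrib-* (inv N) (ι N) k) ⟨
        pow (inv N * ι N) k * K
          ≤⟨ *-monoʳ 0≤K (≤-trans (pow-mono k (*-nonneg (inv-nonneg N) (ι-nonneg N)) (inv*ι≤1 N)) (≤-reflexive (pow-1 k))) ⟩
        1ℚ * K
          ≡⟨ *-identityˡ K ⟩
        K
          ∎
        where k = hits (adj F v) r

      -- Mutual induction along the order: Y for the newest vertex is bounded by powers of earlier
      -- spreads, each of which has expectation at most L already. The set `S` in the second
      -- statement is arbitrary, to serve both for neighbourhoods and for all vertices.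
      vertexMoment : ∀ v r → hits (adj F v) r ℕ.≤ d → Ordered d r → E r (λ h → pow (ι (X v h)) a) ≤ L
      powerSumMoment : ∀ r → Ordered d r → ∀ S → E r (powerSum a S) ≤ ι (hits S r) * L

      vertexMoment v r k≤d ord = begin
        E r (λ h → pow (ι (X v h)) a)
          ≤⟨ E-mono r pointwise ⟩
        E r (λ h → l * (pow (ι (X v h)) (a ℕ.+ a) * weight S h) + l′ * product S h)
          ≡⟨ E-+ r (λ h → l * (pow (ι (X v h)) (a ℕ.+ a) * weight S h)) (λ h → l′ * product S h) ⟩
        E r (λ h → l * (pow (ι (X v h)) (a ℕ.+ a) * weight S h)) + E r (λ h → l′ * product S h)
          ≡⟨ cong₂ _+_ (E-*ˡ r (λ h → pow (ι (X v h)) (a ℕ.+ a) * weight S h) l) (E-*ˡ r (product S) l′) ⟩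
        l * E r (λ h → pow (ι (X v h)) (a ℕ.+ a) * weight S h) + l′ * E r (product S)
          ≤⟨ +-mono-≤ (*-monoˡ 0≤l (neighbourMoment v r k≤d)) (*-monoˡ 0≤l′ productMoment) ⟩
        l * K + l′ * (ι (suc d) * L)
          ≤⟨ recursion ⟩
        L
          ∎
        where
        S = adj F v
        pointwise : ∀ h → map proj₁ h ≡ r →
          pow (ι (X v h)) a ≤ l * (pow (ι (X v h)) (a ℕ.+ a) * weight S h) + l′ * product S h
        pointwise h _ = ≤-trans
          (young (pow-nonneg a (ι-nonneg (X v h))) (product-nonneg S h) (weight-nonneg S h) 0≤l 0≤l′ (weight*product S h) l′l≡1)
          (≤-reflexive (cong (λ z → l * (z * weight S h) + l′ * product S h) (sym (pow-+ (ι (X v h)) a a))))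
        productMoment : E r (product S) ≤ ι (suc d) * L
        productMoment = begin
          E r (product S)                  ≤⟨ E-mono r (λ h eq → product≤powerSum a S h
                                                (ℕ.≤-trans (ℕ.≤-reflexive (cong (hits S) eq)) (ℕ.≤-trans k≤d d≤a))) ⟩
          E r (λ h → 1ℚ + powerSum a S h)  ≡⟨ E-+ r (λ _ → 1ℚ) (powerSum a S) ⟩
          E r (λ _ → 1ℚ) + E r (powerSum a S)
            ≤⟨ +-mono-≤ (E-const r 1ℚ 0≤1) (powerSumMoment r ord S) ⟩
          1ℚ + ι (hits S r) * L            ≤⟨ +-mono-≤ 1≤L (*-monoʳ 0≤L (ι-mono k≤d)) ⟩
          L + ι d * L                      ≡⟨ solve 2 (λ L d → L :+ d :* L := (con 1ℚ :+ d) :* L) refl L (ι d) ⟩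
          (1ℚ + ι d) * L                   ≡⟨ cong (_* L) (ι-suc d) ⟨
          ι (suc d) * L                    ∎

      powerSumMoment [] ord S = ≤-reflexive (sym (trans (cong (_* L) ι-0) (*-zeroˡ L)))
      powerSumMoment (u ∷ r) (k≤d , ord) S = step (S u)
        where
        step : ∀ b → E r (λ h → mean (avail u h) (λ _ → (if b then pow (ι (X u h)) a else 0ℚ) + powerSum a S h))
          ≤ ι ((if b then 1 else 0) ℕ.+ hits S r) * L
        step false = begin
          E r (λ h → mean (avail u h) (λ _ → 0ℚ + powerSum a S h))
            ≤⟨ E-drop u r (λ h → 0ℚ + powerSum a S h) (λ h → +-nonneg ≤-refl (powerSum-nonneg a S h)) ⟩
          E r (λ h → 0ℚ + powerSum a S h)    ≡⟨ E-cong r (λ h → +-identityˡ (powerSum a S h)) ⟩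
          E r (powerSum a S)                 ≤⟨ powerSumMoment r ord S ⟩
          ι (hits S r) * L                   ∎
        step true = begin
          E r (λ h → mean (avail u h) (λ _ → pow (ι (X u h)) a + powerSum a S h))
            ≤⟨ E-drop u r (λ h → pow (ι (X u h)) a + powerSum a S h)
                 (λ h → +-nonneg (pow-nonneg a (ι-nonneg (X u h))) (powerSum-nonneg a S h)) ⟩
          E r (λ h → pow (ι (X u h)) a + powerSum a S h)
            ≡⟨ E-+ r (λ h → pow (ι (X u h)) a) (powerSum a S) ⟩
          E r (λ h → pow (ι (X u h)) a) + E r (powerSum a S)
            ≤⟨ +-mono-≤ (vertexMoment u r k≤d ord) (powerSumMoment r ord S) ⟩
          L + ι (hits S r) * L
            ≡⟨ solve 2 (λ L d → L :+ d :* L := (con 1ℚ :+ d) :* L) refl L (ι (hits S r)) ⟩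
          (1ℚ + ι (hits S r)) * L
            ≡⟨ cong (_* L) (ι-suc (hits S r)) ⟨
          ι (suc (hits S r)) * L
            ∎

    -- Counts with multiplicity, as images may collide.
    visits : (Fin N → Bool) → Hist → ℕ
    visits S [] = 0
    visits S ((u , w) ∷ h) = (if S w then 1 else 0) ℕ.+ visits S h

    total : Hist → ℕ
    total [] = 0
    total ((u , w) ∷ h) = X u h ℕ.+ total h

    -- Since w lies in S with probability at most X |S| / N, tilt is a supermartingale.
    tilt : ℚ → ℚ → (Fin N → Bool) → Hist → ℚ
    tilt b ρ S h = pow b (visits S h) * pow ρ (total h)

    module TiltBound (b ρ y : ℚ) (S : Fin N → Bool) (0≤b : 0ℚ ≤ b) (0≤ρ : 0ℚ ≤ ρ) (0≤y : 0ℚ ≤ y)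
      (ρ[1+y]≤1 : ρ * (1ℚ + y) ≤ 1ℚ) (b∣S∣≤y : b * (inv N * ι (count S)) ≤ y) where

      open ≤-Reasoning
      open +-*-Solver

      tilt-nonneg : ∀ h → 0ℚ ≤ tilt b ρ S h
      tilt-nonneg h = *-nonneg (pow-nonneg (visits S h) 0≤b) (pow-nonneg (total h) 0≤ρ)

      -- Bounds the growth of b^visits when the next image is `w`; writing b in place of b - 1
      -- avoids a subtraction.
      factor : Fin N → ℚ
      factor w = 1ℚ + 𝟙[ S w ] * b

      -- The next image hits `S` with probability at most X|S| / N, hence a mean of at most 1 + Xy.
      -- Bernoulli's inequality moves X into an exponent, where ρ^X can cancel it.
      mean-factor : ∀ v h → mean (avail v h) factor ≤ pow (1ℚ + y) (X v h)
      mean-factor v h = begin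
        mean (avail v h) factor
          ≡⟨ mean-+ (avail v h) (λ _ → 1ℚ) (λ w → 𝟙[ S w ] * b) ⟩
        mean (avail v h) (λ _ → 1ℚ) + mean (avail v h) (λ w → 𝟙[ S w ] * b)
          ≤⟨ +-mono-≤ (mean-const (avail v h) 1ℚ 0≤1) (mean-avail v h (λ w → 𝟙[ S w ] * b) 0≤Sb) ⟩
        1ℚ + x * inv N * sum (λ w → 𝟙[ Z (col v) w ] * (𝟙[ S w ] * b))
          ≤⟨ +-monoʳ-≤ 1ℚ (*-monoˡ (*-nonneg (ι-nonneg (X v h)) (inv-nonneg N)) (sum-mono λ w →
               ≤-trans (*-monoʳ (0≤Sb w) (𝟙≤1 (Z (col v) w))) (≤-reflexive (*-identityˡ (𝟙[ S w ] * b))))) ⟩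
        1ℚ + x * inv N * sum (λ w → 𝟙[ S w ] * b)
          ≡⟨ cong (λ z → 1ℚ + x * inv N * z) (sum-indicator-* S b) ⟩
        1ℚ + x * inv N * (ι (count S) * b)
          ≡⟨ cong (1ℚ +_) (solve 4 (λ x i s b → x :* i :* (s :* b) := x :* (b :* (i :* s))) refl x (inv N) (ι (count S)) b) ⟩
        1ℚ + x * (b * (inv N * ι (count S)))
          ≤⟨ +-monoʳ-≤ 1ℚ (*-monoˡ (ι-nonneg (X v h)) b∣S∣≤y) ⟩
        1ℚ + x * y
          ≤⟨ bernoulli y (X v h) 0≤y ⟩
        pow (1ℚ + y) (X v h)
          ∎
        where
        x = ι (X v h)
        0≤Sb : ∀ w → 0ℚ ≤ 𝟙[ S w ] * b
        0≤Sb w = *-nonneg (𝟙-nonneg (S w)) 0≤b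

      E-tilt : ∀ r → E r (tilt b ρ S) ≤ 1ℚ
      E-tilt [] = ≤-refl
      E-tilt (v ∷ r) = ≤-trans (E-mono r λ h _ → step h) (E-tilt r)
        where
        pow-visit : ∀ c k → pow b ((if c then 1 else 0) ℕ.+ k) ≤ (1ℚ + 𝟙[ c ] * b) * pow b k
        pow-visit false k = ≤-reflexive (sym (trans (cong (λ z → (1ℚ + z) * pow b k) (*-zeroˡ b))
          (trans (cong (_* pow b k) (+-identityʳ 1ℚ)) (*-identityˡ (pow b k)))))
        pow-visit true k = *-monoʳ (pow-nonneg k 0≤b)
          (≤-trans (≤-reflexive (sym (*-identityˡ b))) (≤-+ˡ 0≤1))
        step : ∀ h → mean (avail v h) (λ w → tilt b ρ S ((v , w) ∷ h)) ≤ tilt b ρ S h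
        step h = begin
          mean (avail v h) (λ w → tilt b ρ S ((v , w) ∷ h))
            ≤⟨ mean-mono (avail v h) (λ w → ≤-trans
                 (*-monoʳ (pow-nonneg (X v h ℕ.+ total h) 0≤ρ) (pow-visit (S w) (visits S h)))
                 (≤-reflexive (trans
                   (cong (factor w * pow b (visits S h) *_) (pow-+ ρ (X v h) (total h)))
                   (solve 4 (λ f p x y → f :* p :* (x :* y) := f :* (x :* (p :* y))) refl
                     (factor w) (pow b (visits S h)) (pow ρ (X v h)) (pow ρ (total h)))))) ⟩
          mean (avail v h) (λ w → factor w * (pow ρ (X v h) * tilt b ρ S h))
            ≡⟨ mean-*ʳ (avail v h) factor (pow ρ (X v h) * tilt b ρ S h) ⟩
          mean (avail v h) factor * (pow ρ (X v h) * tilt b ρ S h)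
            ≤⟨ *-monoʳ (*-nonneg (pow-nonneg (X v h) 0≤ρ) (tilt-nonneg h)) (mean-factor v h) ⟩
          pow (1ℚ + y) (X v h) * (pow ρ (X v h) * tilt b ρ S h)
            ≡⟨ solve 3 (λ p q t → p :* (q :* t) := q :* p :* t) refl (pow (1ℚ + y) (X v h)) (pow ρ (X v h)) (tilt b ρ S h) ⟩
          pow ρ (X v h) * pow (1ℚ + y) (X v h) * tilt b ρ S h
            ≡⟨ cong (_* tilt b ρ S h) (pow-distrib-* ρ (1ℚ + y) (X v h)) ⟨
          pow (ρ * (1ℚ + y)) (X v h) * tilt b ρ S h
            ≤⟨ *-monoʳ (tilt-nonneg h) (≤-trans
                 (pow-mono (X v h) (*-nonneg 0≤ρ (+-nonneg 0≤1 0≤y)) ρ[1+y]≤1) (≤-reflexive (pow-1 (X v h)))) ⟩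
          1ℚ * tilt b ρ S h
            ≡⟨ *-identityˡ (tilt b ρ S h) ⟩
          tilt b ρ S h
            ∎

    -- The histories in the support of the process, including those with collisions.
    data Run : List (Fin n) → Hist → Set where
      [] : Run [] []
      _∷_ : ∀ {v w r h} → avail v h w ≡ true → Run r h → Run (v ∷ r) ((v , w) ∷ h)

    module _ (proper : ∀ u v → adj F u v ≡ true → col u ≢ col v)
      (complete-T : complete G (T false) (T true) ≡ true) (T≢[] : ∀ c → 1 ℕ.≤ length (T c)) where

      complete-T′ : ∀ c → all (Z c) (T (not c)) ≡ true
      complete-T′ false = complete-T
      complete-T′ true = trans (all-nbr-comm G (T true) (T false)) complete-T

      allZ-back : ∀ {r h} → Run r h → ∀ v → all (Z (not (col v))) (back v h) ≡ true
      allZ-back [] v = refl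
      allZ-back {h = (u , w) ∷ h} (a ∷ run) v = step (adj F v u) λ vu →
        subst (λ c → Z c w ≡ true) (Bool.¬-not (≢-sym (proper v u vu)))
          (target⇒Z u h w (avail⇒target u h w a))
        where
        step : ∀ b → (b ≡ true → Z (not (col v)) w ≡ true) →
          all (Z (not (col v))) (if b then w ∷ back v h else back v h) ≡ true
        step false _ = allZ-back run v
        step true w∈Z = cong₂ _∧_ (w∈Z refl) (allZ-back run v)

      -- An entry of the tuple of the other colour is always a candidate: it is joined to all of
      -- `T c` because the pair is complete, and to the images of earlier neighbours because these
      -- are common neighbours of that tuple.
      target-nonempty : ∀ {r h} → Run r h → ∀ v → 1 ℕ.≤ count (target v h)
      target-nonempty {h = h} run v = go (T (not c)) refl (T≢[] (not c))
        where
        c = col v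
        go : ∀ p → T (not c) ≡ p → 1 ℕ.≤ length p → 1 ℕ.≤ count (target v h)
        go (w ∷ p) eq _ = count-pos (target v h) w (cong₂ _∧_
          (Bool.∧-conicalˡ _ _ (subst (λ p → all (Z c) p ≡ true) eq (complete-T′ c)))
          (common (back v h) (subst (λ p → all (nbr G p) (back v h) ≡ true) eq (allZ-back run v))))
          where
          common : ∀ q → all (nbr G (w ∷ p)) q ≡ true → nbr G q w ≡ true
          common [] _ = refl
          common (x ∷ q) all-q = cong₂ _∧_ (trans (adj-sym G x w) (Bool.∧-conicalˡ _ _ (Bool.∧-conicalˡ _ _ all-q))) (common q (Bool.∧-conicalʳ (nbr G (w ∷ p) x) _ all-q))

      -- The first moment method, one vertex at a time. An empty set has mean 0 and would offer no
      -- image, so available vertices must exist after every run.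
      E-<⇒∃ : ∀ r φ {c} → E r φ < c → ∃ λ h → Run r h × φ h < c
      E-<⇒∃ [] φ lt = [] , [] , lt
      E-<⇒∃ (v ∷ r) φ lt =
        let h , run , lt′ = E-<⇒∃ r (λ h → mean (avail v h) (λ w → φ ((v , w) ∷ h))) lt
            w , a , lt″ = mean-<⇒∃ (avail v h) (λ w → φ ((v , w) ∷ h)) (avail-nonempty h run) lt′
        in (v , w) ∷ h , a ∷ run , lt″
        where
        positive-half : ∀ m → 1 ℕ.≤ 2 ℕ.* m → 1 ℕ.≤ m
        positive-half (suc m) _ = s≤s z≤n
        avail-nonempty : ∀ h → Run r h → 1 ℕ.≤ count (avail v h)
        avail-nonempty h run = positive-half (count (avail v h)) (ℕ.≤-trans (target-nonempty run v) (target≤2avail v h))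

-- Degeneracy orders, and embeddings from runs with enough room.

module Embedding where

  open import Data.Bool using (Bool; true; false; _∧_; _∨_; not; if_then_else_)
  import Data.Bool.Properties as Bool
  open import Data.Fin as Fin using (Fin; zero; suc)
  import Data.Fin.Properties as Fin
  open import Data.List using (List; []; _∷_; length; map)
  open import Data.List.Membership.Propositional using (_∈_)
  open import Data.List.Relation.Unary.All as All using (All; []; _∷_)
  open import Data.List.Relation.Unary.AllPairs using (AllPairs; []; _∷_)
  open import Data.List.Relation.Unary.Any using (here; there)
  open import Data.Nat using (ℕ; zero; suc; z≤n; s≤s; _+_; _*_; _≤_)
  open import Data.Nat.Properties
  open import Data.Product using (∃; _×_; _,_; proj₁; proj₂)
  open import Data.Rational as ℚ using (ℚ)
  import Data.Rational.Properties as ℚ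
  open import Data.Sum using (_⊎_; inj₁; inj₂)
  open import Data.Unit using (⊤)
  open import Function using (_∘_)
  open import Function.Definitions using (Injective)
  open import Relation.Binary.PropositionalEquality
  open import Relation.Nullary using (does; yes; no; contradiction)
  open import Relation.Nullary.Decidable using (dec-true)
  open Rationals
  open FiniteSums
  open CommonNeighbourhoods
  open RandomHomomorphism
  open ProcessBounds

  count-none : ∀ {n} (p : Fin n → Bool) → (∀ i → p i ≡ false) → count p ≡ 0
  count-none {zero} p none = refl
  count-none {suc n} p none rewrite none zero = count-none (p ∘ suc) (none ∘ suc)

  count-≟ : ∀ {n} (j : Fin n) → count (λ i → does (i Fin.≟ j)) ≡ 1
  count-≟ {suc n} zero = cong suc (count-none {n} (λ i → does (suc i Fin.≟ zero)) (λ _ → refl))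
  count-≟ (suc j) = count-≟ j

  count-∨ : ∀ {n} (p q r : Fin n → Bool) → (∀ i → r i ≡ true → p i ∨ q i ≡ true) → count r ≤ count p + count q
  count-∨ {zero} p q r r⇒p∨q = z≤n
  count-∨ {suc n} p q r r⇒p∨q = begin
    #[ r zero ] + count (r ∘ suc)
      ≤⟨ +-mono-≤ (at-zero (p zero) (q zero) (r zero) (r⇒p∨q zero)) (count-∨ (p ∘ suc) (q ∘ suc) (r ∘ suc) (r⇒p∨q ∘ suc)) ⟩
    #[ p zero ] + #[ q zero ] + (count (p ∘ suc) + count (q ∘ suc))
      ≡⟨ +-assoc #[ p zero ] #[ q zero ] _ ⟩
    #[ p zero ] + (#[ q zero ] + (count (p ∘ suc) + count (q ∘ suc)))
      ≡⟨ cong (#[ p zero ] +_) (trans (sym (+-assoc #[ q zero ] _ _)) (trans (cong (_+ count (q ∘ suc)) (+-comm #[ q zero ] _)) (+-assoc (count (p ∘ suc)) _ _))) ⟩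
    #[ p zero ] + (count (p ∘ suc) + (#[ q zero ] + count (q ∘ suc)))
      ≡⟨ +-assoc #[ p zero ] _ _ ⟨
    #[ p zero ] + count (p ∘ suc) + (#[ q zero ] + count (q ∘ suc))
      ∎
    where
    open ≤-Reasoning
    #[_] : Bool → ℕ
    #[ b ] = if b then 1 else 0
    at-zero : ∀ b c e → (e ≡ true → b ∨ c ≡ true) → #[ e ] ≤ #[ b ] + #[ c ]
    at-zero b c false _ = z≤n
    at-zero true c true _ = s≤s z≤n
    at-zero false c true e⇒c rewrite e⇒c refl = s≤s z≤n

  ∈-pairs : ∀ {A : Set} {R : A → A → Set} {xs} → AllPairs R xs → ∀ {x y} → x ∈ xs → y ∈ xs → x ≡ y ⊎ R x y ⊎ R y x
  ∈-pairs (px ∷ pxs) (here refl) (here refl) = inj₁ refl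
  ∈-pairs (px ∷ pxs) (here refl) (there y∈xs) = inj₂ (inj₁ (All.lookup px y∈xs))
  ∈-pairs (px ∷ pxs) (there x∈xs) (here refl) = inj₂ (inj₂ (All.lookup px x∈xs))
  ∈-pairs (px ∷ pxs) (there x∈xs) (there y∈xs) = ∈-pairs pxs x∈xs y∈xs

  ∈-map-proj₁ : ∀ {A B : Set} {xs : List (A × B)} {a} → a ∈ map proj₁ xs → ∃ λ b → (a , b) ∈ xs
  ∈-map-proj₁ {xs = (a , b) ∷ xs} (here refl) = b , here refl
  ∈-map-proj₁ {xs = x ∷ xs} (there a∈xs) = let b , ab∈xs = ∈-map-proj₁ a∈xs in b , there ab∈xs

  module _ {n N : ℕ} (F : Graph n) (col : Fin n → Bool) (G : Graph N) (T : Bool → List (Fin N)) where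

    open Process F col G T

    remove : Fin n → (Fin n → Bool) → Fin n → Bool
    remove v S u = S u ∧ not (does (u Fin.≟ v))

    count-remove : ∀ v S → S v ≡ true → suc (count (remove v S)) ≤ count S
    count-remove v S v∈S = begin
      1 + count (remove v S)
        ≤⟨ +-monoˡ-≤ (count (remove v S)) (count-pos (λ u → S u ∧ does (u Fin.≟ v)) v
             (cong₂ _∧_ v∈S (dec-true (v Fin.≟ v) refl))) ⟩
      count (λ u → S u ∧ does (u Fin.≟ v)) + count (remove v S)
        ≡⟨ count-split S (λ u → does (u Fin.≟ v)) ⟨
      count S
        ∎
      where open ≤-Reasoning

    remove-∧ : ∀ v (S P : Fin n → Bool) u → remove v S u ∧ P u ≡ remove v (λ x → S x ∧ P x) u
    remove-∧ v S P u with S u | P u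
    ... | false | _ = refl
    ... | true | true = Bool.∧-identityʳ (not (does (u Fin.≟ v)))
    ... | true | false = Bool.∧-zeroʳ (not (does (u Fin.≟ v)))

    -- The head of the list is the vertex removed first, hence embedded last.
    degeneracyOrder : ∀ {d} → Degenerate d F → ∀ k (S : Fin n → Bool) → count S ≤ k →
      ∃ λ r → Ordered F col G T d r × (∀ v → S v ≡ true → v ∈ r) × (∀ P → hits P r ≤ count (λ u → S u ∧ P u))
    degeneracyOrder {d} degenerate k S ∣S∣≤k with Fin.any? (λ v → S v Bool.≟ true)
    degeneracyOrder degenerate k S ∣S∣≤k | no S-empty = [] , _ , (λ v v∈S → contradiction (v , v∈S) S-empty) , λ P → z≤n
    degeneracyOrder degenerate zero S ∣S∣≤0 | yes (v , v∈S) with () ← ≤-trans (count-pos S v v∈S) ∣S∣≤0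
    degeneracyOrder {d} degenerate (suc k) S ∣S∣≤k | yes nonempty =
      let v , v∈S , deg≤d = degenerate S nonempty
          r , ordered , covers , hits≤ = degeneracyOrder degenerate k (remove v S)
            (s≤s⁻¹ (≤-trans (count-remove v S v∈S) ∣S∣≤k))
      in v ∷ r
       , (≤-trans (hits≤ (adj F v)) (≤-trans (drop-remove v (adj F v)) deg≤d) , ordered)
       , (λ u u∈S → cover v u r u∈S (covers u))
       -- This clause also says that the order has no repetitions. With `P` the neighbourhood of a
       -- vertex it bounds the back-degree, with `P` everywhere true the length of the order.
       , λ P → step v P v∈S (P v) refl (hits P r) (hits≤ P)
      where
      s≤s⁻¹ : ∀ {i j} → suc i ≤ suc j → i ≤ j
      s≤s⁻¹ (s≤s i≤j) = i≤j
      drop-remove : ∀ v P → count (λ u → remove v S u ∧ P u) ≤ count (λ u → S u ∧ P u)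
      drop-remove v P = count-mono λ u eq → Bool.∧-conicalˡ _ _ (trans (sym (remove-∧ v S P u)) eq)
      cover : ∀ v u r → S u ≡ true → (remove v S u ≡ true → u ∈ r) → u ∈ v ∷ r
      cover v u r u∈S rest with u Fin.≟ v
      ... | yes u≡v = here u≡v
      ... | no _ = there (rest (trans (Bool.∧-identityʳ (S u)) u∈S))
      step : ∀ v P → S v ≡ true → ∀ b → P v ≡ b → ∀ m → m ≤ count (λ u → remove v S u ∧ P u) →
        (if b then 1 else 0) + m ≤ count (λ u → S u ∧ P u)
      step v P v∈S false _ m m≤ = ≤-trans m≤ (drop-remove v P)
      step v P v∈S true v∈P m m≤ = ≤-trans (s≤s (≤-trans m≤ (≤-reflexive (count-cong (remove-∧ v S P)))))
        (count-remove v (λ u → S u ∧ P u) (cong₂ _∧_ v∈S v∈P))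

    used≤visits : ∀ S h → count (λ w → S w ∧ used h w) ≤ visits F col G T S h
    used≤visits S [] = ≤-reflexive (count-none (λ w → S w ∧ false) (λ w → Bool.∧-zeroʳ (S w)))
    used≤visits S ((u , x) ∷ h) = ≤-trans
      (count-∨ (λ w → S w ∧ does (w Fin.≟ x)) (λ w → S w ∧ used h w) _ λ w → split (S w))
      (+-mono-≤ (single (S x) refl) (used≤visits S h))
      where
      split : ∀ a {b c} → a ∧ (b ∨ c) ≡ true → (a ∧ b) ∨ (a ∧ c) ≡ true
      split true eq = eq
      single : ∀ b → S x ≡ b → count (λ w → S w ∧ does (w Fin.≟ x)) ≤ (if b then 1 else 0)
      single true _ = ≤-trans (count-mono λ w → Bool.∧-conicalʳ (S w) _) (≤-reflexive (count-≟ x))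
      single false x∉S = ≤-reflexive (count-none (λ w → S w ∧ does (w Fin.≟ x)) none)
        where
        none : ∀ w → S w ∧ does (w Fin.≟ x) ≡ false
        none w with w Fin.≟ x
        ... | yes refl = trans (Bool.∧-identityʳ (S w)) x∉S
        ... | no _ = Bool.∧-zeroʳ (S w)

    -- Stated for visits in place of used vertices, since visits are what the tilt controls.
    Spacious : Hist → Set
    Spacious [] = ⊤
    Spacious ((v , w) ∷ h) = 2 * visits F col G T (target v h) h ≤ count (target v h) × Spacious h

    Compatible : Fin n × Fin N → Fin n × Fin N → Set
    Compatible (v , w) (u , x) = w ≢ x × (adj F v u ≡ true → adj G w x ≡ true)

    -- Used candidates number at most the visits, hence at most half of the candidates. The other
    -- half is free, so the test in `avail` succeeds and collisions are excluded.
    avail⇒free : ∀ v h w → 2 * visits F col G T (target v h) h ≤ count (target v h) →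
      avail v h w ≡ true → free v h w ≡ true
    avail⇒free v h w spacious a = trans (cong (λ f → f w) (sym branch)) a
      where
      open ≤-Reasoning
      t = count (target v h)
      f = count (free v h)
      b = visits F col G T (target v h) h
      t≤b+f : t ≤ b + f
      t≤b+f = ≤-trans (≤-reflexive (count-split (target v h) (used h))) (+-monoˡ-≤ f (used≤visits (target v h) h))
      t≤2f : t ≤ 2 * f
      t≤2f = +-cancelˡ-≤ t t (2 * f) (begin
        t + t            ≡⟨ cong (t +_) (+-identityʳ t) ⟨
        2 * t            ≤⟨ *-monoʳ-≤ 2 t≤b+f ⟩
        2 * (b + f)      ≡⟨ *-distribˡ-+ 2 b f ⟩
        2 * b + 2 * f    ≤⟨ +-monoˡ-≤ (2 * f) spacious ⟩
        t + 2 * f        ∎)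
      T⇒≡true : ∀ {x} → Data.Bool.T x → x ≡ true
      T⇒≡true {true} _ = refl
      branch : avail v h ≡ free v h
      branch = cong (λ x → if x then free v h else target v h) (T⇒≡true (≤⇒≤ᵇ t≤2f))

    -- Being a candidate gives adjacency to the images of earlier neighbours; being free gives
    -- distinctness from all earlier images.
    Run⇒AllPairs : ∀ {r h} → Run F col G T r h → Spacious h → AllPairs Compatible h
    Run⇒AllPairs [] _ = []
    Run⇒AllPairs {h = (v , w) ∷ h} (a ∷ run) (room , spacious) =
      tabulate-compatible h (Bool.∧-conicalʳ (Z (col v) w) _ (Bool.∧-conicalˡ _ _ w-free)) (Bool.not-injective {y = false} (Bool.∧-conicalʳ (target v h w) _ w-free))
      ∷ Run⇒AllPairs run spacious
      where
      w-free : free v h w ≡ true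
      w-free = avail⇒free v h w room a
      tabulate-compatible : ∀ h → nbr G (images (adj F v) h) w ≡ true → used h w ≡ false → All (Compatible (v , w)) h
      tabulate-compatible [] _ _ = []
      tabulate-compatible ((u , x) ∷ h) common unused =
        (distinct , λ vu → trans (adj-sym G w x) (adjacent (adj F v u) vu common))
        ∷ tabulate-compatible h (rest (adj F v u) common) (Bool.∨-conicalʳ (does (w Fin.≟ x)) _ unused)
        where
        distinct : w ≢ x
        distinct w≡x with () ← trans (sym (dec-true (w Fin.≟ x) w≡x)) (Bool.∨-conicalˡ (does (w Fin.≟ x)) _ unused)
        adjacent : ∀ b → b ≡ true → nbr G (if b then x ∷ images (adj F v) h else images (adj F v) h) w ≡ true → adj G x w ≡ true
        adjacent true _ eq = Bool.∧-conicalˡ _ _ eq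
        rest : ∀ b → nbr G (if b then x ∷ images (adj F v) h else images (adj F v) h) w ≡ true → nbr G (images (adj F v) h) w ≡ true
        rest false eq = eq
        rest true eq = Bool.∧-conicalʳ (adj G x w) _ eq

    embedding : ∀ h → AllPairs Compatible h → (∀ v → v ∈ map proj₁ h) → SubgraphOf F G
    embedding h pairs covers = f , injective , homomorphism
      where
      f : Fin n → Fin N
      f v = proj₁ (∈-map-proj₁ (covers v))
      f∈ : ∀ v → (v , f v) ∈ h
      f∈ v = proj₂ (∈-map-proj₁ (covers v))
      injective : Injective _≡_ _≡_ f
      injective {u} {v} fu≡fv with ∈-pairs pairs (f∈ u) (f∈ v)
      ... | inj₁ eq = cong proj₁ eq
      ... | inj₂ (inj₁ (fu≢fv , _)) = contradiction fu≡fv fu≢fv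
      ... | inj₂ (inj₂ (fv≢fu , _)) = contradiction (sym fu≡fv) fv≢fu
      homomorphism : ∀ u v → adj F u v ≡ true → adj G (f u) (f v) ≡ true
      homomorphism u v uv with ∈-pairs pairs (f∈ u) (f∈ v)
      ... | inj₁ eq with refl ← cong proj₁ eq with () ← trans (sym uv) (loopless F u)
      ... | inj₂ (inj₁ (_ , hom)) = hom uv
      ... | inj₂ (inj₂ (_ , hom)) = trans (adj-sym G (f u) (f v)) (hom (trans (adj-sym F v u) uv))

    length-images : ∀ S h → length (images S h) ≡ hits S (map proj₁ h)
    length-images S [] = refl
    length-images S ((u , w) ∷ h) = step (S u)
      where
      step : ∀ b → length (if b then w ∷ images S h else images S h) ≡ (if b then 1 else 0) + hits S (map proj₁ h)
      step false = length-images S h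
      step true = cong suc (length-images S h)

    Run⇒map : ∀ {r h} → Run F col G T r h → map proj₁ h ≡ r
    Run⇒map [] = refl
    Run⇒map {h = (v , w) ∷ h} (a ∷ run) = cong (v ∷_) (Run⇒map run)

    powerSum-all : ℕ → Hist → ℚ
    powerSum-all a = powerSum F col G T a (λ _ → true)

    module _ (nonempty : ∀ {r h} → Run F col G T r h → ∀ v → 1 ≤ count (target v h)) (a d : ℕ) (C : ℚ) where

      -- Visits only accumulate, so each set needs to be checked only at the end of the run. As the
      -- target of a vertex is random, all sets `cand c q` are checked; those with too large a
      -- spread are exempt, because the power sum bound keeps them from occurring as targets.
      spacious : ∀ {r h} → Ordered F col G T d r → Run F col G T r h → powerSum-all a h ℚ.≤ C →
        (∀ c q → length q ≤ d → 1 ≤ count (cand c q) → pow (ι (spread G (count (cand c q)))) a ℚ.≤ C →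
          2 * visits F col G T (cand c q) h ≤ count (cand c q)) →
        Spacious h
      spacious ord [] _ _ = _
      spacious {v ∷ r} {(v , w) ∷ h} (k≤d , ord) (a₀ ∷ run) powers≤C room =
        ≤-trans (*-monoʳ-≤ 2 (m≤n+m _ (if target v h w then 1 else 0)))
          (room (col v) (back v h)
            (≤-trans (≤-reflexive (trans (length-images (adj F v) h) (cong (hits (adj F v)) (Run⇒map run)))) k≤d)
            (nonempty run v)
            (ℚ.≤-trans (≤-+ʳ (powerSum-nonneg F col G T a (λ _ → true) h)) powers≤C))
        , spacious ord run (ℚ.≤-trans (≤-+ˡ (pow-nonneg a (ι-nonneg (X v h)))) powers≤C)
            λ c q q≤d 1≤ small → ≤-trans (*-monoʳ-≤ 2 (m≤n+m _ (if cand c q w then 1 else 0))) (room c q q≤d 1≤ small)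

-- Choice of the constants and comparison of exponents.

module Constants where

  open import Data.Nat as ℕ using (ℕ; zero; suc; z≤n; s≤s)
  import Data.Nat.Properties as ℕ
  import Data.Nat.Solver as ℕ
  open import Data.Product using (∃; _×_; _,_)
  open import Data.Rational
  open import Data.Rational.Properties
  open import Data.Rational.Solver using (module +-*-Solver)
  open import Relation.Binary.PropositionalEquality
  open import Relation.Nullary using (yes; no)
  open Rationals

  binaryLog : ∀ s → 1 ℕ.≤ s → ∃ λ j → 2 ℕ.^ j ℕ.≤ s × s ℕ.< 2 ℕ.^ suc j
  binaryLog (suc zero) _ = 0 , s≤s z≤n , s≤s (s≤s z≤n)
  binaryLog (suc (suc s)) _ with binaryLog (suc s) (s≤s z≤n)
  ... | j , lower , upper with suc (suc s) ℕ.<? 2 ℕ.^ suc j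
  ...   | yes s<2^j = j , ℕ.m≤n⇒m≤1+n lower , s<2^j
  ...   | no s≮2^j = suc j , ℕ.≮⇒≥ s≮2^j , ℕ.≤-<-trans upper
    (ℕ.m<m+n (2 ℕ.^ suc j) (ℕ.≤-trans (ℕ.m^n>0 2 (suc j)) (ℕ.m≤m+n (2 ℕ.^ suc j) 0)))

  suc≤2^ : ∀ n → suc n ℕ.≤ 2 ℕ.^ n
  suc≤2^ zero = s≤s z≤n
  suc≤2^ (suc n) = ℕ.≤-trans (ℕ.+-mono-≤ (ℕ.m^n>0 2 n) (suc≤2^ n))
    (ℕ.+-monoʳ-≤ (2 ℕ.^ n) (ℕ.m≤m+n (2 ℕ.^ n) 0))

  square≤2^ : ∀ j → (4 ℕ.+ j) ℕ.* (4 ℕ.+ j) ℕ.≤ 2 ℕ.^ (4 ℕ.+ j)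
  square≤2^ zero = ℕ.≤-refl
  square≤2^ (suc j) = begin
    (5 ℕ.+ j) ℕ.* (5 ℕ.+ j)                       ≤⟨ ℕ.m≤m+n _ (7 ℕ.+ 6 ℕ.* j ℕ.+ j ℕ.* j) ⟩
    (5 ℕ.+ j) ℕ.* (5 ℕ.+ j) ℕ.+ (7 ℕ.+ 6 ℕ.* j ℕ.+ j ℕ.* j)
      ≡⟨ solve 1 (λ j → (con 5 :+ j) :* (con 5 :+ j) :+ (con 7 :+ con 6 :* j :+ j :* j)
                     := con 2 :* ((con 4 :+ j) :* (con 4 :+ j))) refl j ⟩
    2 ℕ.* ((4 ℕ.+ j) ℕ.* (4 ℕ.+ j))               ≤⟨ ℕ.*-monoʳ-≤ 2 (square≤2^ j) ⟩
    2 ℕ.^ (5 ℕ.+ j)                               ∎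
    where
    open ℕ.≤-Reasoning
    open ℕ.+-*-Solver

  2^-cancel-≤ : ∀ {i j} → 2 ℕ.^ i ℕ.≤ 2 ℕ.^ j → i ℕ.≤ j
  2^-cancel-≤ {i} {j} le = ℕ.≮⇒≥ λ j<i → ℕ.<⇒≱ (ℕ.^-monoʳ-< 2 (s≤s (s≤s z≤n)) j<i) le

  -- Let 2^j ≤ s < 2^(j + 1). Then N ≤ 2^(4(j + 1)), so the lower bound on N forces 20d ≤ j, and the
  -- binary logarithm of the left side is at most 3 + d + 4(j + 1)d ≤ j² ≤ 2^j ≤ s.
  union-bound : ∀ d′ N s → let d = suc d′ in 1 ℕ.≤ s → 2 ℕ.^ (400 ℕ.* (d ℕ.* d)) ℕ.≤ N → N ℕ.≤ s ℕ.^ 4 →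
    8 ℕ.* suc d ℕ.* N ℕ.^ d ℕ.≤ 2 ℕ.^ s
  union-bound d′ N s 1≤s large N≤s⁴ with binaryLog s 1≤s
  ... | j , lower , upper = begin
    8 ℕ.* suc d ℕ.* N ℕ.^ d
      ≤⟨ ℕ.*-mono-≤ (ℕ.*-monoʳ-≤ 8 (suc≤2^ d)) (ℕ.^-monoˡ-≤ d N≤2^) ⟩
    8 ℕ.* 2 ℕ.^ d ℕ.* (2 ℕ.^ (suc j ℕ.* 4)) ℕ.^ d
      ≡⟨ cong₂ ℕ._*_ (sym (ℕ.^-distribˡ-+-* 2 3 d)) (ℕ.^-*-assoc 2 (suc j ℕ.* 4) d) ⟩
    2 ℕ.^ (3 ℕ.+ d) ℕ.* 2 ℕ.^ (suc j ℕ.* 4 ℕ.* d)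
      ≡⟨ ℕ.^-distribˡ-+-* 2 (3 ℕ.+ d) (suc j ℕ.* 4 ℕ.* d) ⟨
    2 ℕ.^ (3 ℕ.+ d ℕ.+ suc j ℕ.* 4 ℕ.* d)
      ≤⟨ ℕ.^-monoʳ-≤ 2 (ℕ.≤-trans exponent (ℕ.≤-trans (subst (λ j → j ℕ.* j ℕ.≤ 2 ℕ.^ j) (ℕ.m+[n∸m]≡n 4≤j) (square≤2^ (j ℕ.∸ 4))) lower)) ⟩
    2 ℕ.^ s
      ∎
    where
    open ℕ.≤-Reasoning
    open ℕ.+-*-Solver
    d = suc d′
    N≤2^ : N ℕ.≤ 2 ℕ.^ (suc j ℕ.* 4)
    N≤2^ = ℕ.≤-trans N≤s⁴ (ℕ.≤-trans (ℕ.^-monoˡ-≤ 4 (ℕ.<⇒≤ upper)) (ℕ.≤-reflexive (ℕ.^-*-assoc 2 (suc j) 4)))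
    100d²≤1+j : 100 ℕ.* (d ℕ.* d) ℕ.≤ suc j
    100d²≤1+j = ℕ.*-cancelʳ-≤ _ _ 4 (ℕ.≤-trans
      (ℕ.≤-reflexive (solve 1 (λ x → con 100 :* x :* con 4 := con 400 :* x) refl (d ℕ.* d)))
      (2^-cancel-≤ (ℕ.≤-trans large N≤2^)))
    20d≤j : 20 ℕ.* d ℕ.≤ j
    20d≤j = ℕ.s≤s⁻¹ (begin
      suc (20 ℕ.* d)          ≤⟨ ℕ.m≤m+n _ (79 ℕ.+ 180 ℕ.* d′ ℕ.+ 100 ℕ.* (d′ ℕ.* d′)) ⟩
      suc (20 ℕ.* d) ℕ.+ (79 ℕ.+ 180 ℕ.* d′ ℕ.+ 100 ℕ.* (d′ ℕ.* d′))
        ≡⟨ solve 1 (λ x → con 1 :+ con 20 :* (con 1 :+ x) :+ (con 79 :+ con 180 :* x :+ con 100 :* (x :* x))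
                       := con 100 :* ((con 1 :+ x) :* (con 1 :+ x))) refl d′ ⟩
      100 ℕ.* (d ℕ.* d)       ≤⟨ 100d²≤1+j ⟩
      suc j                   ∎)
    4≤j : 4 ℕ.≤ j
    4≤j = ℕ.≤-trans (ℕ.≤-trans (ℕ.m≤m+n 4 16) (ℕ.*-monoʳ-≤ 20 {1} {d} (s≤s z≤n))) 20d≤j
    exponent : 3 ℕ.+ d ℕ.+ suc j ℕ.* 4 ℕ.* d ℕ.≤ j ℕ.* j
    exponent = begin
      3 ℕ.+ d ℕ.+ suc j ℕ.* 4 ℕ.* d
        ≡⟨ solve 2 (λ j x → con 3 :+ (con 1 :+ x) :+ (con 1 :+ j) :* con 4 :* (con 1 :+ x)
                         := con 8 :+ con 5 :* x :+ j :* (con 4 :* (con 1 :+ x))) refl j d′ ⟩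
      8 ℕ.+ 5 ℕ.* d′ ℕ.+ j ℕ.* (4 ℕ.* d)
        ≤⟨ ℕ.+-monoˡ-≤ (j ℕ.* (4 ℕ.* d)) (ℕ.m≤m+n (8 ℕ.+ 5 ℕ.* d′) (3 ℕ.* d′)) ⟩
      8 ℕ.+ 5 ℕ.* d′ ℕ.+ 3 ℕ.* d′ ℕ.+ j ℕ.* (4 ℕ.* d)
        ≡⟨ solve 2 (λ j x → con 8 :+ con 5 :* x :+ con 3 :* x :+ j :* (con 4 :* (con 1 :+ x))
                         := con 1 :* (con 8 :* (con 1 :+ x)) :+ j :* (con 4 :* (con 1 :+ x))) refl j d′ ⟩
      1 ℕ.* (8 ℕ.* d) ℕ.+ j ℕ.* (4 ℕ.* d)
        ≤⟨ ℕ.+-monoˡ-≤ (j ℕ.* (4 ℕ.* d)) (ℕ.*-monoˡ-≤ (8 ℕ.* d) {1} {j} (ℕ.≤-trans (s≤s z≤n) 4≤j)) ⟩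
      j ℕ.* (8 ℕ.* d) ℕ.+ j ℕ.* (4 ℕ.* d)
        ≡⟨ solve 2 (λ j x → j :* (con 8 :* x) :+ j :* (con 4 :* x) := j :* (con 12 :* x)) refl j d ⟩
      j ℕ.* (12 ℕ.* d)
        ≤⟨ ℕ.*-monoʳ-≤ j (ℕ.≤-trans (ℕ.*-monoˡ-≤ d (ℕ.m≤m+n 12 8)) 20d≤j) ⟩
      j ℕ.* j
        ∎

  -- Exponents of a bound for 2L and of M^a. For d = 1 they are 67 and 68, so 34 is the least
  -- coefficient that works.
  M-exponent : ∀ d′ → let d = suc d′ in
    suc (d ℕ.+ 2 ℕ.+ 63 ℕ.* (d ℕ.* d)) ℕ.≤ (d ℕ.+ d) ℕ.* (34 ℕ.* d)
  M-exponent d′ = ℕ.≤-trans (ℕ.m≤m+n _ (1 ℕ.+ 9 ℕ.* d′ ℕ.+ 5 ℕ.* (d′ ℕ.* d′))) (ℕ.≤-reflexive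
    (solve 1 (λ x → let d = con 1 :+ x in
      con 1 :+ (d :+ con 2 :+ con 63 :* (d :* d)) :+ (con 1 :+ con 9 :* x :+ con 5 :* (x :* x))
        := (d :+ d) :* (con 34 :* d)) refl d′))
    where open ℕ.+-*-Solver

  L²-exponent : ∀ d′ → let d = suc d′; e = d ℕ.+ 2 ℕ.+ 63 ℕ.* (d ℕ.* d) in
    e ℕ.+ e ℕ.≤ 400 ℕ.* (d ℕ.* d)
  L²-exponent d′ = ℕ.≤-trans (ℕ.m≤m+n _ (268 ℕ.+ 546 ℕ.* d′ ℕ.+ 274 ℕ.* (d′ ℕ.* d′))) (ℕ.≤-reflexive
    (solve 1 (λ x → let d = con 1 :+ x ; e = d :+ con 2 :+ con 63 :* (d :* d) in
      e :+ e :+ (con 268 :+ con 546 :* x :+ con 274 :* (x :* x))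
        := con 400 :* (d :* d)) refl d′))
    where open ℕ.+-*-Solver

  -- In terms of d = d′ + 1 this is 15d² - 4d, what remains of the exponent 63d² of K after paying
  -- t(3t + 1) = 48d² + 4d for γ^t.
  slack : ℕ → ℕ
  slack d′ = 11 ℕ.+ 26 ℕ.* d′ ℕ.+ 15 ℕ.* (d′ ℕ.* d′)

  -- The left side exceeds the binary logarithm of 2(d + 1)3^t, with 3 replaced by 4. Equality holds
  -- for d = 1, which determines the constant 63.
  slack-exponent : ∀ d′ → let d = suc d′; a = d ℕ.+ d; t = a ℕ.+ a in
    d ℕ.+ 1 ℕ.+ (2 ℕ.* t ℕ.+ 1) ℕ.≤ slack d′
  slack-exponent d′ = ℕ.≤-trans (ℕ.m≤m+n _ (17 ℕ.* d′ ℕ.+ 15 ℕ.* (d′ ℕ.* d′))) (ℕ.≤-reflexive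
    (solve 1 (λ x → let d = con 1 :+ x ; a = d :+ d ; t = a :+ a in
      d :+ con 1 :+ (con 2 :* t :+ con 1) :+ (con 17 :* x :+ con 15 :* (x :* x))
        := con 11 :+ con 26 :* x :+ con 15 :* (x :* x)) refl d′))
    where open ℕ.+-*-Solver

  K-exponent : ∀ d′ → let d = suc d′; a = d ℕ.+ d; t = a ℕ.+ a in
    63 ℕ.* (d ℕ.* d) ≡ slack d′ ℕ.+ t ℕ.* suc (t ℕ.* 3)
  K-exponent d′ = solve 1 (λ x → let d = con 1 :+ x ; a = d :+ d ; t = a :+ a in
    con 63 :* (d :* d) := con 11 :+ con 26 :* x :+ con 15 :* (x :* x) :+ t :* (con 1 :+ t :* con 3)) refl d′
    where open ℕ.+-*-Solver

  module Powers (α : ℚ) (0<α : 0ℚ < α) (α≤½ : α ≤ ½) where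

    open +-*-Solver

    P : ℚ
    P = recip α 0<α

    0≤α : 0ℚ ≤ α
    0≤α = <⇒≤ 0<α

    2α≤1 : α + α ≤ 1ℚ
    2α≤1 = +-mono-≤ α≤½ α≤½

    2≤P : 1ℚ + 1ℚ ≤ P
    2≤P = begin
      1ℚ + 1ℚ           ≡⟨ cong₂ _+_ (recip-inverse α 0<α) (recip-inverse α 0<α) ⟨
      P * α + P * α     ≡⟨ *-distribˡ-+ P α α ⟨
      P * (α + α)       ≤⟨ *-monoˡ (<⇒≤ (recip-pos α 0<α)) 2α≤1 ⟩
      P * 1ℚ            ≡⟨ *-identityʳ P ⟩
      P                 ∎
      where open ≤-Reasoning

    1≤P : 1ℚ ≤ P
    1≤P = ≤-trans (≤-+ʳ 0≤1) 2≤P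

    0≤P : 0ℚ ≤ P
    0≤P = ≤-trans 0≤1 1≤P

    pow-P-α : ∀ k → pow P k * pow α k ≡ 1ℚ
    pow-P-α k = trans (sym (pow-distrib-* P α k)) (trans (cong (λ x → pow x k) (recip-inverse α 0<α)) (pow-1 k))

    -- As P = 1/α is at least 2, integer constants can be absorbed into powers of P.
    ι-2^≤pow : ∀ k → ι (2 ℕ.^ k) ≤ pow P k
    ι-2^≤pow k = ≤-trans (≤-reflexive (ι-^ 2 k)) (pow-mono k (ι-nonneg 2)
      (≤-trans (≤-reflexive ι-2) 2≤P))

    clear-α : ∀ k {x y} → x ≤ pow α k * y → pow P k * x ≤ y
    clear-α k {x} {y} x≤α^k*y = begin
      pow P k * x               ≤⟨ *-monoˡ (pow-nonneg k 0≤P) x≤α^k*y ⟩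
      pow P k * (pow α k * y)   ≡⟨ *-assoc (pow P k) (pow α k) y ⟨
      pow P k * pow α k * y     ≡⟨ trans (cong (_* y) (pow-P-α k)) (*-identityˡ y) ⟩
      y                         ∎
      where open ≤-Reasoning

    pow-P-split : ∀ i j → pow P i * pow P j ≡ pow P (i ℕ.+ j)
    pow-P-split i j = sym (pow-+ P i j)

    module AtDegree (d′ : ℕ) where

      -- K bounds the moments of order t = 2a over uniform tuples, L the moments of order a along the
      -- random embedding, and M is a typical spread.
      d a t lℕ : ℕ
      d = suc d′
      a = d ℕ.+ d
      t = a ℕ.+ a
      lℕ = 2 ℕ.* suc d

      β γ K L M : ℚ
      -- At most α/4: one factor 2 is for N² ≤ 2N(N - 1), the other for the loss in `sumAll-pow`.
      -- The second use of `sumAll-pow` costs the additional factor α in `γ`.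
      β = pow α 3
      γ = pow α (suc (t ℕ.* 3))
      K = pow P (63 ℕ.* (d ℕ.* d))
      L = ι lℕ * K + ι lℕ * K
      M = pow P (34 ℕ.* d)

      4β≤α : (β + β) + (β + β) ≤ α
      4β≤α = begin
        (β + β) + (β + β)        ≡⟨ solve 1 (λ x → let b = x :* (x :* (x :* con 1ℚ)) in (b :+ b) :+ (b :+ b) := x :* ((x :+ x) :* (x :+ x))) refl α ⟩
        α * ((α + α) * (α + α))  ≤⟨ *-monoˡ 0≤α (*-mono-≤₀ (+-nonneg 0≤α 0≤α) (+-nonneg 0≤α 0≤α) 2α≤1 2α≤1) ⟩
        α * (1ℚ * 1ℚ)            ≡⟨ *-identityʳ α ⟩
        α                        ∎
        where open ≤-Reasoning

      2γ≤β^t : γ + γ ≤ pow β t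
      2γ≤β^t = begin
        α * x + α * x      ≡⟨ *-distribʳ-+ x α α ⟨
        (α + α) * x        ≤⟨ *-monoʳ (pow-nonneg (t ℕ.* 3) 0≤α) 2α≤1 ⟩
        1ℚ * x             ≡⟨ *-identityˡ x ⟩
        x                  ≡⟨ pow-* α t 3 ⟩
        pow β t            ∎
        where
        open ≤-Reasoning
        x = pow α (t ℕ.* 3)

      0≤K : 0ℚ ≤ K
      0≤K = pow-nonneg (63 ℕ.* (d ℕ.* d)) 0≤P

      1≤K : 1ℚ ≤ K
      1≤K = 1≤pow (63 ℕ.* (d ℕ.* d)) 1≤P

      1≤L : 1ℚ ≤ L
      1≤L = ≤-trans (*-mono-≤₀ 0≤1 0≤1 (1≤ι {lℕ} (s≤s z≤n)) 1≤K) (≤-+ʳ (*-nonneg (ι-nonneg lℕ) 0≤K))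

      recursion : ι lℕ * K + inv lℕ * (ι (suc d) * L) ≤ L
      recursion = ≤-reflexive (cong (ι lℕ * K +_) (begin
        inv lℕ * (ι (suc d) * L)
          ≡⟨ solve 3 (λ i e k → i :* (e :* (k :+ k)) := i :* ((con 1ℚ :+ con 1ℚ) :* e) :* k) refl (inv lℕ) (ι (suc d)) (ι lℕ * K) ⟩
        inv lℕ * ((1ℚ + 1ℚ) * ι (suc d)) * (ι lℕ * K)
          ≡⟨ cong (λ z → inv lℕ * z * (ι lℕ * K)) (trans (cong (_* ι (suc d)) (sym ι-2)) (sym (ι-* 2 (suc d)))) ⟩
        inv lℕ * ι lℕ * (ι lℕ * K)
          ≡⟨ trans (cong (_* (ι lℕ * K)) (inv-inverse {lℕ} (s≤s z≤n))) (*-identityˡ _) ⟩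
        ι lℕ * K
          ∎))
        where open ≡-Reasoning

      L≤ : L ≤ pow P (d ℕ.+ 2 ℕ.+ 63 ℕ.* (d ℕ.* d))
      L≤ = begin
        ι lℕ * K + ι lℕ * K                 ≡⟨ solve 2 (λ l k → l :* k :+ l :* k := (con 1ℚ :+ con 1ℚ) :* l :* k) refl (ι lℕ) K ⟩
        (1ℚ + 1ℚ) * ι lℕ * K                ≡⟨ cong (_* K) (trans (cong (_* ι lℕ) (sym ι-2)) (sym (ι-* 2 lℕ))) ⟩
        ι (2 ℕ.* lℕ) * K                    ≤⟨ *-monoʳ 0≤K (≤-trans (ι-mono small) (ι-2^≤pow (d ℕ.+ 2))) ⟩
        pow P (d ℕ.+ 2) * K                 ≡⟨ pow-P-split (d ℕ.+ 2) (63 ℕ.* (d ℕ.* d)) ⟩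
        pow P (d ℕ.+ 2 ℕ.+ 63 ℕ.* (d ℕ.* d)) ∎
        where
        open ≤-Reasoning
        small : 2 ℕ.* (2 ℕ.* suc d) ℕ.≤ 2 ℕ.^ (d ℕ.+ 2)
        small = ℕ.≤-trans (ℕ.*-monoʳ-≤ 2 (ℕ.*-monoʳ-≤ 2 (suc≤2^ d))) (ℕ.≤-reflexive (cong (2 ℕ.^_) (ℕ.+-comm 2 d)))

      2L≤M^a : L + L ≤ pow M a
      2L≤M^a = begin
        L + L                                       ≡⟨ solve 1 (λ x → x :+ x := (con 1ℚ :+ con 1ℚ) :* x) refl L ⟩
        (1ℚ + 1ℚ) * L                               ≤⟨ *-mono-≤₀ (+-nonneg 0≤1 0≤1) (≤-trans 0≤1 1≤L) 2≤P L≤ ⟩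
        pow P (suc (d ℕ.+ 2 ℕ.+ 63 ℕ.* (d ℕ.* d)))  ≤⟨ pow-exp-mono 1≤P exponent ⟩
        pow P (a ℕ.* (34 ℕ.* d))                    ≡⟨ pow-* P a (34 ℕ.* d) ⟩
        pow M a                                     ∎
        where
        open ≤-Reasoning
        exponent : suc (d ℕ.+ 2 ℕ.+ 63 ℕ.* (d ℕ.* d)) ℕ.≤ a ℕ.* (34 ℕ.* d)
        exponent = M-exponent d′

      L²≤ : L * L ≤ pow P (400 ℕ.* (d ℕ.* d))
      L²≤ = begin
        L * L                                     ≤⟨ *-mono-≤₀ 0≤L 0≤L L≤ L≤ ⟩
        pow P e * pow P e                         ≡⟨ pow-P-split e e ⟩
        pow P (e ℕ.+ e)                           ≤⟨ pow-exp-mono 1≤P exponent ⟩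
        pow P (400 ℕ.* (d ℕ.* d))                 ∎
        where
        open ≤-Reasoning
        0≤L = ≤-trans 0≤1 1≤L
        e = d ℕ.+ 2 ℕ.+ 63 ℕ.* (d ℕ.* d)
        exponent : e ℕ.+ e ℕ.≤ 400 ℕ.* (d ℕ.* d)
        exponent = L²-exponent d′

      -- The sum of the spreads will be at most 2nM, and `few-visits` asks that 32 times this sum be
      -- at most N.
      64M≤ : ι 64 * M ≤ pow P (400 ℕ.* d)
      64M≤ = begin
        ι 64 * M                        ≤⟨ *-monoʳ (pow-nonneg (34 ℕ.* d) 0≤P) (ι-2^≤pow 6) ⟩
        pow P 6 * M                     ≡⟨ pow-P-split 6 (34 ℕ.* d) ⟩
        pow P (6 ℕ.+ 34 ℕ.* d)          ≤⟨ pow-exp-mono 1≤P exponent ⟩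
        pow P (400 ℕ.* d)               ∎
        where
        open ≤-Reasoning
        exponent : 6 ℕ.+ 34 ℕ.* d ℕ.≤ 400 ℕ.* d
        exponent = ℕ.≤-trans (ℕ.+-monoˡ-≤ (34 ℕ.* d) (ℕ.≤-trans (ℕ.m≤m+n 6 360) (ℕ.*-monoʳ-≤ 366 {1} {d} (s≤s z≤n))))
          (ℕ.≤-reflexive (sym (ℕ.*-distribʳ-+ d 366 34)))

      -- After cancellation of N^(2t) this is 2(d + 1)3^t < Kγ^t, where Kγ^t is P to the power
      -- `slack d′`.
      choiceBudget : ∀ N → 1 ℕ.≤ N → ∀ {k} → pow (ι N) t * pow (γ * ι N) t ≤ k →
        ι (suc d) * (ι 2 * (pow (ι N) t * pow (ι (3 ℕ.* N)) t)) < K * k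
      choiceBudget N 1≤N {k} lower = begin-strict
        ι (suc d) * (ι 2 * (m * pow (ι (3 ℕ.* N)) t))
          ≡⟨ cong (λ z → ι (suc d) * (ι 2 * (m * z))) (trans (cong (λ x → pow x t) (ι-* 3 N)) (pow-distrib-* (ι 3) (ι N) t)) ⟩
        ι (suc d) * (ι 2 * (m * (pow (ι 3) t * m)))
          ≡⟨ solve 4 (λ e w m h → e :* (w :* (m :* (h :* m))) := e :* w :* h :* (m :* m)) refl (ι (suc d)) (ι 2) m (pow (ι 3) t) ⟩
        ι (suc d) * ι 2 * pow (ι 3) t * (m * m)
          ≡⟨ cong (_* (m * m)) (trans (cong₂ _*_ (sym (ι-* (suc d) 2)) (sym (ι-^ 3 t))) (sym (ι-* (suc d ℕ.* 2) (3 ℕ.^ t)))) ⟩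
        ι (suc d ℕ.* 2 ℕ.* 3 ℕ.^ t) * (m * m)
          <⟨ *-monoʳ-< 0<mm (<-≤-trans (ι-mono-< small) (≤-trans (ι-2^≤pow e) (≤-trans (pow-exp-mono 1≤P e≤e′) (≤-reflexive (sym split))))) ⟩
        K * pow γ t * (m * m)
          ≡⟨ solve 3 (λ k g m → k :* g :* (m :* m) := k :* (m :* (g :* m))) refl K (pow γ t) m ⟩
        K * (m * (pow γ t * m))
          ≡⟨ cong (λ z → K * (m * z)) (pow-distrib-* γ (ι N) t) ⟨
        K * (m * pow (γ * ι N) t)
          ≤⟨ *-monoˡ 0≤K lower ⟩
        K * k
          ∎
        where
        open ≤-Reasoning
        m = pow (ι N) t
        0<mm : 0ℚ < m * m
        0<mm = *-pos 0<m 0<m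
          where
          0<m : 0ℚ < m
          0<m = pow-pos t (<-≤-trans 0<1 (1≤ι 1≤N))
        e = d ℕ.+ 1 ℕ.+ (2 ℕ.* t ℕ.+ 1)
        e′ = slack d′
        g = t ℕ.* suc (t ℕ.* 3)
        small : suc d ℕ.* 2 ℕ.* 3 ℕ.^ t ℕ.< 2 ℕ.^ e
        small = ℕ.≤-<-trans
          (ℕ.*-mono-≤ (ℕ.*-monoˡ-≤ 2 (suc≤2^ d))
            (ℕ.≤-trans (ℕ.^-monoˡ-≤ t (ℕ.m≤m+n 3 1)) (ℕ.≤-reflexive (ℕ.^-*-assoc 2 2 t))))
          (ℕ.≤-<-trans
            (ℕ.≤-reflexive (trans (cong (ℕ._* 2 ℕ.^ (2 ℕ.* t)) (sym (ℕ.^-distribˡ-+-* 2 d 1)))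
              (sym (ℕ.^-distribˡ-+-* 2 (d ℕ.+ 1) (2 ℕ.* t)))))
            (ℕ.^-monoʳ-< 2 (s≤s (s≤s z≤n)) (ℕ.+-monoʳ-< (d ℕ.+ 1) (ℕ.m<m+n (2 ℕ.* t) (s≤s z≤n)))))
        e≤e′ : e ℕ.≤ e′
        e≤e′ = slack-exponent d′
        split : K * pow γ t ≡ pow P e′
        split = E.begin
          K * pow γ t                    E.≡⟨ cong₂ _*_ (cong (pow P) e′+g) (sym (pow-* α t (suc (t ℕ.* 3)))) ⟩
          pow P (e′ ℕ.+ g) * pow α g     E.≡⟨ cong (_* pow α g) (pow-+ P e′ g) ⟩
          pow P e′ * pow P g * pow α g   E.≡⟨ *-assoc (pow P e′) (pow P g) (pow α g) ⟩
          pow P e′ * (pow P g * pow α g) E.≡⟨ trans (cong (pow P e′ *_) (pow-P-α g)) (*-identityʳ (pow P e′)) ⟩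
          pow P e′                       E.∎
          where
          module E = ≡-Reasoning
          e′+g : 63 ℕ.* (d ℕ.* d) ≡ e′ ℕ.+ g
          e′+g = K-exponent d′

-- Assembly: sizes, a good run, and the case d = 0.

module Universality where

  open import Data.Bool using (Bool; true; false; _∧_; _∨_; not)
  import Data.Bool.Properties as Bool
  open import Data.Fin as Fin using (Fin; zero; suc; toℕ; fromℕ<)
  import Data.Fin.Properties as Fin
  open import Data.List using (List; []; _∷_; length; map)
  open import Data.List.Membership.Propositional using (_∈_)
  open import Data.Nat as ℕ using (ℕ; zero; suc; z≤n; s≤s)
  import Data.Nat.Properties as ℕ
  open import Data.Product using (∃; _×_; _,_; proj₁; proj₂)
  open import Data.Rational
  open import Data.Rational.Properties
  open import Data.Rational.Solver using (module +-*-Solver)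
  open import Data.Sum using (_⊎_; inj₁; inj₂)
  open import Relation.Binary.PropositionalEquality
  open import Relation.Nullary using (does; yes; no; contradiction)
  open import Relation.Nullary.Decidable using (dec-true; from-yes)
  open Rationals
  open FiniteSums
  open CommonNeighbourhoods
  open RandomHomomorphism
  open ProcessBounds
  open Embedding
  open Constants

  hits-true : ∀ {n N} (F : Graph n) col (G : Graph N) T → ∀ r → Process.hits F col G T (λ _ → true) r ≡ length r
  hits-true F col G T [] = refl
  hits-true F col G T (v ∷ r) = cong suc (hits-true F col G T r)

  module _ {n N : ℕ} (F : Graph n) (col : Fin n → Bool) (G : Graph N) (T : Bool → List (Fin N)) where

    open Process F col G T

    -- M^(a-1) X ≤ M^a + X^a, summed over the history.
    total-bound : ∀ M s → 0ℚ ≤ M → ∀ h →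
      pow M s * ι (total F col G T h) ≤ ι (length h) * pow M (suc s) + powerSum-all F col G T (suc s) h
    total-bound M s 0≤M [] = ≤-reflexive (trans (cong (pow M s *_) ι-0)
      (trans (*-zeroʳ (pow M s)) (sym (trans (+-identityʳ _) (trans (cong (_* pow M (suc s)) ι-0) (*-zeroˡ (pow M (suc s))))))))
    total-bound M s 0≤M ((u , w) ∷ h) = begin
      m * ι (X u h ℕ.+ total F col G T h)
        ≡⟨ trans (cong (m *_) (ι-+ (X u h) (total F col G T h))) (*-distribˡ-+ m x (ι (total F col G T h))) ⟩
      m * x + m * ι (total F col G T h)
        ≤⟨ +-mono-≤ (tangent s (ι-nonneg (X u h)) 0≤M) (total-bound M s 0≤M h) ⟩
      pow x (suc s) + pow M (suc s) + (ι (length h) * pow M (suc s) + p)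
        ≡⟨ solve 4 (λ x m l p → x :+ m :+ (l :* m :+ p) := (con 1ℚ :+ l) :* m :+ (x :+ p)) refl (pow x (suc s)) (pow M (suc s)) (ι (length h)) p ⟩
      (1ℚ + ι (length h)) * pow M (suc s) + (pow x (suc s) + p)
        ≡⟨ cong (λ z → z * pow M (suc s) + (pow x (suc s) + p)) (ι-suc (length h)) ⟨
      ι (suc (length h)) * pow M (suc s) + (pow x (suc s) + p)
        ∎
      where
      open ≤-Reasoning
      open +-*-Solver
      m = pow M s
      x = ι (X u h)
      p = powerSum-all F col G T (suc s) h

  pow≤2 : ∀ x m → 0ℚ ≤ x → ι m * x ≤ ½ → pow (1ℚ + x) m ≤ 1ℚ + 1ℚ
  pow≤2 x m 0≤x mx≤½ = begin
    q                           ≡⟨ solve 1 (λ q → q := (con 1ℚ :+ con 1ℚ) :* (q :* (con 1ℚ :- con ½))) refl q ⟩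
    (1ℚ + 1ℚ) * (q * (1ℚ - ½))  ≤⟨ *-monoˡ (+-nonneg 0≤1 0≤1) (≤-trans
                                     (*-monoˡ (pow-nonneg m (≤-trans 0≤1 (≤-+ʳ 0≤x))) (+-monoʳ-≤ 1ℚ (neg-antimono-≤ mx≤½)))
                                     (pow-upper x m 0≤x)) ⟩
    (1ℚ + 1ℚ) * 1ℚ              ≡⟨ *-identityʳ (1ℚ + 1ℚ) ⟩
    1ℚ + 1ℚ                     ∎
    where
    open ≤-Reasoning
    open +-*-Solver
    q = pow (1ℚ + x) m

  module _ (α : ℚ) (0<α : 0ℚ < α) (α≤½ : α ≤ ½) (d′ n N : ℕ) (G : Graph N) where

    open Powers α 0<α α≤½
    open AtDegree d′

    module Sizes (n-large : pow P (400 ℕ.* (d ℕ.* d)) ≤ ι n) (N-large : pow P (400 ℕ.* d) * ι n ≤ ι N) where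

      1≤n : 1 ℕ.≤ n
      1≤n = ι-cancel-≤ (≤-trans (≤-reflexive ι-1) (≤-trans (1≤pow (400 ℕ.* (d ℕ.* d)) 1≤P) n-large))

      ιn≤ιN : ι n ≤ ι N
      ιn≤ιN = ≤-trans (≤-reflexive (sym (*-identityˡ (ι n))))
        (≤-trans (*-monoʳ (ι-nonneg n) (1≤pow (400 ℕ.* d) 1≤P)) N-large)

      n≤N : n ℕ.≤ N
      n≤N = ι-cancel-≤ ιn≤ιN

      1≤N : 1 ℕ.≤ N
      1≤N = ℕ.≤-trans 1≤n n≤N

      2^≤N : 2 ℕ.^ (400 ℕ.* (d ℕ.* d)) ℕ.≤ N
      2^≤N = ι-cancel-≤ (≤-trans (ι-2^≤pow (400 ℕ.* (d ℕ.* d))) (≤-trans n-large ιn≤ιN))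

      2≤N : 2 ℕ.≤ N
      2≤N = ℕ.≤-trans (ℕ.^-monoʳ-≤ 2 {1} {400 ℕ.* (d ℕ.* d)} (s≤s z≤n)) 2^≤N

      -- Twice the bound on the expected power sum, to be used with Markov's inequality.
      C : ℚ
      C = ι n * L + ι n * L

      0≤L : 0ℚ ≤ L
      0≤L = ≤-trans 0≤1 1≤L

      0<C : 0ℚ < C
      0<C = <-≤-trans 0<1 (≤-trans (*-mono-≤₀ 0≤1 0≤1 (1≤ι 1≤n) 1≤L) (≤-+ʳ (*-nonneg (ι-nonneg n) 0≤L)))

      degrees : ι (orderedEdgeCount G) ≥ α * ι (N ℕ.* (N ℕ.∸ 1)) →
        pow (ι N) 1 * (β * ι N + β * ι N) ≤ sumAll 1 (λ q → ι (codeg G q))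
      degrees density = begin
        pow (ι N) 1 * (β * ι N + β * ι N)
          ≡⟨ solve 2 (λ m b → (m :* con 1ℚ) :* (b :* m :+ b :* m) := (b :+ b) :* (m :* m)) refl (ι N) β ⟩
        (β + β) * (ι N * ι N)
          ≡⟨ cong ((β + β) *_) (ι-* N N) ⟨
        (β + β) * ι (N ℕ.* N)
          ≤⟨ *-monoˡ (+-nonneg 0≤β 0≤β) (ι-mono (N²≤ N 2≤N)) ⟩
        (β + β) * ι (e ℕ.+ e)
          ≡⟨ trans (cong ((β + β) *_) (ι-+ e e)) (solve 2 (λ b e → b :* (e :+ e) := (b :+ b) :* e) refl (β + β) (ι e)) ⟩
        ((β + β) + (β + β)) * ι e
          ≤⟨ *-monoʳ (ι-nonneg e) 4β≤α ⟩
        α * ι e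
          ≤⟨ density ⟩
        ι (orderedEdgeCount G)
          ≡⟨ codeg-total G ⟨
        sumAll 1 (λ q → ι (codeg G q))
          ∎
        where
        open ≤-Reasoning
        open +-*-Solver
        e = N ℕ.* (N ℕ.∸ 1)
        0≤β : 0ℚ ≤ β
        0≤β = pow-nonneg 3 0≤α
        N²≤ : ∀ N → 2 ℕ.≤ N → N ℕ.* N ℕ.≤ N ℕ.* (N ℕ.∸ 1) ℕ.+ N ℕ.* (N ℕ.∸ 1)
        N²≤ (suc m) (s≤s 1≤m) = ℕ.≤-trans (ℕ.*-monoʳ-≤ (suc m) (ℕ.+-monoˡ-≤ m 1≤m)) (ℕ.≤-reflexive (ℕ.*-distribˡ-+ (suc m) m m))

      choice : ι (orderedEdgeCount G) ≥ α * ι (N ℕ.* (N ℕ.∸ 1)) →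
        ∃ λ (T : Bool → List (Fin N)) →
          (∀ c → length (T c) ≡ t) × (complete G (T false) (T true) ≡ true) ×
          (∀ c k → k ℕ.≤ d → moment G (T c) (T (not c)) t k ≤ K * pow (ι N) k)
      choice density = dependentChoice G t d K 1≤N 0≤K (choiceBudget N 1≤N
        -- The numerical argument is t - 1.
        (completePairs-lower G (d′ ℕ.+ suc d′ ℕ.+ a) β γ (pow-nonneg 3 0≤α) (pow-nonneg (suc (t ℕ.* 3)) 0≤α)
          (degrees density) 2γ≤β^t))

      -- From x² ≤ x^a ≤ 2NL and 2N ≤ xs it follows that 2N ≤ Ls². Squaring and L² ≤ n ≤ N give the
      -- claim.
      candidates-large : ∀ x s → 1 ℕ.≤ x → 2 ℕ.* N ℕ.≤ x ℕ.* s → pow (ι x) a ≤ C → N ℕ.≤ s ℕ.^ 4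
      candidates-large x s 1≤x 2N≤xs x^a≤C = ι-cancel-≤ (*-cancelˡ-≤₀ 0<ν (begin
        ν * ν
          ≤⟨ ≤-trans (≤-+ʳ {q = ν * ν} 0≤νν) (≤-+ʳ (+-nonneg 0≤νν 0≤νν)) ⟩
        (ν * ν + ν * ν) + (ν * ν + ν * ν)
          ≡⟨ solve 1 (λ v → (v :* v :+ v :* v) :+ (v :* v :+ v :* v) := (v :+ v) :* (v :+ v)) refl ν ⟩
        (ν + ν) * (ν + ν)
          ≤⟨ *-mono-≤₀ (+-nonneg 0≤ν 0≤ν) (+-nonneg 0≤ν 0≤ν) 2ν≤Lσ² 2ν≤Lσ² ⟩
        L * (σ * σ) * (L * (σ * σ))
          ≡⟨ solve 2 (λ l s → l :* (s :* s) :* (l :* (s :* s)) := (l :* l) :* (s :* (s :* (s :* (s :* con 1ℚ))))) refl L σ ⟩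
        L * L * pow σ 4
          ≤⟨ *-monoʳ (pow-nonneg 4 0≤σ) (≤-trans L²≤ (≤-trans n-large ιn≤ιN)) ⟩
        ν * pow σ 4
          ≡⟨ cong (ν *_) (ι-^ s 4) ⟨
        ν * ι (s ℕ.^ 4)
          ∎))
        where
        open ≤-Reasoning
        open +-*-Solver
        ν = ι N
        σ = ι s
        0≤σ : 0ℚ ≤ σ
        0≤σ = ι-nonneg s
        0≤ν : 0ℚ ≤ ν
        0≤ν = ι-nonneg N
        0<ν : 0ℚ < ν
        0<ν = <-≤-trans 0<1 (1≤ι 1≤N)
        0≤νν : 0ℚ ≤ ν * ν
        0≤νν = *-nonneg 0≤ν 0≤ν
        x²≤C : ι x * ι x ≤ C
        x²≤C = ≤-trans (≤-reflexive (cong (ι x *_) (sym (*-identityʳ (ι x)))))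
          (≤-trans (pow-exp-mono {j = 2} (1≤ι 1≤x) (ℕ.+-mono-≤ {1} {d} {1} {d} (s≤s z≤n) (s≤s z≤n))) x^a≤C)
        2ν≤xσ : ν + ν ≤ ι x * σ
        2ν≤xσ = begin
          ν + ν           ≡⟨ solve 1 (λ v → v :+ v := (con 1ℚ :+ con 1ℚ) :* v) refl ν ⟩
          (1ℚ + 1ℚ) * ν   ≡⟨ trans (ι-* 2 N) (cong (_* ν) ι-2) ⟨
          ι (2 ℕ.* N)     ≤⟨ ι-mono 2N≤xs ⟩
          ι (x ℕ.* s)     ≡⟨ ι-* x s ⟩
          ι x * σ         ∎
        2ν≤Lσ² : ν + ν ≤ L * (σ * σ)
        2ν≤Lσ² = *-cancelˡ-≤₀ (<-≤-trans 0<ν (≤-+ʳ 0≤ν)) (begin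
          (ν + ν) * (ν + ν)
            ≤⟨ *-mono-≤₀ (+-nonneg 0≤ν 0≤ν) (+-nonneg 0≤ν 0≤ν) 2ν≤xσ 2ν≤xσ ⟩
          ι x * σ * (ι x * σ)
            ≡⟨ solve 2 (λ x s → x :* s :* (x :* s) := x :* x :* (s :* s)) refl (ι x) σ ⟩
          ι x * ι x * (σ * σ)
            ≤⟨ *-monoʳ (*-nonneg 0≤σ 0≤σ) (≤-trans x²≤C (+-mono-≤ (*-monoʳ 0≤L ιn≤ιN) (*-monoʳ 0≤L ιn≤ιN))) ⟩
          (ν * L + ν * L) * (σ * σ)
            ≡⟨ solve 3 (λ v l s → (v :* l :+ v :* l) :* (s :* s) := (v :+ v) :* (l :* (s :* s))) refl ν L σ ⟩
          (ν + ν) * (L * (σ * σ))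
            ∎)

      -- Since 2L ≤ M^a, the power sum is absorbed by nM^a, and dividing by M^(a - 1) leaves m ≤
      -- 2nM.
      32total≤N : ∀ m → pow M (d′ ℕ.+ suc d′) * ι m ≤ ι n * pow M a + C → 32 ℕ.* m ℕ.≤ N
      32total≤N m bound = ι-cancel-≤ (begin
        ι (32 ℕ.* m)                 ≡⟨ ι-* 32 m ⟩
        ι 32 * ι m                   ≤⟨ *-monoˡ (ι-nonneg 32) m≤2nM ⟩
        ι 32 * (ι n * M + ι n * M)   ≡⟨ solve 3 (λ c n m → c :* (n :* m :+ n :* m) := (con 1ℚ :+ con 1ℚ) :* c :* m :* n) refl (ι 32) (ι n) M ⟩
        (1ℚ + 1ℚ) * ι 32 * M * ι n   ≡⟨ cong (λ z → z * M * ι n) (trans (cong (_* ι 32) (sym ι-2)) (sym (ι-* 2 32))) ⟩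
        ι 64 * M * ι n               ≤⟨ *-monoʳ (ι-nonneg n) 64M≤ ⟩
        pow P (400 ℕ.* d) * ι n      ≤⟨ N-large ⟩
        ι N                          ∎)
        where
        open ≤-Reasoning
        open +-*-Solver
        s = d′ ℕ.+ suc d′
        m≤2nM : ι m ≤ ι n * M + ι n * M
        m≤2nM = *-cancelˡ-≤₀ (pow-pos s (<-≤-trans 0<1 (1≤pow (34 ℕ.* d) 1≤P))) (begin
          pow M s * ι m                   ≤⟨ bound ⟩
          ι n * pow M a + (ι n * L + ι n * L)
            ≡⟨ cong (ι n * pow M a +_) (sym (*-distribˡ-+ (ι n) L L)) ⟩
          ι n * pow M a + ι n * (L + L)
            ≤⟨ +-monoʳ-≤ (ι n * pow M a) (*-monoˡ (ι-nonneg n) 2L≤M^a) ⟩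
          ι n * (M * pow M s) + ι n * (M * pow M s)
            ≡⟨ solve 3 (λ n m p → n :* (m :* p) :+ n :* (m :* p) := p :* (n :* m :+ n :* m)) refl (ι n) M (pow M s) ⟩
          pow M s * (ι n * M + ι n * M)   ∎)

      -- Four times 2(d + 1)N^d, which bounds the expected sum of all tilts over both colours.
      B : ℕ
      B = 8 ℕ.* suc d ℕ.* N ℕ.^ d

      -- The base 16 is chosen so that 16^visits ≤ 4^s gives 2 visits ≤ s.
      few-visits : ∀ visits total s ρ → ρ * (1ℚ + ι s * (ι 16 * inv N)) ≡ 1ℚ → B ℕ.≤ 2 ℕ.^ s →
        32 ℕ.* total ℕ.≤ N → pow (ι 16) visits * pow ρ total ≤ ι B → 2 ℕ.* visits ℕ.≤ s
      few-visits v m s ρ ρ[1+y]≡1 B≤2^s 32m≤N tilt≤B = ℕ.*-cancelˡ-≤ 2 (2^-cancel-≤ (ι-cancel-≤ (begin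
        ι (2 ℕ.^ (2 ℕ.* (2 ℕ.* v)))
          ≡⟨ cong ι (trans (cong (2 ℕ.^_) (sym (ℕ.*-assoc 2 2 v))) (sym (ℕ.^-*-assoc 2 4 v))) ⟩
        ι (16 ℕ.^ v)                               ≡⟨ ι-^ 16 v ⟩
        pow (ι 16) v                               ≡⟨ *-identityʳ (pow (ι 16) v) ⟨
        pow (ι 16) v * 1ℚ                          ≡⟨ cong (pow (ι 16) v *_) (trans (sym (pow-1 m)) (trans (cong (λ z → pow z m) (sym ρ[1+y]≡1)) (pow-distrib-* ρ (1ℚ + y) m))) ⟩
        pow (ι 16) v * (pow ρ m * pow (1ℚ + y) m)  ≡⟨ *-assoc (pow (ι 16) v) (pow ρ m) _ ⟨
        pow (ι 16) v * pow ρ m * pow (1ℚ + y) m    ≤⟨ *-mono-≤₀ 0≤tilt (pow-nonneg m 0≤1+y) (≤-trans tilt≤B (ι-mono B≤2^s)) growth ⟩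
        ι (2 ℕ.^ s) * ι (2 ℕ.^ s)                  ≡⟨ trans (sym (ι-* (2 ℕ.^ s) (2 ℕ.^ s))) (cong ι (trans (sym (ℕ.^-distribˡ-+-* 2 s s)) (cong (λ z → 2 ℕ.^ (s ℕ.+ z)) (sym (ℕ.+-identityʳ s))))) ⟩
        ι (2 ℕ.^ (2 ℕ.* s))                        ∎)))
        where
        open ≤-Reasoning
        open +-*-Solver
        x = ι 16 * inv N
        y = ι s * x
        0≤x : 0ℚ ≤ x
        0≤x = *-nonneg (ι-nonneg 16) (inv-nonneg N)
        0≤1+y : 0ℚ ≤ 1ℚ + y
        0≤1+y = +-nonneg 0≤1 (*-nonneg (ι-nonneg s) 0≤x)
        0≤ρ : 0ℚ ≤ ρ
        0≤ρ = *-cancelˡ-≤₀ (<-≤-trans 0<1 (≤-+ʳ (*-nonneg (ι-nonneg s) 0≤x)))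
          (≤-trans (≤-reflexive (*-zeroʳ (1ℚ + y))) (≤-trans 0≤1 (≤-reflexive (sym (trans (*-comm (1ℚ + y) ρ) ρ[1+y]≡1)))))
        0≤tilt : 0ℚ ≤ pow (ι 16) v * pow ρ m
        0≤tilt = *-nonneg (pow-nonneg v (ι-nonneg 16)) (pow-nonneg m 0≤ρ)
        mx≤½ : ι m * x ≤ ½
        mx≤½ = begin
          ι m * (ι 16 * inv N)
            ≡⟨ solve 3 (λ m c i → m :* (c :* i) := con ½ :* (i :* (((con 1ℚ :+ con 1ℚ) :* c) :* m))) refl (ι m) (ι 16) (inv N) ⟩
          ½ * (inv N * ((1ℚ + 1ℚ) * ι 16 * ι m))
            ≡⟨ cong (λ z → ½ * (inv N * z)) (trans (cong (λ z → z * ι 16 * ι m) (sym ι-2)) (trans (cong (_* ι m) (sym (ι-* 2 16))) (sym (ι-* 32 m)))) ⟩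
          ½ * (inv N * ι (32 ℕ.* m))
            ≤⟨ *-monoˡ (nonNegative⁻¹ ½) (≤-trans (*-monoˡ (inv-nonneg N) (ι-mono 32m≤N)) (inv*ι≤1 N)) ⟩
          ½ * 1ℚ
            ≡⟨ *-identityʳ ½ ⟩
          ½
            ∎
        -- As y = sx, Bernoulli's inequality and an exchange of exponents reduce this to the s-th
        -- power of (1 + x)^m ≤ 2.
        growth : pow (1ℚ + y) m ≤ ι (2 ℕ.^ s)
        growth = begin
          pow (1ℚ + y) m              ≤⟨ pow-mono m 0≤1+y (bernoulli x s 0≤x) ⟩
          pow (pow (1ℚ + x) s) m      ≡⟨ pow-* (1ℚ + x) m s ⟨
          pow (1ℚ + x) (m ℕ.* s)      ≡⟨ cong (pow (1ℚ + x)) (ℕ.*-comm m s) ⟩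
          pow (1ℚ + x) (s ℕ.* m)      ≡⟨ pow-* (1ℚ + x) s m ⟩
          pow (pow (1ℚ + x) m) s      ≤⟨ pow-mono s (pow-nonneg m (+-nonneg 0≤1 0≤x)) (pow≤2 x m 0≤x mx≤½) ⟩
          pow (1ℚ + 1ℚ) s             ≡⟨ cong (λ z → pow z s) ι-2 ⟨
          pow (ι 2) s                 ≡⟨ ι-^ 2 s ⟨
          ι (2 ℕ.^ s)                 ∎

      module Finish (F : Graph n) (degenerate : Degenerate d F) (col : Fin n → Bool)
        (proper : ∀ u v → adj F u v ≡ true → col u ≢ col v)
        (T : Bool → List (Fin N)) (lengths : ∀ c → length (T c) ≡ t) (complete-T : complete G (T false) (T true) ≡ true)
        (moments : ∀ c k → k ℕ.≤ d → moment G (T c) (T (not c)) t k ≤ K * pow (ι N) k) where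

        open Process F col G T

        T≢[] : ∀ c → 1 ℕ.≤ length (T c)
        T≢[] c = ℕ.≤-trans (s≤s z≤n) (ℕ.≤-reflexive (sym (lengths c)))

        order : ∃ λ r → Ordered F col G T d r × (∀ v → true ≡ true → v ∈ r) × (∀ S → hits S r ℕ.≤ count S)
        order = degeneracyOrder F col G T degenerate n (λ _ → true) (count≤n (λ _ → true))

        r : List (Fin n)
        r = proj₁ order

        ordered : Ordered F col G T d r
        ordered = proj₁ (proj₂ order)

        ∣r∣≤n : hits (λ _ → true) r ℕ.≤ n
        ∣r∣≤n = ℕ.≤-trans (proj₂ (proj₂ (proj₂ order)) (λ _ → true)) (count≤n {n} (λ _ → true))

        powers : Hist → ℚ
        powers = powerSum-all F col G T a

        0≤powers : ∀ h → 0ℚ ≤ powers h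
        0≤powers = powerSum-nonneg F col G T a (λ _ → true)

        E-powers : E r powers ≤ ι n * L
        E-powers = ≤-trans
          (MomentBound.powerSumMoment F col G T proper a d (ℕ.m≤m+n d d) K L (ι lℕ) (inv lℕ)
            0≤K 1≤L (ι-nonneg lℕ) (inv-nonneg lℕ) (inv-inverse {lℕ} (s≤s z≤n)) recursion moments
            r ordered (λ _ → true))
          (*-monoʳ 0≤L (ι-mono ∣r∣≤n))

        module OfSet (S : Fin N → Bool) where

          y : ℚ
          y = ι (count S) * (ι 16 * inv N)

          0≤y : 0ℚ ≤ y
          0≤y = *-nonneg (ι-nonneg (count S)) (*-nonneg (ι-nonneg 16) (inv-nonneg N))

          0<1+y : 0ℚ < 1ℚ + y
          0<1+y = <-≤-trans 0<1 (≤-+ʳ 0≤y)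

          ρ : ℚ
          ρ = recip (1ℚ + y) 0<1+y

          exponent : ι 16 * (inv N * ι (count S)) ≡ y
          exponent = solve 3 (λ b i s → b :* (i :* s) := s :* (b :* i)) refl (ι 16) (inv N) (ι (count S))
            where open +-*-Solver

          open TiltBound F col G T (ι 16) ρ y S (ι-nonneg 16) (<⇒≤ (recip-pos (1ℚ + y) 0<1+y)) 0≤y
            (≤-reflexive (recip-inverse (1ℚ + y) 0<1+y))
            (≤-reflexive exponent)
            public

        tiltOf : (Fin N → Bool) → Hist → ℚ
        tiltOf S = tilt F col G T (ι 16) (OfSet.ρ S) S

        -- The union bound in the form of a sum: every set `cand c q` enters with the discount ρ
        -- adapted to its own size.
        tilts : Bool → Hist → ℚ
        tilts c h = sum {suc d} (λ i → sumAll (toℕ i) (λ q → tiltOf (cand c q) h))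

        0≤tilts : ∀ c h → 0ℚ ≤ tilts c h
        0≤tilts c h = sum-nonneg {suc d} λ i →
          sumIn-nonneg (λ _ → true) (toℕ i) λ q → OfSet.tilt-nonneg (cand c q) h

        tilt≤tilts : ∀ c q h → length q ℕ.≤ d → tiltOf (cand c q) h ≤ tilts c h
        tilt≤tilts c q h q≤d = ≤-trans
          (term≤sumAll (λ p → OfSet.tilt-nonneg (cand c p) h) q)
          (subst (λ k → sumAll k (λ p → tiltOf (cand c p) h) ≤ tilts c h) (Fin.toℕ-fromℕ< (s≤s q≤d))
            (term≤sum {suc d} (λ i → sumIn-nonneg (λ _ → true) (toℕ i) λ p → OfSet.tilt-nonneg (cand c p) h) (fromℕ< (s≤s q≤d))))

        E-tilts : ∀ c → E r (tilts c) ≤ ι (suc d) * ι (N ℕ.^ d)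
        E-tilts c = E-sum r {suc d} (λ i h → sumAll (toℕ i) (λ q → tiltOf (cand c q) h)) (ι (N ℕ.^ d)) λ i →
          ≤-trans (E-sumAll r (toℕ i) (λ q → tiltOf (cand c q)) 1ℚ (λ q → OfSet.E-tilt (cand c q) r))
            (≤-trans (≤-reflexive (*-identityʳ (pow (ι N) (toℕ i))))
              (≤-trans (pow-exp-mono (1≤ι 1≤N) (Fin.toℕ≤pred[n] i)) (≤-reflexive (sym (ι-^ N d)))))

        κ : ℚ
        κ = recip C 0<C

        0≤κ : 0ℚ ≤ κ
        0≤κ = <⇒≤ (recip-pos C 0<C)

        1≤B : 1 ℕ.≤ B
        1≤B = ℕ.*-mono-≤ {1} {8 ℕ.* suc d} {1} {N ℕ.^ d} (s≤s z≤n) (1≤N^ d)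
          where
          1≤N^ : ∀ k → 1 ℕ.≤ N ℕ.^ k
          1≤N^ zero = s≤s z≤n
          1≤N^ (suc k) = ℕ.*-mono-≤ 1≤N (1≤N^ k)

        -- Two applications of Markov's inequality in one: the two parts have expectation at most
        -- 1/2 and 1/4, and a value below 1 bounds the power sum by C and the tilts by B in the same
        -- run.
        badness : Hist → ℚ
        badness h = κ * powers h + inv B * (tilts false h + tilts true h)

        E-badness : E r badness < 1ℚ
        E-badness = begin-strict
          E r badness
            ≡⟨ trans (E-+ r (λ h → κ * powers h) (λ h → inv B * (tilts false h + tilts true h)))
                 (cong₂ _+_ (E-*ˡ r powers κ) (trans (E-*ˡ r (λ h → tilts false h + tilts true h) (inv B))
                   (cong (inv B *_) (E-+ r (tilts false) (tilts true))))) ⟩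
          κ * E r powers + inv B * (E r (tilts false) + E r (tilts true))
            ≤⟨ +-mono-≤ (*-monoˡ 0≤κ E-powers) (*-monoˡ (inv-nonneg B) (+-mono-≤ (E-tilts false) (E-tilts true))) ⟩
          κ * z + inv B * (b + b)
            ≡⟨ solve 4 (λ k z i b → k :* z :+ i :* (b :+ b) := con ½ :* (k :* (z :+ z)) :+ con (½ * ½) :* (i :* (((con 1ℚ :+ con 1ℚ) :* ((con 1ℚ :+ con 1ℚ) :* (con 1ℚ :+ con 1ℚ))) :* b))) refl κ z (inv B) b ⟩
          ½ * (κ * C) + ½ * ½ * (inv B * ((1ℚ + 1ℚ) * ((1ℚ + 1ℚ) * (1ℚ + 1ℚ)) * b))
            ≡⟨ cong₂ (λ u w → ½ * u + ½ * ½ * (inv B * w)) (recip-inverse C 0<C) eight ⟩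
          ½ * 1ℚ + ½ * ½ * (inv B * ι B)
            ≡⟨ cong (λ u → ½ * 1ℚ + ½ * ½ * u) (inv-inverse 1≤B) ⟩
          ½ * 1ℚ + ½ * ½ * 1ℚ
            <⟨ from-yes (½ * 1ℚ + ½ * ½ * 1ℚ <? 1ℚ) ⟩
          1ℚ
            ∎
          where
          open ≤-Reasoning
          open +-*-Solver
          z = ι n * L
          b = ι (suc d) * ι (N ℕ.^ d)
          eight : (1ℚ + 1ℚ) * ((1ℚ + 1ℚ) * (1ℚ + 1ℚ)) * b ≡ ι B
          eight = trans (cong (λ u → u * (u * u) * b) (sym ι-2))
            (trans (cong (λ u → ι 2 * u * b) (sym (ι-* 2 2)))
              (trans (cong (_* b) (sym (ι-* 2 4)))
                (trans (sym (*-assoc (ι 8) (ι (suc d)) (ι (N ℕ.^ d))))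
                  (trans (cong (_* ι (N ℕ.^ d)) (sym (ι-* 8 (suc d)))) (sym (ι-* (8 ℕ.* suc d) (N ℕ.^ d)))))))

        good : ∃ λ h → Run F col G T r h × badness h < 1ℚ
        good = E-<⇒∃ F col G T proper complete-T T≢[] r badness E-badness

        h : Hist
        h = proj₁ good

        run : Run F col G T r h
        run = proj₁ (proj₂ good)

        badness<1 : badness h < 1ℚ
        badness<1 = proj₂ (proj₂ good)

        0≤κpowers : 0ℚ ≤ κ * powers h
        0≤κpowers = *-nonneg 0≤κ (0≤powers h)

        0≤tilts₂ : 0ℚ ≤ tilts false h + tilts true h
        0≤tilts₂ = +-nonneg (0≤tilts false h) (0≤tilts true h)

        powers≤C : powers h ≤ C
        powers≤C = begin
          powers h            ≡⟨ trans (cong (_* powers h) (trans (*-comm C κ) (recip-inverse C 0<C))) (*-identityˡ (powers h)) ⟨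
          C * κ * powers h    ≡⟨ *-assoc C κ (powers h) ⟩
          C * (κ * powers h)  ≤⟨ *-monoˡ (<⇒≤ 0<C) (≤-trans (≤-+ʳ (*-nonneg (inv-nonneg B) 0≤tilts₂)) (<⇒≤ badness<1)) ⟩
          C * 1ℚ              ≡⟨ *-identityʳ C ⟩
          C                   ∎
          where open ≤-Reasoning

        tilts≤B : tilts false h + tilts true h ≤ ι B
        tilts≤B = begin
          u                      ≡⟨ trans (cong (_* u) (trans (*-comm (ι B) (inv B)) (inv-inverse 1≤B))) (*-identityˡ u) ⟨
          ι B * inv B * u        ≡⟨ *-assoc (ι B) (inv B) u ⟩
          ι B * (inv B * u)      ≤⟨ *-monoˡ (ι-nonneg B) (≤-trans (≤-+ˡ 0≤κpowers) (<⇒≤ badness<1)) ⟩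
          ι B * 1ℚ               ≡⟨ *-identityʳ (ι B) ⟩
          ι B                    ∎
          where
          open ≤-Reasoning
          u = tilts false h + tilts true h

        tilt≤B : ∀ c q → length q ℕ.≤ d → tiltOf (cand c q) h ≤ ι B
        tilt≤B false q q≤d = ≤-trans (tilt≤tilts false q h q≤d) (≤-trans (≤-+ʳ (0≤tilts true h)) tilts≤B)
        tilt≤B true q q≤d = ≤-trans (tilt≤tilts true q h q≤d) (≤-trans (≤-+ˡ (0≤tilts false h)) tilts≤B)

        length-h : length h ℕ.≤ n
        length-h = ℕ.≤-trans (ℕ.≤-reflexive (trans (sym (length-map h))
          (trans (cong length (Run⇒map F col G T run)) (sym (hits-true F col G T r))))) ∣r∣≤n
          where
          length-map : ∀ (h : Hist) → length (map proj₁ h) ≡ length h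
          length-map [] = refl
          length-map (_ ∷ h) = cong suc (length-map h)

        few : 32 ℕ.* total F col G T h ℕ.≤ N
        few = 32total≤N (total F col G T h) (≤-trans
          (total-bound F col G T M (d′ ℕ.+ suc d′) 0≤M h)
          (+-mono-≤ (*-monoʳ (pow-nonneg a 0≤M) (ι-mono length-h)) powers≤C))
          where
          0≤M : 0ℚ ≤ M
          0≤M = pow-nonneg (34 ℕ.* d) 0≤P

        room : ∀ c q → length q ℕ.≤ d → 1 ℕ.≤ count (cand c q) → pow (ι (spread G (count (cand c q)))) a ≤ C →
          2 ℕ.* visits F col G T (cand c q) h ℕ.≤ count (cand c q)
        room c q q≤d 1≤s small = few-visits (visits F col G T (cand c q) h) (total F col G T h) s (OfSet.ρ (cand c q))
          (recip-inverse (1ℚ + OfSet.y (cand c q)) (OfSet.0<1+y (cand c q)))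
          (union-bound d′ N s 1≤s 2^≤N (candidates-large (spread G s) s (spread-pos G s) (spread-lower G s 1≤s) small))
          few (tilt≤B c q q≤d)
          where
          s = count (cand c q)

        subgraph : SubgraphOf F G
        subgraph = embedding F col G T h
          (Run⇒AllPairs F col G T run (spacious F col G T
            (target-nonempty F col G T proper complete-T T≢[]) a d C ordered run powers≤C room))
          (λ v → subst (v ∈_) (sym (Run⇒map F col G T run)) (proj₁ (proj₂ (proj₂ order)) v refl))

      universal : ι (orderedEdgeCount G) ≥ α * ι (N ℕ.* (N ℕ.∸ 1)) → UniversalDegBip d n G
      universal density F degenerate (col , proper) =
        let T , lengths , complete-T , moments = choice density
        in Finish.subgraph F degenerate col proper T lengths complete-T moments

  -- The two ends of an edge would span a subgraph in which each has a neighbour.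
  edgeless : ∀ {n} (F : Graph n) → Degenerate 0 F → ∀ u v → adj F u v ≢ true
  edgeless F degenerate u v uv = contradiction (degenerate S (u , u∈S)) λ where
      (x , x∈S , deg≤0) → ℕ.<⇒≱ (neighbour x (ends x x∈S)) deg≤0
    where
    S : Fin _ → Bool
    S w = does (w Fin.≟ u) ∨ does (w Fin.≟ v)
    u∈S : S u ≡ true
    u∈S = cong (_∨ does (u Fin.≟ v)) (dec-true (u Fin.≟ u) refl)
    v∈S : S v ≡ true
    v∈S = trans (cong (does (v Fin.≟ u) ∨_) (dec-true (v Fin.≟ v) refl)) (Bool.∨-zeroʳ (does (v Fin.≟ u)))
    ends : ∀ x → S x ≡ true → x ≡ u ⊎ x ≡ v
    ends x x∈S with x Fin.≟ u | x Fin.≟ v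
    ... | yes x≡u | _ = inj₁ x≡u
    ... | no _ | yes x≡v = inj₂ x≡v
    neighbour : ∀ x → x ≡ u ⊎ x ≡ v → 1 ℕ.≤ degIn F S x
    neighbour x (inj₁ refl) = count-pos (λ w → S w ∧ adj F u w) v (cong₂ _∧_ v∈S uv)
    neighbour x (inj₂ refl) = count-pos (λ w → S w ∧ adj F v w) u (cong₂ _∧_ u∈S (trans (adj-sym F v u) uv))

  universal-zero : ∀ {n N} (G : Graph N) → n ℕ.≤ N → UniversalDegBip 0 n G
  universal-zero G n≤N F degenerate _ =
    (λ v → Fin.inject≤ v n≤N) , Fin.inject≤-injective n≤N n≤N _ _ , λ u v uv → contradiction uv (edgeless F degenerate u v)

  universality : ∀ d α → 0ℚ < α → α ≤ ½ →
    ∀ n → 1ℚ ≤ pow α (400 ℕ.* (d ℕ.* d)) * ℕ→ℚ n →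
    ∀ N (G : Graph N) → ℕ→ℚ n ≤ pow α (400 ℕ.* d) * ℕ→ℚ N → DensityAtLeast α G → UniversalDegBip d n G
  -- The random process needs a = 2d ≥ 2. For d = 0 the powers of α are 1, and any injection embeds
  -- the edgeless graph.
  universality zero α 0<α α≤½ n _ N G n≤N _ = universal-zero G (ι-cancel-≤
    (subst₂ _≤_ (sym (ι≡ℕ→ℚ n)) (trans (*-identityˡ (ℕ→ℚ N)) (sym (ι≡ℕ→ℚ N))) n≤N))
  universality (suc d′) α 0<α α≤½ n n-large N G N-large density =
    Sizes.universal α 0<α α≤½ d′ n N G
      (≤-trans (≤-reflexive (sym (*-identityʳ _)))
        (clear-α (400 ℕ.* (d ℕ.* d)) (subst (λ x → 1ℚ ≤ pow α (400 ℕ.* (d ℕ.* d)) * x) (sym (ι≡ℕ→ℚ n)) n-large)))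
      (clear-α (400 ℕ.* d) (subst₂ (λ x y → x ≤ pow α (400 ℕ.* d) * y) (sym (ι≡ℕ→ℚ n)) (sym (ι≡ℕ→ℚ N)) N-large))
      (subst₂ (λ x y → α * x ≤ y) (sym (ι≡ℕ→ℚ (N ℕ.* (N ℕ.∸ 1)))) (sym (ι≡ℕ→ℚ (orderedEdgeCount G))) density)
    where
    open Powers α 0<α α≤½
    d = suc d′

open import Data.Nat using (ℕ; _*_)
open import Data.Integer using (+_)
open import Data.Rational using (ℚ; _/_; _≤_; _<_; 0ℚ) renaming (_*_ to _*ℚ_)
open import Data.Product using (Σ; _,_)

theorem1p2 : Σ ℕ λ c →
    (d : ℕ) (α : ℚ) → 0ℚ < α → α ≤ (+ 1) / 2 →
    (n : ℕ) → (+ 1) / 1 ≤ pow α (c * (d * d)) *ℚ ℕ→ℚ n →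
    (N : ℕ) (G : Graph N) → ℕ→ℚ n ≤ pow α (c * d) *ℚ ℕ→ℚ N →
    DensityAtLeast α G →
    UniversalDegBip d n G
-- A generous common coefficient: `64M≤` uses the exponent 6 + 34d, and `L²-exponent` uses 126d² +
-- 2d + 4.
theorem1p2 = 400 , Universality.universality
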